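{- Let $\beta:=\sqrt{7+2\sqrt2}$, $\alpha:=1+\sqrt2+\beta$, $\gamma:=\sqrt{16+\alpha^2}$. The limits $$p_\bot:=\lim_{n\to\infty}\frac{f_n}{g_n},\qquad p_a:=\lim_{n\to\infty}\frac{a_n}{g_n},\qquad p_b:=\lim_{n\to\infty}\frac{b_n}{g_n},\qquad p_\top:=\lim_{n\to\infty}\frac{t_n}{g_n}$$ exist and satisfy $p_\bot+p_a+p_b+p_\top=1$. Moreover, $$p_\bot=\frac12-\frac{\sqrt2}{4},\qquad p_a=\frac{2+\sqrt2}{2\alpha\beta},\qquad p_b=\frac{(2+\sqrt2)\,\alpha}{\beta\,\gamma\,(\alpha+\gamma)},\qquad p_\top=\frac{(2+\sqrt2)\,\alpha\,(\alpha+\gamma)}{16\,\beta\,\gamma}.$$ In particular $p_\top\approx 0.684122210733017786\ldots$.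
   Context: Let $V_4=\{0<a<b<1\}$ be a four-element chain with Gödel implication $x\Rightarrow_G y=1$ if $x\le y$ and $x\Rightarrow_G y=y$ if $x>y$. For $n\ge1$, consider the $C_{n-1}$ full bracketings of $p_1\Rightarrow_G p_2\Rightarrow_G\cdots\Rightarrow_G p_n$ in $n$ distinct variables (equivalently, full binary trees with $n$ ordered leaves $p_1,\dots,p_n$), where $C_k=\frac{1}{k+1}\binom{2k}{k}$ is the Catalan number. Let $f_n,a_n,b_n,t_n$ be the number of pairs (bracketing, valuation $\{p_1,\dots,p_n\}\to V_4$) for which the bracketed formula evaluates to $0,a,b,1$ respectively, and let $g_n=f_n+a_n+b_n+t_n=4^nC_{n-1}$. -}

module Defs where

open import Axiom.UniquenessOfIdentityProofs.WithK using (uip)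
open import Data.Fin as Fin using (Fin; zero; suc)
import Data.Fin.Properties as Fin
open import Data.Integer as ℤ using (ℤ; +_; -[1+_])
import Data.Integer.Properties as ℤ
open import Data.List using (List; []; _∷_; _++_; map; concatMap; length; filter; lookup;
  allFin; cartesianProductWith; cartesianProduct)
open import Data.List.Membership.Propositional using (_∈_; find)
open import Data.List.Membership.Propositional.Properties
  using (∈-++⁺ˡ; ∈-++⁺ʳ; ∈-map⁺; ∈-map⁻; ∈-concatMap⁺; ∈-concatMap⁻; ∈-filter⁺; ∈-filter⁻; ∈-lookup; ∈-allFin;
         ∈-cartesianProduct⁺; ∈-cartesianProductWith⁺; ∈-cartesianProductWith⁻)
open import Data.List.Relation.Unary.All as All using (All; []; _∷_)
import Data.List.Relation.Unary.All.Properties as All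
open import Data.List.Relation.Binary.Disjoint.Propositional using (Disjoint)
open import Data.List.Relation.Unary.AllPairs as AllPairs using ([]; _∷_)
import Data.List.Relation.Unary.AllPairs.Properties as AllPairs
open import Data.List.Relation.Unary.Any as Any using (here; there; index)
open import Data.List.Relation.Unary.Any.Properties using (lookup-index)
open import Data.List.Relation.Unary.Unique.Propositional using (Unique)
import Data.List.Relation.Unary.Unique.Propositional.Properties as Unique
open import Data.Maybe using (Maybe; just; nothing)
open import Data.Nat as ℕ using (ℕ; zero; suc; s≤s; z≤n)
import Data.Nat.DivMod as ℕ
import Data.Nat.Properties as ℕ
open import Data.Product using (Σ; ∃; Σ-syntax; ∃-syntax; _×_; _,_; proj₁; proj₂)
open import Data.Rational as ℚ using (ℚ; mkℚ; 0ℚ; 1ℚ; ½; positive; nonNegative)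
import Data.Rational.Properties as ℚ
open import Data.Rational.Solver using (module +-*-Solver)
open import Data.Rational.Unnormalised as ℚᵘ using (mkℚᵘ)
import Data.Rational.Unnormalised.Properties as ℚᵘ
open import Data.Sum using (_⊎_; inj₁; inj₂)
open import Data.Vec as Vec using (Vec; []; _∷_)
import Data.Vec.Properties as Vec
open import Function using (_∘_; _↔_; mk↔ₛ′; Inverse)
open import Relation.Binary.PropositionalEquality
  using (_≡_; _≢_; refl; sym; trans; cong; cong₂; subst; subst₂)
open import Relation.Nullary using (yes; no; ¬_; contradiction)
open import Relation.Unary using (Decidable)

V₄ : Set
V₄ = Fin 4

-- 0 < a < b < 1
pattern 𝟎 = zero
pattern 𝐚 = suc zero
pattern 𝐛 = suc (suc zero)
pattern 𝟏 = suc (suc (suc zero))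

infixr 5 _⇒G_
_⇒G_ : V₄ → V₄ → V₄
x ⇒G y with x Fin.≤? y
... | yes _ = 𝟏
... | no  _ = y

infixr 5 _⇒_
data Bracketing : ℕ → Set where
  leaf : Bracketing 1
  _⇒_  : ∀ {m n} → Bracketing m → Bracketing n → Bracketing (m ℕ.+ n)

Valuation : ℕ → Set
Valuation n = Vec V₄ n

eval : ∀ {n} → Bracketing n → Valuation n → V₄
eval leaf          (x ∷ []) = x
eval (_⇒_ {m} s t) v        = eval s (Vec.take m v) ⇒G eval t (Vec.drop m v)

splits : ∀ n → List (∃[ i ] ∃[ j ] i ℕ.+ j ≡ n)
splits zero    = (0 , 0 , refl) ∷ []
splits (suc n) = (0 , suc n , refl) ∷ map (λ (i , j , i+j≡n) → suc i , j , cong suc i+j≡n) (splits n)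

leaves : ∀ n → List (Bracketing n)
leaves 1 = leaf ∷ []
leaves _ = []

-- bracketings< h n lists the trees with n leaves and height less than h; a tree
-- with n leaves has height less than n.
mutual
  bracketings< : ℕ → ∀ n → List (Bracketing n)
  bracketings< zero    n = []
  bracketings< (suc h) n = leaves n ++ concatMap (nodes h) (splits n)

  nodes : ∀ h {n} → ∃[ i ] ∃[ j ] i ℕ.+ j ≡ n → List (Bracketing n)
  nodes h (i , j , refl) = cartesianProductWith _⇒_ (bracketings< h i) (bracketings< h j)

bracketings : ∀ n → List (Bracketing n)
bracketings n = bracketings< n n

valuations : ∀ n → List (Valuation n)
valuations zero    = [] ∷ []
valuations (suc n) = cartesianProductWith _∷_ (allFin 4) (valuations n)

HasValue : ∀ {n} → V₄ → Bracketing n × Valuation n → Set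
HasValue c (t , v) = eval t v ≡ c

hasValue? : ∀ {n} c → Decidable (HasValue {n} c)
hasValue? c (t , v) = eval t v Fin.≟ c

-- The enumeration has neither gaps nor repetitions: see count-correct.
count : V₄ → ℕ → ℕ
count c n = length (filter (hasValue? c) (cartesianProduct (bracketings n) (valuations n)))

∈-splits : ∀ i j → (i , j , refl) ∈ splits (i ℕ.+ j)
∈-splits zero    zero    = here refl
∈-splits zero    (suc j) = here refl
∈-splits (suc i) j       = there (∈-map⁺ _ (∈-splits i j))

leaves≥1 : ∀ {n} → Bracketing n → 1 ℕ.≤ n
leaves≥1 leaf    = s≤s z≤n
leaves≥1 (s ⇒ t) = ℕ.≤-trans (leaves≥1 s) (ℕ.m≤m+n _ _)

∈-bracketings< : ∀ {h n} → n ℕ.≤ h → (t : Bracketing n) → t ∈ bracketings< h n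
∈-bracketings< {zero}  n≤h t = contradiction (ℕ.≤-trans (leaves≥1 t) n≤h) λ ()
∈-bracketings< {suc h} n≤h leaf = here refl
∈-bracketings< {suc h} n≤h (_⇒_ {m} {n} s t) =
  ∈-++⁺ʳ (leaves (m ℕ.+ n)) (∈-concatMap⁺ (nodes h) (Any.map (λ where refl → in-nodes) (∈-splits m n)))
  where
  m≤h : m ℕ.≤ h
  m≤h = ℕ.s≤s⁻¹ (ℕ.≤-trans (ℕ.≤-reflexive (ℕ.+-comm 1 m)) (ℕ.≤-trans (ℕ.+-monoʳ-≤ m (leaves≥1 t)) n≤h))
  n≤h′ : n ℕ.≤ h
  n≤h′ = ℕ.s≤s⁻¹ (ℕ.≤-trans (ℕ.+-monoˡ-≤ n (leaves≥1 s)) n≤h)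
  in-nodes : s ⇒ t ∈ nodes h (m , n , refl)
  in-nodes = ∈-cartesianProductWith⁺ _⇒_ (∈-bracketings< m≤h s) (∈-bracketings< n≤h′ t)

∈-bracketings : ∀ {n} (t : Bracketing n) → t ∈ bracketings n
∈-bracketings = ∈-bracketings< ℕ.≤-refl

∈-valuations : ∀ {n} (v : Valuation n) → v ∈ valuations n
∈-valuations []      = here refl
∈-valuations (x ∷ v) = ∈-cartesianProductWith⁺ _∷_ (∈-allFin x) (∈-valuations v)

leftSize : ∀ {n} → Bracketing n → ℕ
leftSize leaf          = 0
leftSize (_⇒_ {m} _ _) = m

subtrees : ∀ {n} → Bracketing n → Maybe (∃[ i ] ∃[ j ] (Bracketing i × Bracketing j))
subtrees leaf    = nothing
subtrees (s ⇒ t) = just (_ , _ , s , t)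

⇒-injective : ∀ {m n} {s s′ : Bracketing m} {t t′ : Bracketing n} → s ⇒ t ≡ s′ ⇒ t′ → s ≡ s′ × t ≡ t′
⇒-injective eq with cong subtrees eq
... | refl = refl , refl

∈-nodes⁻ : ∀ h {n} p {t : Bracketing n} → t ∈ nodes h p → leftSize t ≡ proj₁ p × 1 ℕ.≤ leftSize t
∈-nodes⁻ h (i , j , refl) t∈
  with ∈-cartesianProductWith⁻ _⇒_ (bracketings< h i) (bracketings< h j) t∈
... | s , _ , _ , _ , refl = refl , leaves≥1 s

splits-unique : ∀ n → AllPairs.AllPairs (λ p q → proj₁ p ≢ proj₁ q) (splits n)
splits-unique zero    = [] ∷ []
splits-unique (suc n) =
  All.map⁺ (All.universal (λ _ ()) (splits n)) ∷
  AllPairs.map⁺ (AllPairs.map (λ i≢i′ → i≢i′ ∘ ℕ.suc-injective) (splits-unique n))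

leaves-unique : ∀ n → Unique (leaves n)
leaves-unique 0             = []
leaves-unique 1             = [] ∷ []
leaves-unique (suc (suc _)) = []

leaves-leftSize : ∀ n {t : Bracketing n} → t ∈ leaves n → leftSize t ≡ 0
leaves-leftSize 1 (here refl) = refl

bracketings<-unique : ∀ h n → Unique (bracketings< h n)
bracketings<-unique zero    n = []
bracketings<-unique (suc h) n = Unique.++⁺ (leaves-unique n)
  (Unique.concat⁺
    (All.map⁺ (All.universal nodes-unique (splits n)))
    (AllPairs.map⁺ (AllPairs.map (λ {p} {q} → nodes-disjoint p q) (splits-unique n))))
  (λ (t∈leaves , t∈nodes) → leaf∉nodes t∈leaves t∈nodes)
  where
  nodes-unique : ∀ p → Unique (nodes h p)
  nodes-unique (i , j , refl) =
    Unique.cartesianProductWith⁺ _⇒_ ⇒-injective (bracketings<-unique h i) (bracketings<-unique h j)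
  nodes-disjoint : ∀ p q → proj₁ p ≢ proj₁ q → Disjoint (nodes h {n} p) (nodes h q)
  nodes-disjoint p q i≢i′ (t∈p , t∈q) =
    i≢i′ (trans (sym (proj₁ (∈-nodes⁻ h p t∈p))) (proj₁ (∈-nodes⁻ h q t∈q)))
  leaf∉nodes : ∀ {t} → t ∈ leaves n → ¬ t ∈ concatMap (nodes h) (splits n)
  leaf∉nodes t∈leaves t∈nodes with find (∈-concatMap⁻ (nodes h) {xs = splits n} t∈nodes)
  ... | p , _ , t∈p = ℕ.<⇒≢ (proj₂ (∈-nodes⁻ h p t∈p)) (sym (leaves-leftSize n t∈leaves))

valuations-unique : ∀ n → Unique (valuations n)
valuations-unique zero    = [] ∷ []
valuations-unique (suc n) =
  Unique.cartesianProductWith⁺ _∷_ Vec.∷-injective (Unique.allFin⁺ 4) (valuations-unique n)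

lookup-injective : ∀ {A : Set} {xs : List A} → Unique xs → ∀ i j → lookup xs i ≡ lookup xs j → i ≡ j
lookup-injective (_   ∷ _) zero    zero    _  = refl
lookup-injective (x∉  ∷ _) zero    (suc j) eq = contradiction eq (All.lookup x∉ (∈-lookup j))
lookup-injective (x∉  ∷ _) (suc i) zero    eq = contradiction (sym eq) (All.lookup x∉ (∈-lookup i))
lookup-injective (_   ∷ u) (suc i) (suc j) eq = cong suc (lookup-injective u i j eq)

module _ {A : Set} {P : A → Set} (P? : Decidable P) (P-irr : ∀ {x} (p q : P x) → p ≡ q)
         {xs : List A} (complete : ∀ x → x ∈ xs) (unique : Unique xs) where

  Σ↔Fin : Σ A P ↔ Fin (length (filter P? xs))
  Σ↔Fin = mk↔ₛ′ (λ (x , p) → index (mem x p))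
    (λ i → lookup ys i , proj₂ (∈-filter⁻ P? {xs = xs} (∈-lookup i)))
    (λ i → lookup-injective (Unique.filter⁺ P? unique) _ _ (sym (lookup-index (mem (lookup ys i) _))))
    (λ (x , p) → Σ-≡ (sym (lookup-index (mem x p))))
    where
    ys : List A
    ys = filter P? xs
    mem : ∀ x → P x → x ∈ ys
    mem x p = ∈-filter⁺ P? (complete x) p
    Σ-≡ : ∀ {x y} {p : P x} {q : P y} → x ≡ y → (x , p) ≡ (y , q)
    Σ-≡ refl = cong (_ ,_) (P-irr _ _)

count-correct : ∀ c n → Σ (Bracketing n × Valuation n) (HasValue c) ↔ Fin (count c n)
count-correct c n = Σ↔Fin (hasValue? c) uip
  (λ (t , v) → ∈-cartesianProduct⁺ (∈-bracketings t) (∈-valuations v))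
  (Unique.cartesianProduct⁺ (bracketings<-unique n n) (valuations-unique n))

comb : ∀ n → Bracketing (suc n)
comb zero    = leaf
comb (suc n) = leaf ⇒ comb n

Eventually : (ℕ → Set) → Set
Eventually P = ∃[ N ] (∀ n → N ℕ.≤ n → P n)

-- The quantifier ∃[ N ] is a Σ-type, so a Cauchy sequence carries its modulus.
Cauchy : (ℕ → ℚ) → Set
Cauchy x = ∀ ε → 0ℚ ℚ.< ε →
  ∃[ N ] (∀ m n → N ℕ.≤ m → N ℕ.≤ n → ℚ.∣ x m ℚ.- x n ∣ ℚ.< ε)

-- The intended equality is _≃_, not _≡_.
record ℝ : Set where
  constructor mkℝ
  field
    at     : ℕ → ℚ
    cauchy : Cauchy at

open ℝ public

infix 4 _≃_ _<_ _≤_ _#_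

_≃_ : ℝ → ℝ → Set
x ≃ y = ∀ ε → 0ℚ ℚ.< ε → Eventually λ n → ℚ.∣ at x n ℚ.- at y n ∣ ℚ.< ε

_<_ : ℝ → ℝ → Set
x < y = ∃[ δ ] (0ℚ ℚ.< δ × Eventually λ n → at x n ℚ.+ δ ℚ.≤ at y n)

_≤_ : ℝ → ℝ → Set
x ≤ y = ∀ ε → 0ℚ ℚ.< ε → Eventually λ n → at x n ℚ.≤ at y n ℚ.+ ε

_#_ : ℝ → ℝ → Set
x # y = x < y ⊎ y < x

pos½ : ∀ {ε} → 0ℚ ℚ.< ε → 0ℚ ℚ.< ½ ℚ.* ε
pos½ 0<ε = ℚ.*-monoʳ-<-pos ½ 0<ε

halves : ∀ ε → ½ ℚ.* ε ℚ.+ ½ ℚ.* ε ≡ ε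
halves ε = trans (sym (ℚ.*-distribʳ-+ ε ½ ½)) (ℚ.*-identityˡ ε)

0<1 : 0ℚ ℚ.< 1ℚ
0<1 = ℚ.positive⁻¹ 1ℚ

*-pos : ∀ {p q} → 0ℚ ℚ.< p → 0ℚ ℚ.< q → 0ℚ ℚ.< p ℚ.* q
*-pos {p} {q} 0<p 0<q =
  ℚ.positive⁻¹ _ {{ℚ.pos*pos⇒pos p {{positive 0<p}} q {{positive 0<q}}}}

+-pos : ∀ {p q} → 0ℚ ℚ.≤ p → 0ℚ ℚ.< q → 0ℚ ℚ.< p ℚ.+ q
+-pos = ℚ.+-mono-≤-<

*-mono-≤ : ∀ {p q r s} → 0ℚ ℚ.≤ q → 0ℚ ℚ.≤ r → p ℚ.≤ q → r ℚ.≤ s → p ℚ.* r ℚ.≤ q ℚ.* s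
*-mono-≤ {p} {q} {r} {s} 0≤q 0≤r p≤q r≤s = ℚ.≤-trans
  (ℚ.*-monoʳ-≤-nonNeg r {{nonNegative 0≤r}} p≤q)
  (ℚ.*-monoˡ-≤-nonNeg q {{nonNegative 0≤q}} r≤s)

∣-∣-swap : ∀ p q → ℚ.∣ p ℚ.- q ∣ ≡ ℚ.∣ q ℚ.- p ∣
∣-∣-swap p q = trans (sym (ℚ.∣-p∣≡∣p∣ (p ℚ.- q)))
  (cong ℚ.∣_∣ (solve 2 (λ p q → :- (p :- q) := q :- p) refl p q))
  where open +-*-Solver

p≤∣p∣ : ∀ p → p ℚ.≤ ℚ.∣ p ∣
p≤∣p∣ p with ℚ.≤-total 0ℚ p
... | inj₁ 0≤p = ℚ.≤-reflexive (sym (ℚ.0≤p⇒∣p∣≡p 0≤p))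
... | inj₂ p≤0 = ℚ.≤-trans p≤0 (ℚ.0≤∣p∣ p)

∣p∣<r : ∀ {p r} → p ℚ.< r → ℚ.- p ℚ.< r → ℚ.∣ p ∣ ℚ.< r
∣p∣<r {p} p<r -p<r with ℚ.∣p∣≡p∨∣p∣≡-p p
... | inj₁ eq = subst (ℚ._< _) (sym eq) p<r
... | inj₂ eq = subst (ℚ._< _) (sym eq) -p<r

<-shift : ∀ {p q r} → p ℚ.- q ℚ.< r → p ℚ.< q ℚ.+ r
<-shift {p} {q} {r} h = subst (ℚ._< q ℚ.+ r)
  (solve 2 (λ p q → q :+ (p :- q) := p) refl p q) (ℚ.+-monoʳ-< q h)
  where open +-*-Solver

<-unshift : ∀ {p q r} → p ℚ.< q ℚ.+ r → p ℚ.- q ℚ.< r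
<-unshift {p} {q} {r} h = subst (p ℚ.- q ℚ.<_)
  (solve 2 (λ q r → (q :+ r) :- q := r) refl q r) (ℚ.+-monoˡ-< (ℚ.- q) h)
  where open +-*-Solver

∣p-q∣<r⇒p<q+r : ∀ {p q r} → ℚ.∣ p ℚ.- q ∣ ℚ.< r → p ℚ.< q ℚ.+ r
∣p-q∣<r⇒p<q+r {p} {q} h = <-shift (ℚ.≤-<-trans (p≤∣p∣ (p ℚ.- q)) h)

∣p-q∣<r : ∀ {p q r} → p ℚ.< q ℚ.+ r → q ℚ.< p ℚ.+ r → ℚ.∣ p ℚ.- q ∣ ℚ.< r
∣p-q∣<r {p} {q} {r} p<q+r q<p+r = ∣p∣<r (<-unshift p<q+r)
  (subst (ℚ._< r) (solve 2 (λ p q → q :- p := :- (p :- q)) refl p q) (<-unshift q<p+r))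
  where open +-*-Solver

∣p∣-∣q∣≤∣p-q∣ : ∀ p q → ℚ.∣ p ∣ ℚ.- ℚ.∣ q ∣ ℚ.≤ ℚ.∣ p ℚ.- q ∣
∣p∣-∣q∣≤∣p-q∣ p q = subst (ℚ.∣ p ∣ ℚ.- ℚ.∣ q ∣ ℚ.≤_)
  (solve 2 (λ u v → (u :+ v) :- v := u) refl ℚ.∣ p ℚ.- q ∣ ℚ.∣ q ∣)
  (ℚ.+-monoˡ-≤ (ℚ.- ℚ.∣ q ∣) (subst (λ r → ℚ.∣ r ∣ ℚ.≤ ℚ.∣ p ℚ.- q ∣ ℚ.+ ℚ.∣ q ∣)
    (solve 2 (λ p q → (p :- q) :+ q := p) refl p q) (ℚ.∣p+q∣≤∣p∣+∣q∣ (p ℚ.- q) q)))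
  where open +-*-Solver

∣∣p∣-∣q∣∣≤∣p-q∣ : ∀ p q → ℚ.∣ ℚ.∣ p ∣ ℚ.- ℚ.∣ q ∣ ∣ ℚ.≤ ℚ.∣ p ℚ.- q ∣
∣∣p∣-∣q∣∣≤∣p-q∣ p q with ℚ.∣p∣≡p∨∣p∣≡-p (ℚ.∣ p ∣ ℚ.- ℚ.∣ q ∣)
... | inj₁ eq = subst (ℚ._≤ ℚ.∣ p ℚ.- q ∣) (sym eq) (∣p∣-∣q∣≤∣p-q∣ p q)
... | inj₂ eq = subst (ℚ._≤ ℚ.∣ p ℚ.- q ∣) (sym eq) (subst₂ ℚ._≤_
    (solve 2 (λ u v → v :- u := :- (u :- v)) refl ℚ.∣ p ∣ ℚ.∣ q ∣) (∣-∣-swap q p) (∣p∣-∣q∣≤∣p-q∣ q p))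
  where open +-*-Solver

scale : ∀ {B ε} → 0ℚ ℚ.< B → 0ℚ ℚ.< ε → ∃[ δ ] (0ℚ ℚ.< δ × B ℚ.* δ ≡ ε)
scale {B} {ε} 0<B 0<ε = B⁻¹ ℚ.* ε , *-pos 0<B⁻¹ 0<ε ,
  trans (sym (ℚ.*-assoc B B⁻¹ ε)) (trans (cong (ℚ._* ε) (ℚ.*-inverseʳ B)) (ℚ.*-identityˡ ε))
  where
  instance
    B-pos = positive 0<B
    B-nz = ℚ.pos⇒nonZero B {{positive 0<B}}
  B⁻¹ = ℚ.1/ B
  0<B⁻¹ = ℚ.positive⁻¹ B⁻¹ {{ℚ.1/pos⇒pos B}}

bounded : ∀ {x} → Cauchy x → ∃[ B ] (0ℚ ℚ.< B × Eventually λ n → ℚ.∣ x n ∣ ℚ.< B)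
bounded {x} cx with cx 1ℚ 0<1
... | N , close = ℚ.∣ x N ∣ ℚ.+ 1ℚ , +-pos (ℚ.0≤∣p∣ (x N)) 0<1 , N ,
  λ n N≤n → ∣p-q∣<r⇒p<q+r (ℚ.≤-<-trans (∣∣p∣-∣q∣∣≤∣p-q∣ (x n) (x N)) (close n N N≤n ℕ.≤-refl))

real : ℚ → ℝ
real q = mkℝ (λ _ → q) λ ε 0<ε → 0 , λ _ _ _ _ → subst (λ d → ℚ.∣ d ∣ ℚ.< ε) (sym (ℚ.+-inverseʳ q)) 0<ε

0ℝ 1ℝ : ℝ
0ℝ = real 0ℚ
1ℝ = real 1ℚ

nat : ℕ → ℝ
nat n = real (+ n ℚ./ 1)

infix  8 -_
infixl 7 _*_
infixl 6 _+_ _-_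

_+_ : ℝ → ℝ → ℝ
mkℝ x cx + mkℝ y cy = mkℝ (λ n → x n ℚ.+ y n) λ ε 0<ε →
  let M , closeˣ = cx (½ ℚ.* ε) (pos½ 0<ε)
      N , closeʸ = cy (½ ℚ.* ε) (pos½ 0<ε)
  in M ℕ.⊔ N , λ m n ≤m ≤n → subst (ℚ.∣ (x m ℚ.+ y m) ℚ.- (x n ℚ.+ y n) ∣ ℚ.<_) (halves ε)
       (ℚ.≤-<-trans
         (subst (λ d → ℚ.∣ d ∣ ℚ.≤ ℚ.∣ x m ℚ.- x n ∣ ℚ.+ ℚ.∣ y m ℚ.- y n ∣)
           (solve 4 (λ a b c d → (a :- b) :+ (c :- d) := (a :+ c) :- (b :+ d)) refl (x m) (x n) (y m) (y n))
           (ℚ.∣p+q∣≤∣p∣+∣q∣ (x m ℚ.- x n) (y m ℚ.- y n)))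
         (ℚ.+-mono-< (closeˣ m n (ℕ.m⊔n≤o⇒m≤o M N ≤m) (ℕ.m⊔n≤o⇒m≤o M N ≤n))
                     (closeʸ m n (ℕ.m⊔n≤o⇒n≤o M N ≤m) (ℕ.m⊔n≤o⇒n≤o M N ≤n))))
  where open +-*-Solver

-_ : ℝ → ℝ
- mkℝ x cx = mkℝ (λ n → ℚ.- x n) λ ε 0<ε →
  let N , close = cx ε 0<ε
  in N , λ m n ≤m ≤n → subst (ℚ._< ε)
       (trans (∣-∣-swap (x m) (x n))
         (cong ℚ.∣_∣ (solve 2 (λ p q → q :- p := :- p :- :- q) refl (x m) (x n))))
       (close m n ≤m ≤n)
  where open +-*-Solver

_-_ : ℝ → ℝ → ℝ
x - y = x + - y

∣_∣ : ℝ → ℝ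
∣ mkℝ x cx ∣ = mkℝ (λ n → ℚ.∣ x n ∣) λ ε 0<ε →
  let N , close = cx ε 0<ε
  in N , λ m n ≤m ≤n → ℚ.≤-<-trans (∣∣p∣-∣q∣∣≤∣p-q∣ (x m) (x n)) (close m n ≤m ≤n)

*-mono-< : ∀ {p q r s} → 0ℚ ℚ.≤ p → p ℚ.≤ q → 0ℚ ℚ.≤ r → 0ℚ ℚ.< q → r ℚ.< s → p ℚ.* r ℚ.< q ℚ.* s
*-mono-< {p} {q} {r} {s} 0≤p p≤q 0≤r 0<q r<s = ℚ.≤-<-trans
  (ℚ.*-monoʳ-≤-nonNeg r {{nonNegative 0≤r}} p≤q) (ℚ.*-monoʳ-<-pos q {{positive 0<q}} r<s)

_*_ : ℝ → ℝ → ℝ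
mkℝ x cx * mkℝ y cy = mkℝ (λ n → x n ℚ.* y n) λ ε 0<ε →
  let B , 0<B , Nˣ , x-bound = bounded cx
      C , 0<C , Nʸ , y-bound = bounded cy
      δ , 0<δ , Bδ≡½ε = scale 0<B (pos½ 0<ε)
      η , 0<η , Cη≡½ε = scale 0<C (pos½ 0<ε)
      M , closeˣ = cx η 0<η
      N , closeʸ = cy δ 0<δ
      K = Nˣ ℕ.⊔ Nʸ
      L = M ℕ.⊔ N
  in K ℕ.⊔ L , λ m n ≤m ≤n →
       let K≤m = ℕ.m⊔n≤o⇒m≤o K L ≤m ; K≤n = ℕ.m⊔n≤o⇒m≤o K L ≤n
           L≤m = ℕ.m⊔n≤o⇒n≤o K L ≤m ; L≤n = ℕ.m⊔n≤o⇒n≤o K L ≤n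
       in subst (ℚ.∣ x m ℚ.* y m ℚ.- x n ℚ.* y n ∣ ℚ.<_) (trans (cong₂ ℚ._+_ Bδ≡½ε Cη≡½ε) (halves ε))
         (ℚ.≤-<-trans
           (subst₂ ℚ._≤_
             (cong ℚ.∣_∣ (solve 4 (λ a b c d → a :* (c :- d) :+ d :* (a :- b) := a :* c :- b :* d) refl
               (x m) (x n) (y m) (y n)))
             (cong₂ ℚ._+_ (ℚ.∣p*q∣≡∣p∣*∣q∣ (x m) (y m ℚ.- y n)) (ℚ.∣p*q∣≡∣p∣*∣q∣ (y n) (x m ℚ.- x n)))
             (ℚ.∣p+q∣≤∣p∣+∣q∣ (x m ℚ.* (y m ℚ.- y n)) (y n ℚ.* (x m ℚ.- x n))))
           (ℚ.+-mono-<
             (*-mono-< (ℚ.0≤∣p∣ (x m)) (ℚ.<⇒≤ (x-bound m (ℕ.m⊔n≤o⇒m≤o Nˣ Nʸ K≤m))) (ℚ.0≤∣p∣ _) 0<B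
               (closeʸ m n (ℕ.m⊔n≤o⇒n≤o M N L≤m) (ℕ.m⊔n≤o⇒n≤o M N L≤n)))
             (*-mono-< (ℚ.0≤∣p∣ (y n)) (ℚ.<⇒≤ (y-bound n (ℕ.m⊔n≤o⇒n≤o Nˣ Nʸ K≤n))) (ℚ.0≤∣p∣ _) 0<C
               (closeˣ m n (ℕ.m⊔n≤o⇒m≤o M N L≤m) (ℕ.m⊔n≤o⇒m≤o M N L≤n)))))
  where open +-*-Solver

-- Total on ℚ with recip 0 = 0, since finitely many approximants of a nonzero
-- real may vanish.
recip : ℚ → ℚ
recip p with p ℚ.≟ 0ℚ
... | yes _  = 0ℚ
... | no p≢0 = (ℚ.1/ p) {{ℚ.≢-nonZero p≢0}}

recip-inverse : ∀ p → p ≢ 0ℚ → p ℚ.* recip p ≡ 1ℚ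
recip-inverse p p≢0 with p ℚ.≟ 0ℚ
... | yes p≡0 = contradiction p≡0 p≢0
... | no  p≢0 = ℚ.*-inverseʳ p {{ℚ.≢-nonZero p≢0}}

apart : ∀ {x} → x # 0ℝ → ∃[ δ ] (0ℚ ℚ.< δ × Eventually λ n → δ ℚ.≤ ℚ.∣ at x n ∣)
apart {x} (inj₁ (δ , 0<δ , N , h)) = δ , 0<δ , N , λ n N≤n →
  ℚ.≤-trans
    (subst (ℚ._≤ ℚ.- at x n) (solve 2 (λ x δ → (x :+ δ) :- x := δ) refl (at x n) δ)
      (subst (at x n ℚ.+ δ ℚ.- at x n ℚ.≤_) (ℚ.+-identityˡ _) (ℚ.+-monoˡ-≤ (ℚ.- at x n) (h n N≤n))))
    (subst (ℚ.- at x n ℚ.≤_) (ℚ.∣-p∣≡∣p∣ (at x n)) (p≤∣p∣ (ℚ.- at x n)))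
  where open +-*-Solver
apart {x} (inj₂ (δ , 0<δ , N , h)) = δ , 0<δ , N , λ n N≤n →
  ℚ.≤-trans (subst (ℚ._≤ at x n) (ℚ.+-identityˡ δ) (h n N≤n)) (p≤∣p∣ (at x n))

0<∣p∣⇒p≢0 : ∀ {δ p} → 0ℚ ℚ.< δ → δ ℚ.≤ ℚ.∣ p ∣ → p ≢ 0ℚ
0<∣p∣⇒p≢0 0<δ δ≤ refl = ℚ.<-irrefl refl (ℚ.<-≤-trans 0<δ δ≤)

recip-bound : ∀ {δ D p} → 0ℚ ℚ.< δ → 0ℚ ℚ.< D → δ ℚ.* D ≡ 1ℚ → δ ℚ.≤ ℚ.∣ p ∣ → ℚ.∣ recip p ∣ ℚ.≤ D
recip-bound {δ} {D} {p} 0<δ 0<D δD≡1 δ≤ = subst₂ ℚ._≤_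
  (trans (trans (ℚ.*-assoc u δ D) (cong (u ℚ.*_) δD≡1)) (ℚ.*-identityʳ u))
  (trans (cong (ℚ._* D) (trans (sym (ℚ.∣p*q∣≡∣p∣*∣q∣ (recip p) p))
      (cong ℚ.∣_∣ (trans (ℚ.*-comm (recip p) p) (recip-inverse p (0<∣p∣⇒p≢0 0<δ δ≤))))))
    (ℚ.*-identityˡ D))
  (ℚ.*-monoʳ-≤-nonNeg D {{nonNegative (ℚ.<⇒≤ 0<D)}} (ℚ.*-monoˡ-≤-nonNeg u {{nonNegative (ℚ.0≤∣p∣ (recip p))}} δ≤))
  where u = ℚ.∣ recip p ∣

infix 8 _⁻¹[_]
_⁻¹[_] : ∀ x → x # 0ℝ → ℝ
x ⁻¹[ x#0 ] = mkℝ (λ n → recip (at x n)) λ ε 0<ε →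
  let δ , 0<δ , M , δ≤ = apart {x} x#0
      D , 0<D , δD≡1 = scale 0<δ 0<1
      η , 0<η , DDη≡ε = scale (*-pos 0<D 0<D) 0<ε
      N , close = cauchy x η 0<η
  in M ℕ.⊔ N , λ m n ≤m ≤n →
     let p = at x m ; q = at x n ; u = recip p ; v = recip q
         δ≤p = δ≤ m (ℕ.m⊔n≤o⇒m≤o M N ≤m) ; δ≤q = δ≤ n (ℕ.m⊔n≤o⇒m≤o M N ≤n)
         pu≡1 = recip-inverse p (0<∣p∣⇒p≢0 0<δ δ≤p)
         qv≡1 = recip-inverse q (0<∣p∣⇒p≢0 0<δ δ≤q)
         u-v : (u ℚ.* v) ℚ.* (q ℚ.- p) ≡ u ℚ.- v
         u-v = trans (solve 4 (λ p q u v → (u :* v) :* (q :- p) := u :* (q :* v) :- v :* (p :* u)) refl p q u v)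
                 (cong₂ ℚ._-_ (trans (cong (u ℚ.*_) qv≡1) (ℚ.*-identityʳ u))
                              (trans (cong (v ℚ.*_) pu≡1) (ℚ.*-identityʳ v)))
     in subst₂ ℚ._<_
          (trans (cong₂ ℚ._*_ (sym (ℚ.∣p*q∣≡∣p∣*∣q∣ u v)) (∣-∣-swap p q))
            (trans (sym (ℚ.∣p*q∣≡∣p∣*∣q∣ (u ℚ.* v) (q ℚ.- p))) (cong ℚ.∣_∣ u-v)))
          DDη≡ε
          (*-mono-< (subst (0ℚ ℚ.≤_) (ℚ.∣p*q∣≡∣p∣*∣q∣ u v) (ℚ.0≤∣p∣ (u ℚ.* v)))
            (*-mono-≤ (ℚ.<⇒≤ 0<D) (ℚ.0≤∣p∣ v) (recip-bound {p = p} 0<δ 0<D δD≡1 δ≤p) (recip-bound {p = q} 0<δ 0<D δD≡1 δ≤q))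
            (ℚ.0≤∣p∣ (p ℚ.- q)) (*-pos 0<D 0<D)
            (close m n (ℕ.m⊔n≤o⇒n≤o M N ≤m) (ℕ.m⊔n≤o⇒n≤o M N ≤n)))
  where open +-*-Solver

⁻¹-inverse : ∀ {x} (x#0 : x # 0ℝ) → x * x ⁻¹[ x#0 ] ≃ 1ℝ
⁻¹-inverse {x} x#0 ε 0<ε =
  let δ , 0<δ , N , δ≤ = apart {x} x#0
  in N , λ n N≤n → subst (λ d → ℚ.∣ d ∣ ℚ.< ε)
       (sym (trans (cong (ℚ._- 1ℚ) (recip-inverse (at x n) (0<∣p∣⇒p≢0 0<δ (δ≤ n N≤n)))) (ℚ.+-inverseʳ 1ℚ)))
       0<ε

infixl 7 _÷_[_]
_÷_[_] : ∀ x y → y # 0ℝ → ℝ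
x ÷ y [ y#0 ] = x * y ⁻¹[ y#0 ]

-- ⌊√n⌋
isqrt : ℕ → ℕ
isqrt zero    = 0
isqrt (suc n) with suc (isqrt n) ℕ.* suc (isqrt n) ℕ.≤? suc n
... | yes _ = suc (isqrt n)
... | no  _ = isqrt n

isqrt-spec : ∀ n → isqrt n ℕ.* isqrt n ℕ.≤ n × n ℕ.< suc (isqrt n) ℕ.* suc (isqrt n)
isqrt-spec zero    = z≤n , s≤s z≤n
isqrt-spec (suc n) with suc (isqrt n) ℕ.* suc (isqrt n) ℕ.≤? suc n | isqrt-spec n
... | yes ≤1+n | _ , n< = ≤1+n , ℕ.≤-<-trans n< (ℕ.*-mono-< {suc r} {2 ℕ.+ r} {suc r} {2 ℕ.+ r} ℕ.≤-refl ℕ.≤-refl)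
  where r = isqrt n
... | no  ≰1+n | ≤n , _ = ℕ.m≤n⇒m≤1+n ≤n , ℕ.≰⇒> ≰1+n

-- ⌊√⌊∣q∣k²⌋⌋ / k with k = suc n
√-approx : ℕ → ℚ → ℚ
√-approx n q = + isqrt ((ℤ.∣ ℚ.↥ q ∣ ℕ.* (suc n ℕ.* suc n)) ℕ./ ℚ.↧ₙ q) ℚ./ suc n

sq : ℚ → ℚ
sq p = p ℚ.* p

frac-sq : ∀ r n → ℚ.toℚᵘ (sq (+ r ℚ./ suc n)) ℚᵘ.≃ mkℚᵘ (+ r) n ℚᵘ.* mkℚᵘ (+ r) n
frac-sq r n = ℚᵘ.≃-trans (ℚ.toℚᵘ-homo-* p p) (ℚᵘ.*-cong p≃ p≃)
  where
  p = + r ℚ./ suc n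
  p≃ : ℚ.toℚᵘ p ℚᵘ.≃ mkℚᵘ (+ r) n
  p≃ = ℚ.toℚᵘ-fromℚᵘ (mkℚᵘ (+ r) n)

√-approx-lower : ∀ n q → sq (√-approx n q) ℚ.≤ ℚ.∣ q ∣
√-approx-lower n q@(mkℚ a d _) = ℚ.toℚᵘ-cancel-≤ (ℚᵘ.≤-respˡ-≃ (ℚᵘ.≃-sym (frac-sq r n))
  (ℚᵘ.*≤* (subst₂ ℤ._≤_ (trans (ℤ.pos-* (r ℕ.* r) (suc d)) (cong (ℤ._* + suc d) (ℤ.pos-* r r)))
    (ℤ.pos-* ℤ.∣ a ∣ (k ℕ.* k)) (ℤ.+≤+ le))))
  where
  k = suc n
  M = (ℤ.∣ a ∣ ℕ.* (k ℕ.* k)) ℕ./ suc d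
  r = isqrt M
  le : r ℕ.* r ℕ.* suc d ℕ.≤ ℤ.∣ a ∣ ℕ.* (k ℕ.* k)
  le = ℕ.≤-trans (ℕ.*-monoˡ-≤ (suc d) (proj₁ (isqrt-spec M))) (ℕ.m/n*n≤m (ℤ.∣ a ∣ ℕ.* (k ℕ.* k)) (suc d))

frac-suc : ∀ r n → + suc r ℚ./ suc n ≡ + r ℚ./ suc n ℚ.+ + 1 ℚ./ suc n
frac-suc r n = ℚ.toℚᵘ-injective (ℚᵘ.≃-trans (ℚ.toℚᵘ-fromℚᵘ (mkℚᵘ (+ suc r) n))
  (ℚᵘ.≃-sym (ℚᵘ.≃-trans (ℚ.toℚᵘ-homo-+ (+ r ℚ./ k) (+ 1 ℚ./ k))
    (ℚᵘ.≃-trans (ℚᵘ.+-cong (ℚ.toℚᵘ-fromℚᵘ (mkℚᵘ (+ r) n)) (ℚ.toℚᵘ-fromℚᵘ (mkℚᵘ (+ 1) n)))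
      (ℚᵘ.*≡* (trans (cong (ℤ._* + k) (trans (sym (ℤ.*-distribʳ-+ (+ k) (+ r) (+ 1))) (cong (ℤ._* + k) (cong +_ (ℕ.+-comm r 1)))))
        (ℤ.*-assoc (+ suc r) (+ k) (+ k))))))))
  where k = suc n

√-approx-upper : ∀ n q → ℚ.∣ q ∣ ℚ.< sq (√-approx n q ℚ.+ + 1 ℚ./ suc n)
√-approx-upper n q@(mkℚ a d _) = subst (λ s → ℚ.∣ q ∣ ℚ.< sq s) (frac-suc r n)
  (ℚ.toℚᵘ-cancel-< (ℚᵘ.<-respʳ-≃ (ℚᵘ.≃-sym (frac-sq (suc r) n))
    (ℚᵘ.*<* (subst₂ ℤ._<_ (ℤ.pos-* ℤ.∣ a ∣ (k ℕ.* k))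
      (trans (ℤ.pos-* (suc r ℕ.* suc r) (suc d)) (cong (ℤ._* + suc d) (ℤ.pos-* (suc r) (suc r)))) (ℤ.+<+ lt)))))
  where
  k = suc n
  A = ℤ.∣ a ∣ ℕ.* (k ℕ.* k)
  M = A ℕ./ suc d
  r = isqrt M
  lt : A ℕ.< suc r ℕ.* suc r ℕ.* suc d
  lt = ℕ.<-≤-trans
    (subst (ℕ._< suc M ℕ.* suc d) (sym (ℕ.m≡m%n+[m/n]*n A (suc d)))
      (ℕ.+-monoˡ-< (M ℕ.* suc d) (ℕ.m%n<n A (suc d))))
    (ℕ.*-monoˡ-≤ (suc d) (proj₂ (isqrt-spec M)))

√-approx-nonNeg : ∀ n q → 0ℚ ℚ.≤ √-approx n q
√-approx-nonNeg n q = ℚ.nonNegative⁻¹ _ {{ℚ.normalize-nonNeg (isqrt ((ℤ.∣ ℚ.↥ q ∣ ℕ.* (suc n ℕ.* suc n)) ℕ./ ℚ.↧ₙ q)) (suc n)}}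

0<1/k : ∀ n → 0ℚ ℚ.< + 1 ℚ./ suc n
0<1/k n = ℚ.positive⁻¹ _ {{ℚ.normalize-pos 1 (suc n)}}

1/k→0 : ∀ {ε} → 0ℚ ℚ.< ε → Eventually λ n → + 1 ℚ./ suc n ℚ.≤ ε
1/k→0 {ε@(mkℚ (+ suc a) d _)} 0<ε = d , λ n d≤n →
  ℚ.toℚᵘ-cancel-≤ (ℚᵘ.≤-respˡ-≃ (ℚᵘ.≃-sym (ℚ.toℚᵘ-fromℚᵘ (mkℚᵘ (+ 1) n)))
    (ℚᵘ.*≤* (ℤ.+≤+ (ℕ.*-mono-≤ {1} {suc a} {suc d} {suc n} (s≤s z≤n) (s≤s d≤n)))))
1/k→0 {mkℚ (+ zero) d _} (ℚ.*<* (ℤ.+<+ ()))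
1/k→0 {mkℚ -[1+ _ ] d _} (ℚ.*<* ())

sq-mono-≤ : ∀ {p q} → 0ℚ ℚ.≤ p → p ℚ.≤ q → sq p ℚ.≤ sq q
sq-mono-≤ 0≤p p≤q = *-mono-≤ (ℚ.≤-trans 0≤p p≤q) 0≤p p≤q p≤q

sq-cancel-< : ∀ {p q} → 0ℚ ℚ.≤ q → sq p ℚ.< sq q → p ℚ.< q
sq-cancel-< {p} {q} 0≤q p²<q² with p ℚ.<? q
... | yes p<q = p<q
... | no  p≮q = contradiction (ℚ.<-≤-trans p²<q² (sq-mono-≤ 0≤q (ℚ.≮⇒≥ p≮q))) (ℚ.<-irrefl refl)

p≤p+q : ∀ p {q} → 0ℚ ℚ.≤ q → p ℚ.≤ p ℚ.+ q
p≤p+q p {q} 0≤q = subst (ℚ._≤ p ℚ.+ q) (ℚ.+-identityʳ p) (ℚ.+-monoʳ-≤ p 0≤q)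

√-close : ∀ {A B s t θ} → 0ℚ ℚ.< θ → 0ℚ ℚ.≤ t → sq s ℚ.≤ A → A ℚ.< B ℚ.+ sq θ → B ℚ.< sq (t ℚ.+ θ) →
  s ℚ.< t ℚ.+ (θ ℚ.+ θ)
√-close {A} {B} {s} {t} {θ} 0<θ 0≤t s²≤A A<B+θ² B<[t+θ]² = sq-cancel-< 0≤t+2θ
  (ℚ.≤-<-trans s²≤A (ℚ.<-trans A<B+θ² (ℚ.<-≤-trans (ℚ.+-monoˡ-< (sq θ) B<[t+θ]²)
    (subst (sq (t ℚ.+ θ) ℚ.+ sq θ ℚ.≤_)
      (solve 2 (λ t θ → ((t :+ θ) :* (t :+ θ) :+ θ :* θ) :+ ((t :+ t :+ θ) :+ θ) :* θ
                := (t :+ (θ :+ θ)) :* (t :+ (θ :+ θ))) refl t θ)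
      (p≤p+q _ (ℚ.<⇒≤ (*-pos (+-pos (ℚ.<⇒≤ (+-pos (ℚ.+-mono-≤ 0≤t 0≤t) 0<θ)) 0<θ) 0<θ)))))))
  where
  open +-*-Solver
  0≤t+2θ = ℚ.+-mono-≤ 0≤t (ℚ.<⇒≤ (+-pos (ℚ.<⇒≤ 0<θ) 0<θ))

-- Computed from ∣ x ∣, since approximants of a nonnegative real may be negative;
-- hence √ x is the nonnegative root of x for 0 ≤ x (√*√ and 0≤√), and a junk
-- value for x < 0.
infix 9 √_
√_ : ℝ → ℝ
√ mkℝ x cx = mkℝ (λ n → √-approx n (x n)) λ ε 0<ε →
  let θ = ½ ℚ.* ε
      0<θ = pos½ 0<ε
      M , 1/k≤θ = 1/k→0 0<θ
      N , close = cx (sq θ) (*-pos 0<θ 0<θ)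
      one-sided : ∀ m n → M ℕ.⊔ N ℕ.≤ m → M ℕ.⊔ N ℕ.≤ n → √-approx m (x m) ℚ.< √-approx n (x n) ℚ.+ ε
      one-sided m n ≤m ≤n =
        subst (λ η → √-approx m (x m) ℚ.< √-approx n (x n) ℚ.+ η) (halves ε)
          (√-close 0<θ (√-approx-nonNeg n (x n)) (√-approx-lower m (x m))
            (∣p-q∣<r⇒p<q+r (ℚ.≤-<-trans (∣∣p∣-∣q∣∣≤∣p-q∣ (x m) (x n))
              (close m n (ℕ.m⊔n≤o⇒n≤o M N ≤m) (ℕ.m⊔n≤o⇒n≤o M N ≤n))))
            (ℚ.<-≤-trans (√-approx-upper n (x n))
              (sq-mono-≤ (ℚ.<⇒≤ (+-pos (√-approx-nonNeg n (x n)) (0<1/k n)))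
                (ℚ.+-monoʳ-≤ (√-approx n (x n)) (1/k≤θ n (ℕ.m⊔n≤o⇒m≤o M N ≤n))))))
  in M ℕ.⊔ N , λ m n ≤m ≤n → ∣p-q∣<r (one-sided m n ≤m ≤n) (one-sided n m ≤n ≤m)

0<⇒at : ∀ {x} → 0ℝ < x → ∃[ δ ] (0ℚ ℚ.< δ × Eventually λ n → δ ℚ.≤ at x n)
0<⇒at {x} (δ , 0<δ , N , h) = δ , 0<δ , N , λ n N≤n → subst (ℚ._≤ at x n) (ℚ.+-identityˡ δ) (h n N≤n)

at⇒0< : ∀ {x δ} → 0ℚ ℚ.< δ → Eventually (λ n → δ ℚ.≤ at x n) → 0ℝ < x
at⇒0< {x} {δ} 0<δ (N , h) = δ , 0<δ , N , λ n N≤n → subst (ℚ._≤ at x n) (sym (ℚ.+-identityˡ δ)) (h n N≤n)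

0<nat : ∀ n → 0ℝ < nat (suc n)
0<nat n = at⇒0< {nat (suc n)} (ℚ.positive⁻¹ _ {{ℚ.normalize-pos (suc n) 1}}) (0 , λ _ _ → ℚ.≤-refl)

0<+ : ∀ {x y} → 0ℝ < x → 0ℝ < y → 0ℝ < x + y
0<+ {x} {y} 0<x 0<y =
  let δ , 0<δ , M , δ≤ = 0<⇒at {x} 0<x
      η , 0<η , N , η≤ = 0<⇒at {y} 0<y
  in at⇒0< {x + y} (+-pos (ℚ.<⇒≤ 0<δ) 0<η)
       (M ℕ.⊔ N , λ n ≤n → ℚ.+-mono-≤ (δ≤ n (ℕ.m⊔n≤o⇒m≤o M N ≤n)) (η≤ n (ℕ.m⊔n≤o⇒n≤o M N ≤n)))

0<* : ∀ {x y} → 0ℝ < x → 0ℝ < y → 0ℝ < x * y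
0<* {x} {y} 0<x 0<y =
  let δ , 0<δ , M , δ≤ = 0<⇒at {x} 0<x
      η , 0<η , N , η≤ = 0<⇒at {y} 0<y
  in at⇒0< {x * y} (*-pos 0<δ 0<η)
       (M ℕ.⊔ N , λ n ≤n →
         let δ≤x = δ≤ n (ℕ.m⊔n≤o⇒m≤o M N ≤n)
         in *-mono-≤ (ℚ.≤-trans (ℚ.<⇒≤ 0<δ) δ≤x) (ℚ.<⇒≤ 0<η) δ≤x (η≤ n (ℕ.m⊔n≤o⇒n≤o M N ≤n)))

⊓-pos : ∀ p q → 0ℚ ℚ.< p → 0ℚ ℚ.< q → 0ℚ ℚ.< p ℚ.⊓ q
⊓-pos p q 0<p 0<q with ℚ.⊓-sel p q
... | inj₁ eq = subst (0ℚ ℚ.<_) (sym eq) 0<p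
... | inj₂ eq = subst (0ℚ ℚ.<_) (sym eq) 0<q

0<√ : ∀ {x} → 0ℝ < x → 0ℝ < √ x
0<√ {x} 0<x =
  let δ , 0<δ , M , δ≤ = 0<⇒at {x} 0<x
      μ = δ ℚ.⊓ 1ℚ
      0<μ : 0ℚ ℚ.< μ
      0<μ = ⊓-pos δ 1ℚ 0<δ 0<1
      0<θ = pos½ 0<μ
      N , 1/k≤θ = 1/k→0 0<θ
  in at⇒0< {√ x} 0<θ (M ℕ.⊔ N , λ n ≤n → ℚ.≮⇒≥ λ s<θ → ℚ.<-irrefl refl
       (ℚ.<-≤-trans (√-approx-upper n (at x n))
         (ℚ.≤-trans
           (sq-mono-≤ (ℚ.<⇒≤ (+-pos (√-approx-nonNeg n (at x n)) (0<1/k n)))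
             (ℚ.≤-trans (ℚ.+-mono-≤ (ℚ.<⇒≤ s<θ) (1/k≤θ n (ℕ.m⊔n≤o⇒n≤o M N ≤n))) (ℚ.≤-reflexive (halves μ))))
           (ℚ.≤-trans
             (subst (sq μ ℚ.≤_) (ℚ.*-identityʳ δ)
               (*-mono-≤ (ℚ.<⇒≤ 0<δ) (ℚ.<⇒≤ 0<μ) (ℚ.p⊓q≤p δ 1ℚ) (ℚ.p⊓q≤q δ 1ℚ)))
             (ℚ.≤-trans (δ≤ n (ℕ.m⊔n≤o⇒m≤o M N ≤n)) (p≤∣p∣ (at x n)))))))

0≤√ : ∀ x → 0ℝ ≤ √ x
0≤√ x ε 0<ε = 0 , λ n _ → ℚ.<⇒≤ (+-pos (√-approx-nonNeg n (at x n)) 0<ε)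

√*√ : ∀ {x} → 0ℝ ≤ x → √ x * √ x ≃ x
√*√ {x} 0≤x ε 0<ε =
  let B , 0<B , K , s<B = bounded (cauchy (√ x))
      C = (B ℚ.+ B) ℚ.+ 1ℚ
      0<2B = +-pos (ℚ.<⇒≤ 0<B) 0<B
      0<C = +-pos (ℚ.<⇒≤ 0<2B) 0<1
      η , 0<η , Cη≡ε = scale 0<C 0<ε
      L , 1/k≤1 = 1/k→0 0<1
      M , 1/k≤η = 1/k→0 0<η
      θ = ½ ℚ.* (½ ℚ.* ε)
      N , 0≤x+θ = 0≤x θ (pos½ (pos½ 0<ε))
  in (K ℕ.⊔ L) ℕ.⊔ (M ℕ.⊔ N) , λ n ≤n →
     let KL≤n = ℕ.m⊔n≤o⇒m≤o (K ℕ.⊔ L) (M ℕ.⊔ N) ≤n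
         MN≤n = ℕ.m⊔n≤o⇒n≤o (K ℕ.⊔ L) (M ℕ.⊔ N) ≤n
         q = at x n
         s = √-approx n q
         κ = + 1 ℚ./ suc n
         0≤s = √-approx-nonNeg n q
         s≤B = ℚ.≤-trans (p≤∣p∣ s) (ℚ.<⇒≤ (s<B n (ℕ.m⊔n≤o⇒m≤o K L KL≤n)))
         0≤q+θ = 0≤x+θ n (ℕ.m⊔n≤o⇒n≤o M N MN≤n)
     in ∣p-q∣<r
          (ℚ.≤-<-trans (√-approx-lower n q)
            (ℚ.≤-<-trans (∣q∣≤ q θ (ℚ.<⇒≤ (pos½ (pos½ 0<ε))) 0≤q+θ)
              (ℚ.+-monoʳ-< q (subst (ℚ._< ε) (sym (halves (½ ℚ.* ε))) (half< 0<ε)))))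
          (ℚ.≤-<-trans (p≤∣p∣ q) (ℚ.<-≤-trans (√-approx-upper n q)
            (subst (ℚ._≤ sq s ℚ.+ ε)
              (solve 2 (λ s κ → s :* s :+ ((s :+ s) :+ κ) :* κ := (s :+ κ) :* (s :+ κ)) refl s κ)
              (ℚ.+-monoʳ-≤ (sq s) (subst (((s ℚ.+ s) ℚ.+ κ) ℚ.* κ ℚ.≤_) Cη≡ε
                (*-mono-≤ (ℚ.<⇒≤ 0<C) (ℚ.<⇒≤ (0<1/k n))
                  (ℚ.+-mono-≤ (ℚ.+-mono-≤ s≤B s≤B) (1/k≤1 n (ℕ.m⊔n≤o⇒n≤o K L KL≤n)))
                  (1/k≤η n (ℕ.m⊔n≤o⇒m≤o M N MN≤n))))))))
  where
  open +-*-Solver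
  half< : ∀ {ε} → 0ℚ ℚ.< ε → ½ ℚ.* ε ℚ.< ε
  half< {ε} 0<ε = subst₂ ℚ._<_ (ℚ.+-identityˡ (½ ℚ.* ε)) (halves ε) (ℚ.+-monoˡ-< (½ ℚ.* ε) (pos½ 0<ε))
  ∣q∣≤ : ∀ q θ → 0ℚ ℚ.≤ θ → 0ℚ ℚ.≤ q ℚ.+ θ → ℚ.∣ q ∣ ℚ.≤ q ℚ.+ (θ ℚ.+ θ)
  ∣q∣≤ q θ 0≤θ 0≤q+θ with ℚ.∣p∣≡p∨∣p∣≡-p q
  ... | inj₁ eq = subst (ℚ._≤ q ℚ.+ (θ ℚ.+ θ)) (sym eq) (p≤p+q q (ℚ.+-mono-≤ 0≤θ 0≤θ))
  ... | inj₂ eq = subst₂ ℚ._≤_ (trans (ℚ.+-identityʳ (ℚ.- q)) (sym eq))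
    (solve 2 (λ q θ → :- q :+ ((q :+ θ) :+ (q :+ θ)) := q :+ (θ :+ θ)) refl q θ)
    (ℚ.+-monoʳ-≤ (ℚ.- q) (ℚ.+-mono-≤ 0≤q+θ 0≤q+θ))

0<⇒# : ∀ {x} → 0ℝ < x → x # 0ℝ
0<⇒# = inj₂

infix 4 _⟶_
_⟶_ : (ℕ → ℝ) → ℝ → Set
x ⟶ L = ∀ ε → 0ℝ < ε → Eventually λ n → ∣ x n - L ∣ < ε

f a b t g : ℕ → ℕ
f = count 𝟎
a = count 𝐚
b = count 𝐛
t = count 𝟏
g n = f n ℕ.+ a n ℕ.+ b n ℕ.+ t n

g-nonZero : ∀ n → ℕ.NonZero (g (suc n))
g-nonZero n = ℕ.>-nonZero (go (eval (comb n) v₀) refl)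
  where
  v₀ : Valuation (suc n)
  v₀ = Vec.replicate (suc n) 𝟏
  pos : ∀ c → eval (comb n) v₀ ≡ c → 0 ℕ.< count c (suc n)
  pos c eq = ℕ.≤-<-trans z≤n (Fin.toℕ<n (Inverse.to (count-correct c (suc n)) ((comb n , v₀) , eq)))
  go : ∀ c → eval (comb n) v₀ ≡ c → 0 ℕ.< g (suc n)
  go 𝟎 eq = ℕ.<-≤-trans (pos 𝟎 eq) (ℕ.≤-trans (ℕ.m≤m+n _ _) (ℕ.≤-trans (ℕ.m≤m+n _ _) (ℕ.m≤m+n _ _)))
  go 𝐚 eq = ℕ.<-≤-trans (pos 𝐚 eq) (ℕ.≤-trans (ℕ.m≤n+m _ (f (suc n))) (ℕ.≤-trans (ℕ.m≤m+n _ _) (ℕ.m≤m+n _ _)))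
  go 𝐛 eq = ℕ.<-≤-trans (pos 𝐛 eq) (ℕ.≤-trans (ℕ.m≤n+m _ (f (suc n) ℕ.+ a (suc n))) (ℕ.m≤m+n _ _))
  go 𝟏 eq = ℕ.<-≤-trans (pos 𝟏 eq) (ℕ.m≤n+m _ _)

-- Term n of the sequence h / g is h (n + 1) / g (n + 1): there are no bracketings
-- of 0 variables, and the sequences start at 1.
ratio : (ℕ → ℕ) → ℕ → ℝ
ratio h n = real ((+ h (suc n) ℚ./ g (suc n)) {{g-nonZero n}})

√2 β α γ : ℝ
√2 = √ nat 2
β = √ (nat 7 + nat 2 * √2)
α = 1ℝ + √2 + β
γ = √ (nat 16 + α * α)

0<√2 : 0ℝ < √2
0<√2 = 0<√ {nat 2} (0<nat 1)

0<β : 0ℝ < β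
0<β = 0<√ {nat 7 + nat 2 * √2} (0<+ {nat 7} {nat 2 * √2} (0<nat 6) (0<* {nat 2} {√2} (0<nat 1) 0<√2))

0<α : 0ℝ < α
0<α = 0<+ {1ℝ + √2} {β} (0<+ {1ℝ} {√2} (0<nat 0) 0<√2) 0<β

0<γ : 0ℝ < γ
0<γ = 0<√ {nat 16 + α * α} (0<+ {nat 16} {α * α} (0<nat 15) (0<* {α} {α} 0<α 0<α))

4#0 : nat 4 # 0ℝ
4#0 = 0<⇒# {nat 4} (0<nat 3)

2αβ#0 : nat 2 * α * β # 0ℝ
2αβ#0 = 0<⇒# {nat 2 * α * β} (0<* {nat 2 * α} {β} (0<* {nat 2} {α} (0<nat 1) 0<α) 0<β)

βγ[α+γ]#0 : β * γ * (α + γ) # 0ℝ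
βγ[α+γ]#0 = 0<⇒# {β * γ * (α + γ)}
  (0<* {β * γ} {α + γ} (0<* {β} {γ} 0<β 0<γ) (0<+ {α} {γ} 0<α 0<γ))

16βγ#0 : nat 16 * β * γ # 0ℝ
16βγ#0 = 0<⇒# {nat 16 * β * γ} (0<* {nat 16 * β} {γ} (0<* {nat 16} {β} (0<nat 15) 0<β) 0<γ)

{-# OPTIONS --safe #-}

-- Write G n, X n for the numbers of all pairs, and of the pairs with a given value c, on n + 1
-- variables, divided by 16ⁿ⁺¹, and U n for the pairs with value above c.  An implication has
-- value c ≠ 1 iff its right side has value c and its left side a larger value, so X is the
-- convolution of U and X, as G is of G and G.  From the latter, (n + 2) G (n + 1) = (n + ½) G n;
-- thus G decreases and 1 - 2 Σ_{i<n} G i = 4 (n + 1) G n tends to 0.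
--
-- Let ρ = X / G and v = U / G.  Split off the first K terms at both ends of the convolution
-- and replace the remaining factor G (n - i) in each of them by G (n + 1).  This gives
-- ρ (n + 1) = Σ_{i<K} (U i · ρ (n - i) + X i · v (n - i)) + error, where the error is
-- nonnegative and, term by term, at most the one for G itself, which is 1 - 2 Σ_{i<K} G i.
-- As Σ (U + X) ≤ ½, this is a contraction on the tails of ρ, given that v + ρ converges:
-- so ρ converges, and lim ρ = (Σ U) lim ρ + (Σ X) lim v.
--
-- The sums satisfy Σ X = 1/16 + (Σ U) (Σ X).  Hence D = 1 - Σ U, taken for c = 0, a, b in turn, starts
-- from 1 - Σ G = ½, increases by Σ X and satisfies (Σ X) D = 1/16.  These quadratic equations
-- give 4 D₁ = 1 + √2, 8 D₂ = α and 16 D₃ = α + γ.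
module Submission where

import Data.Integer as ℤ
import Data.Integer.Properties as ℤ
open import Data.Nat as ℕ using (ℕ; zero; suc)
import Data.Nat.Properties as ℕ
open import Data.Product using (∃-syntax; _×_; _,_; proj₁; proj₂)
import Data.Rational as ℚ
import Data.Rational.Properties as ℚ
open import Data.Rational.Solver using (module +-*-Solver)
open import Function using (_∘_)
open import Relation.Binary.PropositionalEquality
open +-*-Solver

-- The embedding of the natural numbers into the rationals.

module Embedding where

  open import Data.Rational
  open import Data.Rational.Properties
  import Data.Rational.Unnormalised as ℚᵘ
  import Data.Rational.Unnormalised.Properties as ℚᵘ
  open import Defs using (frac-suc; p≤p+q)

  ι : ℕ → ℚ
  ι n = ℤ.+ n / 1

  0≤ι : ∀ n → 0ℚ ≤ ι n
  0≤ι n = nonNegative⁻¹ _ {{normalize-nonNeg n 1}}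

  0<ι-suc : ∀ n → 0ℚ < ι (suc n)
  0<ι-suc n = positive⁻¹ _ {{normalize-pos (suc n) 1}}

  ι-suc : ∀ n → ι (suc n) ≡ ι n + 1ℚ
  ι-suc n = frac-suc n 0

  ι-+ : ∀ m n → ι (m ℕ.+ n) ≡ ι m + ι n
  ι-+ zero    n = sym (+-identityˡ (ι n))
  ι-+ (suc m) n = trans (ι-suc (m ℕ.+ n)) (trans (cong (_+ 1ℚ) (ι-+ m n))
    (trans (solve 2 (λ a b → (a :+ b) :+ con 1ℚ := (a :+ con 1ℚ) :+ b) refl (ι m) (ι n)) (cong (_+ ι n) (sym (ι-suc m)))))

  ι-mono : ∀ {m n} → m ℕ.≤ n → ι m ≤ ι n
  ι-mono {m} {n} m≤n = subst (ι m ≤_) (trans (sym (ι-+ m (n ℕ.∸ m))) (cong ι (ℕ.m+[n∸m]≡n m≤n))) (p≤p+q (ι m) (0≤ι (n ℕ.∸ m)))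

  ι-* : ∀ m n → ι (m ℕ.* n) ≡ ι m * ι n
  ι-* zero    n = sym (*-zeroˡ (ι n))
  ι-* (suc m) n = trans (ι-+ n (m ℕ.* n)) (trans (cong (ι n +_) (ι-* m n))
    (trans (solve 2 (λ a b → b :+ a :* b := (a :+ con 1ℚ) :* b) refl (ι m) (ι n)) (cong (_* ι n) (sym (ι-suc m)))))

  /-*-cancel : ∀ m n .{{_ : ℕ.NonZero n}} → (ℤ.+ m / n) * ι n ≡ ι m
  /-*-cancel m n@(suc k) = toℚᵘ-injective (ℚᵘ.≃-trans (toℚᵘ-homo-* (ℤ.+ m / n) (ι n))
    (ℚᵘ.≃-trans (ℚᵘ.*-cong (toℚᵘ-fromℚᵘ (ℚᵘ.mkℚᵘ (ℤ.+ m) k)) (toℚᵘ-fromℚᵘ (ℚᵘ.mkℚᵘ (ℤ.+ n) 0)))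
      (ℚᵘ.≃-trans (ℚᵘ.*≡* (ℤ.*-assoc (ℤ.+ m) (ℤ.+ n) ℤ.1ℤ))
        (ℚᵘ.≃-sym (toℚᵘ-fromℚᵘ (ℚᵘ.mkℚᵘ (ℤ.+ m) 0))))))

open Embedding

-- Convolutions and partial sums of rational sequences, and their monotonicity.

module Sequences where

  open import Data.Rational
  open import Data.Rational.Properties
  open import Data.Sum using (inj₁; inj₂)
  open import Defs using (*-mono-≤)

  -- Nonnegativity travels with the upper bound, because products preserve bounds only between
  -- nonnegative numbers.
  infix 4 0≤_≤_
  0≤_≤_ : ℚ → ℚ → Set
  0≤ p ≤ q = 0ℚ ≤ p × p ≤ q

  ∸-nonNeg : ∀ {p q} → p ≤ q → 0ℚ ≤ q - p
  ∸-nonNeg {p} {q} p≤q = subst (_≤ q - p) (+-inverseʳ p) (+-monoˡ-≤ (- p) p≤q)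

  ∸-nonNeg⁻¹ : ∀ {p q} → 0ℚ ≤ q - p → p ≤ q
  ∸-nonNeg⁻¹ {p} {q} 0≤d = subst₂ _≤_ (+-identityˡ p)
    (solve 2 (λ p q → q :- p :+ p := q) refl p q) (+-monoˡ-≤ p 0≤d)

  *-nonNeg : ∀ {p q} → 0ℚ ≤ p → 0ℚ ≤ q → 0ℚ ≤ p * q
  *-nonNeg {p} {q} 0≤p 0≤q =
    nonNegative⁻¹ _ {{nonNeg*nonNeg⇒nonNeg p {{nonNegative 0≤p}} q {{nonNegative 0≤q}}}}

  0≤-refl : ∀ {p} → 0ℚ ≤ p → 0≤ p ≤ p
  0≤-refl 0≤p = 0≤p , ≤-refl

  0≤-+ : ∀ {p q r s} → 0≤ p ≤ q → 0≤ r ≤ s → 0≤ p + r ≤ q + s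
  0≤-+ (0≤p , p≤q) (0≤r , r≤s) = +-mono-≤ 0≤p 0≤r , +-mono-≤ p≤q r≤s

  0≤-* : ∀ {p q r s} → 0≤ p ≤ q → 0≤ r ≤ s → 0≤ p * r ≤ q * s
  0≤-* (0≤p , p≤q) (0≤r , r≤s) = *-nonNeg 0≤p 0≤r , *-mono-≤ (≤-trans 0≤p p≤q) 0≤r p≤q r≤s

  Seq : Set
  Seq = ℕ → ℚ

  infixl 7 _·_
  _·_ : Seq → Seq → Seq
  (x · y) n = x n * y n

  conv : Seq → Seq → Seq
  conv x y zero    = x 0 * y 0
  conv x y (suc n) = x 0 * y (suc n) + conv (x ∘ suc) y n

  sum : Seq → Seq
  sum x zero    = 0ℚ
  sum x (suc n) = x 0 + sum (x ∘ suc) n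

  -- The contribution to conv x y (K + m) of the first K entries of x.
  head : ℕ → Seq → Seq → Seq
  head zero    x y m = 0ℚ
  head (suc K) x y m = x 0 * y (suc (K ℕ.+ m)) + head K (x ∘ suc) y m

  conv-cong : ∀ {x x′ y y′} n → (∀ i → i ℕ.≤ n → x i ≡ x′ i) → (∀ i → i ℕ.≤ n → y i ≡ y′ i) →
    conv x y n ≡ conv x′ y′ n
  conv-cong zero    x≡ y≡ = cong₂ _*_ (x≡ 0 ℕ.z≤n) (y≡ 0 ℕ.z≤n)
  conv-cong (suc n) x≡ y≡ = cong₂ _+_ (cong₂ _*_ (x≡ 0 ℕ.z≤n) (y≡ (suc n) ℕ.≤-refl))
    (conv-cong n (λ i i≤n → x≡ (suc i) (ℕ.s≤s i≤n)) (λ i i≤n → y≡ i (ℕ.m≤n⇒m≤1+n i≤n)))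

  conv-sucʳ : ∀ x y n → conv x y (suc n) ≡ conv x (y ∘ suc) n + x (suc n) * y 0
  conv-sucʳ x y zero    = refl
  conv-sucʳ x y (suc n) = trans (cong (x 0 * y (suc (suc n)) +_) (conv-sucʳ (x ∘ suc) y n))
    (sym (+-assoc (x 0 * y (suc (suc n))) _ _))

  conv-comm : ∀ x y n → conv x y n ≡ conv y x n
  conv-comm x y zero    = *-comm (x 0) (y 0)
  conv-comm x y (suc n) = trans
    (trans (+-comm (x 0 * y (suc n)) (conv (x ∘ suc) y n)) (cong₂ _+_ (conv-comm (x ∘ suc) y n) (*-comm (x 0) (y (suc n)))))
    (sym (conv-sucʳ y x n))

  conv-peel : ∀ K x y m → conv x y (K ℕ.+ m) ≡ head K x y m + conv (x ∘ (K ℕ.+_)) y m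
  conv-peel zero    x y m = sym (+-identityˡ _)
  conv-peel (suc K) x y m = trans (cong (x 0 * y (suc (K ℕ.+ m)) +_) (conv-peel K (x ∘ suc) y m))
    (sym (+-assoc (x 0 * y (suc (K ℕ.+ m))) _ _))

  head-shift : ∀ K L x y m → head K x (y ∘ (L ℕ.+_)) m ≡ head K x y (L ℕ.+ m)
  head-shift zero    L x y m = refl
  head-shift (suc K) L x y m = cong₂ _+_
    (cong (λ i → x 0 * y i) (trans (ℕ.+-suc L (K ℕ.+ m)) (cong suc
      (trans (sym (ℕ.+-assoc L K m)) (trans (cong (ℕ._+ m) (ℕ.+-comm L K)) (ℕ.+-assoc K L m))))))
    (head-shift K L (x ∘ suc) y m)

  -- At index K + (K + m) the terms with first index below K and those with second index below K are
  -- disjoint. Peeling on the left, commuting and peeling again splits off both.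
  conv-peel₂ : ∀ K x y m → conv x y (K ℕ.+ (K ℕ.+ m)) ≡
    (head K x y (K ℕ.+ m) + head K y x (K ℕ.+ m)) + conv (x ∘ (K ℕ.+_)) (y ∘ (K ℕ.+_)) m
  conv-peel₂ K x y m =
    trans (conv-peel K x y (K ℕ.+ m)) (trans (cong (head K x y (K ℕ.+ m) +_)
      (trans (conv-comm (x ∘ (K ℕ.+_)) y (K ℕ.+ m)) (trans (conv-peel K y (x ∘ (K ℕ.+_)) m)
        (cong₂ _+_ (head-shift K K y x m) (conv-comm (y ∘ (K ℕ.+_)) (x ∘ (K ℕ.+_)) m)))))
      (sym (+-assoc (head K x y (K ℕ.+ m)) _ _)))

  conv-within : ∀ {x x′ y y′} n → (∀ i → 0≤ x i ≤ x′ i) → (∀ i → 0≤ y i ≤ y′ i) →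
    0≤ conv x y n ≤ conv x′ y′ n
  conv-within zero    x≤ y≤ = 0≤-* (x≤ 0) (y≤ 0)
  conv-within (suc n) x≤ y≤ = 0≤-+ (0≤-* (x≤ 0) (y≤ (suc n))) (conv-within n (x≤ ∘ suc) y≤)

  sum-within : ∀ {x x′} n → (∀ i → 0≤ x i ≤ x′ i) → 0≤ sum x n ≤ sum x′ n
  sum-within zero    x≤ = 0≤-refl ≤-refl
  sum-within (suc n) x≤ = 0≤-+ (x≤ 0) (sum-within n (x≤ ∘ suc))

  sum-sucʳ : ∀ x n → sum x (suc n) ≡ sum x n + x n
  sum-sucʳ x zero    = +-comm (x 0) 0ℚ
  sum-sucʳ x (suc n) = trans (cong (x 0 +_) (sum-sucʳ (x ∘ suc) n)) (sym (+-assoc (x 0) _ _))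

  sum-+ : ∀ x m n → sum x (m ℕ.+ n) ≡ sum x m + sum (x ∘ (m ℕ.+_)) n
  sum-+ x zero    n = sym (+-identityˡ _)
  sum-+ x (suc m) n = trans (cong (x 0 +_) (sum-+ (x ∘ suc) m n)) (sym (+-assoc (x 0) _ _))

  sum-add : ∀ {x y z : Seq} → (∀ i → x i + y i ≡ z i) → ∀ n → sum x n + sum y n ≡ sum z n
  sum-add eq zero    = refl
  sum-add {x} {y} eq (suc n) = trans
    (solve 4 (λ a b c d → (a :+ b) :+ (c :+ d) := (a :+ c) :+ (b :+ d)) refl (x 0) (sum (x ∘ suc) n) (y 0) (sum (y ∘ suc) n))
    (cong₂ _+_ (eq 0) (sum-add (eq ∘ suc) n))

  head-within : ∀ K {x x′ y y′} m → (∀ i → 0≤ x i ≤ x′ i) → (∀ i → i ℕ.≤ K ℕ.+ m → 0≤ y i ≤ y′ i) →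
    0≤ head K x y m ≤ head K x′ y′ m
  head-within zero    m x≤ y≤ = 0≤-refl ≤-refl
  head-within (suc K) m x≤ y≤ = 0≤-+ (0≤-* (x≤ 0) (y≤ _ ℕ.≤-refl))
    (head-within K m (x≤ ∘ suc) (λ i i≤ → y≤ i (ℕ.m≤n⇒m≤1+n i≤)))

  head-one : ∀ K x m → head K x (λ _ → 1ℚ) m ≡ sum x K
  head-one zero    x m = refl
  head-one (suc K) x m = cong₂ _+_ (*-identityʳ (x 0)) (head-one K (x ∘ suc) m)

  head-cong : ∀ K {x x′ y y′} m → (∀ i → x i ≡ x′ i) → (∀ i → y i ≡ y′ i) → head K x y m ≡ head K x′ y′ m
  head-cong zero    m x≡ y≡ = refl
  head-cong (suc K) m x≡ y≡ = cong₂ _+_ (cong₂ _*_ (x≡ 0) (y≡ _)) (head-cong K m (x≡ ∘ suc) y≡)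

  -- Passing from the weights `g` to a constant `w` costs a head sum weighted by the differences, so
  -- monotonicity of head sums applies to the cost as well.
  head-weight : ∀ K x s g w m →
    head K x (s · g) m - w * head K x s m ≡ head K x (s · (λ i → g i - w)) m
  head-weight zero    x s g w m = solve 1 (λ w → con 0ℚ :- w :* con 0ℚ := con 0ℚ) refl w
  head-weight (suc K) x s g w m = trans
    (solve 6 (λ x s g w h k → (x :* (s :* g) :+ h) :- w :* (x :* s :+ k) := x :* (s :* (g :- w)) :+ (h :- w :* k))
      refl (x 0) (s j) (g j) w (head K (x ∘ suc) (s · g) m) (head K (x ∘ suc) s m))
    (cong (x 0 * (s j * (g j - w)) +_) (head-weight K (x ∘ suc) s g w m))
    where j = suc (K ℕ.+ m)

  ∣∣-within : ∀ {p} → 0ℚ ≤ p → ∣ p ∣ ≤ p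
  ∣∣-within 0≤p = ≤-reflexive (0≤p⇒∣p∣≡p 0≤p)

  -- A head sum at `m` evaluates `s` only beyond `m`, so closeness of the tails is enough.
  head-diff : ∀ K {x s s′ D} m m′ → (∀ i → 0ℚ ≤ x i) →
    (∀ i j → m ℕ.≤ i → m′ ℕ.≤ j → ∣ s i - s′ j ∣ ≤ D) →
    ∣ head K x s m - head K x s′ m′ ∣ ≤ sum x K * D
  head-diff zero    {D = D} m m′ 0≤x close = ≤-reflexive (sym (*-zeroˡ D))
  head-diff (suc K) {x} {s} {s′} {D} m m′ 0≤x close = ≤-trans
    (subst (λ d → ∣ d ∣ ≤ ∣ x 0 * (s j - s′ j′) ∣ + ∣ h - h′ ∣)
      (solve 5 (λ x s s′ h h′ → x :* (s :- s′) :+ (h :- h′) := (x :* s :+ h) :- (x :* s′ :+ h′)) refl (x 0) (s j) (s′ j′) h h′)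
      (∣p+q∣≤∣p∣+∣q∣ (x 0 * (s j - s′ j′)) (h - h′)))
    (subst (∣ x 0 * (s j - s′ j′) ∣ + ∣ h - h′ ∣ ≤_) (sym (*-distribʳ-+ D (x 0) (sum (x ∘ suc) K)))
      (+-mono-≤
        (subst (_≤ x 0 * D) (trans (cong (_* ∣ s j - s′ j′ ∣) (sym (0≤p⇒∣p∣≡p (0≤x 0)))) (sym (∣p*q∣≡∣p∣*∣q∣ (x 0) _)))
          (*-monoˡ-≤-nonNeg (x 0) {{nonNegative (0≤x 0)}}
            (close j j′ (ℕ.m≤n⇒m≤1+n (ℕ.m≤n+m m K)) (ℕ.m≤n⇒m≤1+n (ℕ.m≤n+m m′ K)))))
        (head-diff K m m′ (0≤x ∘ suc) close)))
    where
    j = suc (K ℕ.+ m)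
    j′ = suc (K ℕ.+ m′)
    h = head K (x ∘ suc) s m
    h′ = head K (x ∘ suc) s′ m′

  -- Since `ω` turns sums into products, all terms of the convolution carry the same factor. The
  -- offset `k` grows whenever the recursion shifts `x`.
  conv-scale : ∀ ω {x y x′ y′} k l n → (∀ i → x′ i ≡ ω (k ℕ.+ i) * x i) → (∀ i → y′ i ≡ ω (l ℕ.+ i) * y i) →
    (∀ i j → ω i * ω j ≡ ω (i ℕ.+ j)) → conv x′ y′ n ≡ ω (k ℕ.+ l ℕ.+ n) * conv x y n
  conv-scale ω k l zero x≡ y≡ ω-* = trans (cong₂ _*_ (x≡ 0) (y≡ 0)) (trans
    (solve 4 (λ a b c d → (a :* b) :* (c :* d) := (a :* c) :* (b :* d)) refl (ω (k ℕ.+ 0)) _ (ω (l ℕ.+ 0)) _)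
    (cong (_* _) (trans (ω-* _ _) (cong ω (trans (cong₂ ℕ._+_ (ℕ.+-identityʳ k) (ℕ.+-identityʳ l)) (sym (ℕ.+-identityʳ _)))))))
  conv-scale ω {x} {y} k l (suc n) x≡ y≡ ω-* = trans
    (cong₂ _+_
      (trans (cong₂ _*_ (x≡ 0) (y≡ (suc n))) (trans
        (solve 4 (λ a b c d → (a :* b) :* (c :* d) := (a :* c) :* (b :* d)) refl (ω (k ℕ.+ 0)) _ (ω (l ℕ.+ suc n)) _)
        (cong (_* (x 0 * y (suc n))) (trans (ω-* _ _) (cong ω
          (trans (cong (ℕ._+ (l ℕ.+ suc n)) (ℕ.+-identityʳ k)) (sym (ℕ.+-assoc k l (suc n)))))))))
      (trans (conv-scale ω {x ∘ suc} {y} (suc k) l n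
          (λ i → trans (x≡ (suc i)) (cong (λ j → ω j * x (suc i)) (ℕ.+-suc k i))) y≡ ω-*)
        (cong (λ j → ω j * conv (x ∘ suc) y n) (sym (ℕ.+-suc (k ℕ.+ l) n)))))
    (sym (*-distribˡ-+ (ω (k ℕ.+ l ℕ.+ suc n)) _ _))

  -- The Leibniz rule for a product of power series, with general weights: `w i + v j` has the same
  -- value `s` on every term.
  conv-deriv : ∀ {w v s} x y n → (∀ i j → i ℕ.+ j ≡ n → w i + v j ≡ s) →
    conv (w · x) y n + conv x (v · y) n ≡ s * conv x y n
  conv-deriv {w} {v} {s} x y zero    w+v = trans
    (solve 4 (λ w v x y → (w :* x) :* y :+ x :* (v :* y) := (w :+ v) :* (x :* y)) refl (w 0) (v 0) (x 0) (y 0))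
    (cong (_* (x 0 * y 0)) (w+v 0 0 refl))
  conv-deriv {w} {v} {s} x y (suc n) w+v = trans
    (solve 6 (λ w v x y a b → ((w :* x) :* y :+ a) :+ (x :* (v :* y) :+ b) := (w :+ v) :* (x :* y) :+ (a :+ b)) refl
      (w 0) (v (suc n)) (x 0) (y (suc n)) (conv ((w · x) ∘ suc) y n) (conv (x ∘ suc) (v · y) n))
    (trans (cong₂ _+_ (cong (_* (x 0 * y (suc n))) (w+v 0 (suc n) refl))
        (conv-deriv {w ∘ suc} {v} (x ∘ suc) y n (λ i j i+j≡n → w+v (suc i) j (cong suc i+j≡n))))
      (sym (*-distribˡ-+ s _ _)))

  -- The difference consists of the products u i · x j with i < K, j < K + M and i + j ≥ K; so it is
  -- nonnegative and monotone in both sequences. In the recursion `M` grows as `K` shrinks, which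
  -- keeps the range of j fixed.
  sum-conv-within : ∀ {u u′ x x′} K M → (∀ i → 0≤ u i ≤ u′ i) → (∀ i → 0≤ x i ≤ x′ i) →
    0≤ sum u K * sum x (K ℕ.+ M) - sum (conv u x) K ≤ sum u′ K * sum x′ (K ℕ.+ M) - sum (conv u′ x′) K
  sum-conv-within {x = x} {x′} zero M u≤ x≤ = subst₂ 0≤_≤_ (lem (sum x M)) (lem (sum x′ M)) (0≤-refl ≤-refl)
    where
    lem : ∀ p → 0ℚ ≡ 0ℚ * p - 0ℚ
    lem p = solve 1 (λ p → con 0ℚ := con 0ℚ :* p :- con 0ℚ) refl p
  sum-conv-within {u} {u′} {x} {x′} (suc K) M u≤ x≤ = subst₂ 0≤_≤_ (step u x) (step u′ x′)
    (0≤-+ (0≤-* (u≤ 0) (sum-within M (λ i → x≤ (suc K ℕ.+ i))))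
      (subst₂ 0≤_≤_ (cong (λ j → sum (u ∘ suc) K * sum x j - sum (conv (u ∘ suc) x) K) (ℕ.+-suc K M))
        (cong (λ j → sum (u′ ∘ suc) K * sum x′ j - sum (conv (u′ ∘ suc) x′) K) (ℕ.+-suc K M))
        (sum-conv-within K (suc M) (u≤ ∘ suc) x≤)))
    where
    peel : ∀ u x L → sum (conv u x) (suc L) ≡ u 0 * sum x (suc L) + sum (conv (u ∘ suc) x) L
    peel u x zero = solve 2 (λ u x → u :* x :+ con 0ℚ := u :* (x :+ con 0ℚ) :+ con 0ℚ) refl (u 0) (x 0)
    peel u x (suc L) = trans (sum-sucʳ (conv u x) (suc L)) (trans (cong (_+ conv u x (suc L)) (peel u x L))
      (trans (solve 5 (λ u s c y k → (u :* s :+ c) :+ (u :* y :+ k) := u :* (s :+ y) :+ (c :+ k)) refl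
          (u 0) (sum x (suc L)) (sum (conv (u ∘ suc) x) L) (x (suc L)) (conv (u ∘ suc) x L))
        (cong₂ _+_ (cong (u 0 *_) (sym (sum-sucʳ x (suc L)))) (sym (sum-sucʳ (conv (u ∘ suc) x) L)))))
    step : ∀ u x → u 0 * sum (x ∘ (suc K ℕ.+_)) M
                   + (sum (u ∘ suc) K * sum x (suc (K ℕ.+ M)) - sum (conv (u ∘ suc) x) K)
                 ≡ sum u (suc K) * sum x (suc K ℕ.+ M) - sum (conv u x) (suc K)
    step u x = trans
      (trans (cong (λ p → u 0 * T + (sum (u ∘ suc) K * p - C)) (sum-+ x (suc K) M))
        (solve 5 (λ u t s c r → u :* t :+ (r :* (s :+ t) :- c) := (u :+ r) :* (s :+ t) :- (u :* s :+ c)) refl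
          (u 0) T (sum x (suc K)) C (sum (u ∘ suc) K)))
      (cong₂ (λ p q → sum u (suc K) * p - q) (sym (sum-+ x (suc K) M)) (sym (peel u x K)))
      where
      T = sum (x ∘ (suc K ℕ.+_)) M
      C = sum (conv (u ∘ suc) x) K

  ∣∣≤ : ∀ {p r} → p ≤ r → - p ≤ r → ∣ p ∣ ≤ r
  ∣∣≤ {p} p≤r -p≤r with ∣p∣≡p∨∣p∣≡-p p
  ... | inj₁ eq = subst (_≤ _) (sym eq) p≤r
  ... | inj₂ eq = subst (_≤ _) (sym eq) -p≤r

  0≤-diff : ∀ {p q r} → 0≤ p ≤ r → 0≤ q ≤ r → ∣ p - q ∣ ≤ r
  0≤-diff {p} {q} {r} (0≤p , p≤r) (0≤q , q≤r) = ∣∣≤ (drop p q 0≤q p≤r)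
    (subst (_≤ r) (solve 2 (λ p q → q :- p := :- (p :- q)) refl p q) (drop q p 0≤p q≤r))
    where
    drop : ∀ p q → 0ℚ ≤ q → p ≤ r → p - q ≤ r
    drop p q 0≤q p≤r = subst (p - q ≤_) (+-identityʳ r) (+-mono-≤ p≤r (neg-antimono-≤ 0≤q))

open Sequences

-- Rescaled Catalan numbers: two-term recurrence and decay of the tails.

module Catalan (G : Seq) (G0 : G 0 ≡ ℤ.+ 1 ℚ./ 4) (G-rec : ∀ n → G (suc n) ≡ conv G G n) where

  open import Data.Rational
  open import Data.Rational.Properties
  open import Data.Sum using (inj₁; inj₂)
  open import Defs using (Eventually; Cauchy; *-mono-<; 1/k→0; sq; pos½; halves)

  2ℚ ¼ : ℚ
  2ℚ = ℤ.+ 2 / 1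
  ¼ = ℤ.+ 1 / 4

  -- For G n = C_n / 4ⁿ⁺¹ this is the recurrence (n + 2) C_{n+1} = (4 n + 2) C_n of the Catalan
  -- numbers.
  Recurrence : ℕ → Set
  Recurrence n = (ι n + 2ℚ) * G (suc n) ≡ (ι n + ½) * G n

  -- By symmetry, each factor of the square carries half of the additive weight w + w.
  conv-half : ∀ w {s} n → (∀ i j → i ℕ.+ j ≡ n → w i + w j ≡ s) →
    conv (w · G) G n + conv (w · G) G n ≡ s * G (suc n)
  conv-half w {s} n w+w = trans (cong (conv (w · G) G n +_) (conv-comm (w · G) G n))
    (trans (conv-deriv {w} {w} {s} G G n w+w) (cong (s *_) (sym (G-rec n))))

  -- Put the weight i + 1 on the first factor of the square; by symmetry it doubles to n + 3. In all
  -- terms but the first, the hypothesis replaces (i + 2) G (i + 1) by (i + ½) G i, and these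
  -- weights double to n + 1. The first term contributes the remaining ½.
  recurrence-step : ∀ n → (∀ i → i ℕ.≤ n → Recurrence i) → Recurrence (suc n)
  recurrence-step n below = begin
    (ι (suc n) + 2ℚ) * G (suc (suc n))
      ≡⟨ sym (conv-half w (suc n) sum₁) ⟩
    conv (w · G) G (suc n) + conv (w · G) G (suc n)
      ≡⟨ cong (λ c → c + c) (cong₂ _+_ (cong (λ g → (1ℚ * g) * G (suc n)) G0)
           (conv-cong {y = G} n (λ i i≤n → trans (cong (_* G (suc i)) (wsuc i)) (below i i≤n)) (λ _ _ → refl))) ⟩
    ((1ℚ * ¼) * G (suc n) + conv (v · G) G n) + ((1ℚ * ¼) * G (suc n) + conv (v · G) G n)
      ≡⟨ solve 2 (λ g c → (con ¼ :* g :+ c) :+ (con ¼ :* g :+ c) := con ½ :* g :+ (c :+ c)) refl (G (suc n)) (conv (v · G) G n) ⟩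
    ½ * G (suc n) + (conv (v · G) G n + conv (v · G) G n)
      ≡⟨ cong (½ * G (suc n) +_) (conv-half v n sum₂) ⟩
    ½ * G (suc n) + (ι n + 1ℚ) * G (suc n)
      ≡⟨ solve 2 (λ k g → con ½ :* g :+ (k :+ con 1ℚ) :* g := ((k :+ con 1ℚ) :+ con ½) :* g) refl (ι n) (G (suc n)) ⟩
    ((ι n + 1ℚ) + ½) * G (suc n)
      ≡⟨ cong (λ k → (k + ½) * G (suc n)) (sym (ι-suc n)) ⟩
    (ι (suc n) + ½) * G (suc n) ∎
    where
    open ≡-Reasoning
    w v : Seq
    w i = ι i + 1ℚ
    v i = ι i + ½
    wsuc : ∀ i → w (suc i) ≡ ι i + 2ℚ
    wsuc i = trans (cong (_+ 1ℚ) (ι-suc i)) (+-assoc (ι i) 1ℚ 1ℚ)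
    sum₁ : ∀ i j → i ℕ.+ j ≡ suc n → w i + w j ≡ ι (suc n) + 2ℚ
    sum₁ i j i+j≡1+n = trans (solve 2 (λ a b → (a :+ con 1ℚ) :+ (b :+ con 1ℚ) := (a :+ b) :+ con 2ℚ) refl (ι i) (ι j))
      (cong (_+ 2ℚ) (trans (sym (ι-+ i j)) (cong ι i+j≡1+n)))
    sum₂ : ∀ i j → i ℕ.+ j ≡ n → v i + v j ≡ ι n + 1ℚ
    sum₂ i j refl = trans (solve 2 (λ a b → (a :+ con ½) :+ (b :+ con ½) := (a :+ b) :+ con 1ℚ) refl (ι i) (ι j))
      (cong (_+ 1ℚ) (sym (ι-+ i j)))

  mutual
    recurrence : ∀ n → Recurrence n
    recurrence zero = trans (cong ((ι 0 + 2ℚ) *_) (trans (G-rec 0) (cong₂ _*_ G0 G0))) (cong ((ι 0 + ½) *_) (sym G0))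
    recurrence (suc n) = recurrence-step n (recurrence≤ n)

    recurrence≤ : ∀ n i → i ℕ.≤ n → Recurrence i
    recurrence≤ zero    zero ℕ.z≤n = recurrence zero
    recurrence≤ (suc n) i i≤1+n with ℕ.m≤n⇒m<n∨m≡n i≤1+n
    ... | inj₁ i<1+n = recurrence≤ n i (ℕ.s≤s⁻¹ i<1+n)
    ... | inj₂ refl  = recurrence-step n (recurrence≤ n)

  0<ι+ : ∀ n {q} → 0ℚ < q → 0ℚ < ι n + q
  0<ι+ n = +-mono-≤-< (0≤ι n)

  G-pos : ∀ n → 0ℚ < G n
  G-pos zero    = subst (0ℚ <_) (sym G0) (positive⁻¹ ¼)
  G-pos (suc n) = *-cancelˡ-<-nonNeg (ι n + 2ℚ) {{nonNegative (<⇒≤ (0<ι+ n (positive⁻¹ 2ℚ)))}}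
    (subst₂ _<_ (sym (*-zeroʳ (ι n + 2ℚ))) (sym (recurrence n))
      (positive⁻¹ _ {{pos*pos⇒pos (ι n + ½) {{positive (0<ι+ n (positive⁻¹ ½))}} (G n) {{positive (G-pos n)}}}}))

  G-dec : ∀ n → G (suc n) ≤ G n
  G-dec n = *-cancelˡ-≤-pos (ι n + 2ℚ) {{positive (0<ι+ n (positive⁻¹ 2ℚ))}}
    (subst (_≤ (ι n + 2ℚ) * G n) (sym (recurrence n))
      (*-monoʳ-≤-nonNeg (G n) {{nonNegative (<⇒≤ (G-pos n))}} (+-monoʳ-≤ (ι n) (∸-nonNeg⁻¹ {½} {2ℚ} (nonNegative⁻¹ _)))))

  G-anti : ∀ m n → m ℕ.≤ n → G n ≤ G m
  G-anti m n m≤n with ℕ.m≤n⇒m<n∨m≡n m≤n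
  ... | inj₂ refl = ≤-refl
  G-anti m (suc n) _ | inj₁ m<1+n = ≤-trans (G-dec n) (G-anti m n (ℕ.s≤s⁻¹ m<1+n))

  -- Twice the tail of the series Σ G, whose sum is ½. It serves as the error bound throughout.
  Z : Seq
  Z n = 1ℚ - (sum G n + sum G n)

  4ℚ : ℚ
  4ℚ = ℤ.+ 4 / 1

  Z-suc : ∀ n → Z (suc n) ≡ Z n - (G n + G n)
  Z-suc n = trans (cong (λ s → 1ℚ - (s + s)) (sum-sucʳ G n))
    (solve 2 (λ s g → con 1ℚ :- ((s :+ g) :+ (s :+ g)) := (con 1ℚ :- (s :+ s)) :- (g :+ g)) refl (sum G n) (G n))

  Z≡ : ∀ n → Z n ≡ 4ℚ * ((ι n + 1ℚ) * G n)
  Z≡ zero    = cong (λ g → 4ℚ * ((0ℚ + 1ℚ) * g)) (sym G0)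
  Z≡ (suc n) = begin
    Z (suc n)                                 ≡⟨ Z-suc n ⟩
    Z n - (G n + G n)                         ≡⟨ cong (_- (G n + G n)) (Z≡ n) ⟩
    4ℚ * ((ι n + 1ℚ) * G n) - (G n + G n)     ≡⟨ solve 2 (λ k g → con 4ℚ :* ((k :+ con 1ℚ) :* g) :- (g :+ g) := con 4ℚ :* ((k :+ con ½) :* g))
        refl (ι n) (G n) ⟩
    4ℚ * ((ι n + ½) * G n)                    ≡⟨ cong (4ℚ *_) (sym (recurrence n)) ⟩
    4ℚ * ((ι n + 2ℚ) * G (suc n))             ≡⟨ cong (λ k → 4ℚ * (k * G (suc n))) (sym (trans (cong (_+ 1ℚ) (ι-suc n)) (+-assoc (ι n) 1ℚ 1ℚ))) ⟩
    4ℚ * ((ι (suc n) + 1ℚ) * G (suc n))       ∎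
    where open ≡-Reasoning

  Z-recurrence : ∀ n → (ι n + 1ℚ) * Z (suc n) ≡ (ι n + ½) * Z n
  Z-recurrence n = trans (cong ((ι n + 1ℚ) *_) (trans (Z-suc n) (cong (_- (G n + G n)) (Z≡ n))))
    (trans (solve 2 (λ k g → (k :+ con 1ℚ) :* (con 4ℚ :* ((k :+ con 1ℚ) :* g) :- (g :+ g)) := (k :+ con ½) :* (con 4ℚ :* ((k :+ con 1ℚ) :* g)))
        refl (ι n) (G n))
      (cong ((ι n + ½) *_) (sym (Z≡ n))))

  Z-nonNeg : ∀ n → 0ℚ ≤ Z n
  Z-nonNeg n = subst (0ℚ ≤_) (sym (Z≡ n))
    (*-nonNeg (nonNegative⁻¹ 4ℚ) (*-nonNeg (<⇒≤ (0<ι+ n (positive⁻¹ 1ℚ))) (<⇒≤ (G-pos n))))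

  G≤Z : ∀ n → G n ≤ Z n
  G≤Z n = subst (G n ≤_) (trans (solve 2 (λ g k → g :+ (con (ℤ.+ 3 / 1) :* g :+ con 4ℚ :* (k :* g)) := con 4ℚ :* ((k :+ con 1ℚ) :* g))
      refl (G n) (ι n)) (sym (Z≡ n)))
    (subst (_≤ G n + (ℤ.+ 3 / 1 * G n + 4ℚ * (ι n * G n))) (+-identityʳ (G n)) (+-monoʳ-≤ (G n)
      (+-mono-≤ (*-nonNeg (nonNegative⁻¹ (ℤ.+ 3 / 1)) 0≤g) (*-nonNeg (nonNegative⁻¹ 4ℚ) (*-nonNeg (0≤ι n) 0≤g)))))
    where 0≤g = <⇒≤ (G-pos n)

  -- The left side is 1 at n = 0 and does not increase: Z is multiplied by (2 n + 1) / (2 n + 2) at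
  -- each step, and (2 n + 1) (2 n + 3) ≤ (2 n + 2)². Hence Z decays like 1 / √n.
  Z²-bound : ∀ n → sq (Z n) * (ι n + ι n + 1ℚ) ≤ 1ℚ
  Z²-bound zero = ≤-refl
  Z²-bound (suc n) = ≤-trans (*-cancelˡ-≤-pos (sq (k + 1ℚ)) {{positive 0<sq}} (∸-nonNeg⁻¹
      (subst (0ℚ ≤_) (sym eq) (*-nonNeg (nonNegative⁻¹ ¼) (*-nonNeg (+-mono-≤ (+-mono-≤ (0≤ι n) (0≤ι n)) (nonNegative⁻¹ 1ℚ)) (*-nonNeg (Z-nonNeg n) (Z-nonNeg n)))))))
    (Z²-bound n)
    where
    k = ι n
    0<k+1 = 0<ι+ n (positive⁻¹ 1ℚ)
    0<sq : 0ℚ < sq (k + 1ℚ)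
    0<sq = positive⁻¹ _ {{pos*pos⇒pos (k + 1ℚ) {{positive 0<k+1}} (k + 1ℚ) {{positive 0<k+1}}}}
    eq : sq (k + 1ℚ) * (sq (Z n) * (k + k + 1ℚ)) - sq (k + 1ℚ) * (sq (Z (suc n)) * (ι (suc n) + ι (suc n) + 1ℚ))
       ≡ ¼ * ((k + k + 1ℚ) * sq (Z n))
    eq = begin
      _ ≡⟨ cong (λ j → sq (k + 1ℚ) * (sq (Z n) * (k + k + 1ℚ)) - sq (k + 1ℚ) * (sq (Z (suc n)) * (j + j + 1ℚ))) (ι-suc n) ⟩
      _ ≡⟨ solve 3 (λ k z y → let k+1 = k :+ con 1ℚ in
             (k+1 :* k+1) :* ((z :* z) :* (k :+ k :+ con 1ℚ)) :- (k+1 :* k+1) :* ((y :* y) :* (k+1 :+ k+1 :+ con 1ℚ))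
             := (k+1 :* k+1) :* ((z :* z) :* (k :+ k :+ con 1ℚ)) :- ((k+1 :* y) :* (k+1 :* y)) :* (k+1 :+ k+1 :+ con 1ℚ)) refl k (Z n) (Z (suc n)) ⟩
      _ ≡⟨ cong (λ y → sq (k + 1ℚ) * (sq (Z n) * (k + k + 1ℚ)) - sq y * ((k + 1ℚ) + (k + 1ℚ) + 1ℚ)) (Z-recurrence n) ⟩
      _ ≡⟨ solve 2 (λ k z → let k+1 = k :+ con 1ℚ in
             (k+1 :* k+1) :* ((z :* z) :* (k :+ k :+ con 1ℚ)) :- (((k :+ con ½) :* z) :* ((k :+ con ½) :* z)) :* (k+1 :+ k+1 :+ con 1ℚ)
             := con ¼ :* ((k :+ k :+ con 1ℚ) :* (z :* z))) refl k (Z n) ⟩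
      _ ∎
      where open ≡-Reasoning

  Z→0 : ∀ {ε} → 0ℚ < ε → Eventually λ n → Z n ≤ ε
  Z→0 {ε} 0<ε with 1/k→0 {sq ε} (positive⁻¹ _ {{pos*pos⇒pos ε {{positive 0<ε}} ε {{positive 0<ε}}}})
  ... | N , small = N , λ n N≤n → ≮⇒≥ λ ε<Z → <-irrefl refl (<-≤-trans
        (*-mono-< (<⇒≤ 0<ε) (<⇒≤ ε<Z) (<⇒≤ 0<ε) (<-trans 0<ε ε<Z) ε<Z)
        (≤-trans (bound n) (small n N≤n)))
    where
    bound : ∀ n → sq (Z n) ≤ ℤ.+ 1 / suc n
    bound n = *-cancelˡ-≤-pos (ι (suc n)) {{positive (0<ι-suc n)}} (subst (ι (suc n) * sq (Z n) ≤_) (sym (trans (*-comm (ι (suc n)) _) (/-*-cancel 1 (suc n))))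
      (≤-trans (subst₂ _≤_ (*-comm (sq (Z n)) (ι (suc n))) refl
        (*-monoˡ-≤-nonNeg (sq (Z n)) {{nonNegative (*-nonNeg (Z-nonNeg n) (Z-nonNeg n))}}
          (subst (_≤ ι n + ι n + 1ℚ) (sym (ι-suc n)) (+-monoˡ-≤ 1ℚ (subst (_≤ ι n + ι n) (+-identityˡ (ι n)) (+-monoˡ-≤ (ι n) (0≤ι n)))))))
        (Z²-bound n)))

  half< : ∀ {ε} → 0ℚ < ε → ½ * ε < ε
  half< {ε} 0<ε = subst₂ _<_ (+-identityˡ (½ * ε)) (halves ε) (+-monoˡ-< (½ * ε) (pos½ 0<ε))

  -- The tail of `x` is dominated by that of `G`, twice which is Z m - Z (m + k).
  sum-tail : ∀ {x} → (∀ n → 0≤ x n ≤ G n) → ∀ m k → 0≤ sum x (m ℕ.+ k) - sum x m ≤ Z m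
  sum-tail {x} x≤G m k = subst (0≤_≤ Z m)
    (trans (solve 2 (λ s t → t := (s :+ t) :- s) refl (sum x m) (sum (x ∘ (m ℕ.+_)) k)) (cong (_- sum x m) (sym (sum-+ x m k))))
    (proj₁ within , ≤-trans (proj₂ within) tail≤Z)
    where
    tail : ℚ
    tail = sum (G ∘ (m ℕ.+_)) k
    within : 0≤ sum (x ∘ (m ℕ.+_)) k ≤ tail
    within = sum-within k (λ i → x≤G (m ℕ.+ i))
    tail≤Z : tail ≤ Z m
    tail≤Z = ∸-nonNeg⁻¹ (subst (0ℚ ≤_)
      (trans (cong (λ s → 1ℚ - (s + s) + tail) (sum-+ G m k))
        (solve 2 (λ s t → con 1ℚ :- ((s :+ t) :+ (s :+ t)) :+ t := con 1ℚ :- (s :+ s) :- t) refl (sum G m) tail))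
      (+-mono-≤ (Z-nonNeg (m ℕ.+ k)) (≤-trans (proj₁ within) (proj₂ within))))

  sum-cauchy : ∀ {x} → (∀ n → 0≤ x n ≤ G n) → Cauchy (sum x)
  sum-cauchy {x} x≤G ε 0<ε = let N , Z≤ = Z→0 (pos½ 0<ε) in N , λ m n N≤m N≤n → ≤-<-trans
    (subst₂ (λ i j → ∣ sum x i - sum x j ∣ ≤ Z N) (ℕ.m+[n∸m]≡n N≤m) (ℕ.m+[n∸m]≡n N≤n)
      (subst (λ d → ∣ d ∣ ≤ Z N)
        (solve 3 (λ a b c → (a :- c) :- (b :- c) := a :- b) refl
          (sum x (N ℕ.+ (m ℕ.∸ N))) (sum x (N ℕ.+ (n ℕ.∸ N))) (sum x N))
        (0≤-diff (sum-tail x≤G N (m ℕ.∸ N)) (sum-tail x≤G N (n ℕ.∸ N)))))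
    (≤-<-trans (Z≤ N ℕ.≤-refl) (half< 0<ε))

  sum-G : ∀ n → ∣ sum G n - ½ ∣ ≤ Z n
  sum-G n = ∣∣≤
    (≤-trans (≤-reflexive (solve 1 (λ s → s :- con ½ := :- (con ½ :* (con 1ℚ :- (s :+ s)))) refl (sum G n)))
      (≤-trans (neg-antimono-≤ 0≤½Z) (Z-nonNeg n)))
    (subst₂ _≤_ (solve 1 (λ s → con ½ :* (con 1ℚ :- (s :+ s)) := :- (s :- con ½)) refl (sum G n)) (halves (Z n))
      (subst (_≤ ½ * Z n + ½ * Z n) (+-identityʳ (½ * Z n)) (+-monoʳ-≤ (½ * Z n) 0≤½Z)))
    where
    0≤½Z : 0ℚ ≤ ½ * Z n
    0≤½Z = *-nonNeg (nonNegative⁻¹ ½) (Z-nonNeg n)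

import Defs

-- Convergence of ρ by contraction, and the equations for its limit and its weighted sum.

module Renewal (G : Seq) (G0 : G 0 ≡ ℤ.+ 1 ℚ./ 4) (G-rec : ∀ n → G (suc n) ≡ conv G G n)
  (u ρ : Seq) (0≤u : ∀ n → ℚ.0ℚ ℚ.≤ u n) (0≤ρ : ∀ n → ℚ.0ℚ ℚ.≤ ρ n) (u+ρ≤1 : ∀ n → u n ℚ.+ ρ n ℚ.≤ ℚ.1ℚ)
  (ρ-zero : ρ 0 ℚ.* G 0 ≡ ℤ.+ 1 ℚ./ 16) (ρ-rec : ∀ n → ρ (suc n) ℚ.* G (suc n) ≡ conv (u · G) (ρ · G) n)
  (u+ρ-cauchy : Defs.Cauchy λ n → u n ℚ.+ ρ n) where

  open import Data.Rational
  open import Data.Rational.Properties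
  open import Defs using (Eventually; Cauchy; 1/k→0; pos½; p≤p+q)
  open Catalan G G0 G-rec

  U X : Seq
  U = sum (u · G)
  X = sum (ρ · G)

  one : Seq
  one _ = 1ℚ

  G-within : ∀ n → 0≤ G n ≤ G n
  G-within n = 0≤-refl (<⇒≤ (G-pos n))

  u-within : ∀ n → 0≤ u n ≤ 1ℚ
  u-within n = 0≤u n , ≤-trans (p≤p+q (u n) (0≤ρ n)) (u+ρ≤1 n)

  ρ-within : ∀ n → 0≤ ρ n ≤ 1ℚ
  ρ-within n = 0≤ρ n , ≤-trans (subst (ρ n ≤_) (+-comm (ρ n) (u n)) (p≤p+q (ρ n) (0≤u n))) (u+ρ≤1 n)

  ·G-within : ∀ v → (∀ n → 0≤ v n ≤ 1ℚ) → ∀ n → 0≤ (v · G) n ≤ G n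
  ·G-within v v≤1 n = subst (0≤ (v · G) n ≤_) (*-identityˡ (G n)) (0≤-* (v≤1 n) (G-within n))

  -- What conv (v · G) (r · G) exceeds its head terms by, when all weights are lowered to the
  -- latest value of G.  It is monotone in v and r, and for v = r = 1 it can be computed,
  -- since G is its own convolution square.
  remainder : ℕ → ℕ → Seq → Seq → ℚ
  remainder K m v r = (head K (v · G) (r · G-w) M + head K (r · G) (v · G-w) M)
                      + conv ((v · G) ∘ (K ℕ.+_)) ((r · G) ∘ (K ℕ.+_)) m
    where
    M = K ℕ.+ m
    G-w : Seq
    G-w i = G i - G (suc (K ℕ.+ M))

  remainder≡ : ∀ K m v r → remainder K m v r ≡
    conv (v · G) (r · G) (K ℕ.+ (K ℕ.+ m))
    - G (suc (K ℕ.+ (K ℕ.+ m))) * (head K (v · G) r (K ℕ.+ m) + head K (r · G) v (K ℕ.+ m))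
  remainder≡ K m v r = trans
    (cong (_+ C) (cong₂ _+_ (sym (head-weight K (v · G) r G w M)) (sym (head-weight K (r · G) v G w M))))
    (trans (solve 6 (λ a b w c d e → ((a :- w :* b) :+ (c :- w :* d)) :+ e := ((a :+ c) :+ e) :- w :* (b :+ d)) refl
        (head K (v · G) (r · G) M) (head K (v · G) r M) w (head K (r · G) (v · G) M) (head K (r · G) v M) C)
      (cong (_- w * (head K (v · G) r M + head K (r · G) v M)) (sym (conv-peel₂ K (v · G) (r · G) m))))
    where
    M = K ℕ.+ m
    w = G (suc (K ℕ.+ M))
    C = conv ((v · G) ∘ (K ℕ.+_)) ((r · G) ∘ (K ℕ.+_)) m

  -- The lowered weights stay nonnegative because `G` decreases and no index exceeds the one at
  -- which the common weight is taken. So every term can only grow when `u` and `ρ` are replaced by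
  -- 1.
  remainder-within : ∀ K m → 0≤ remainder K m u ρ ≤ remainder K m one one
  remainder-within K m = 0≤-+
    (0≤-+ (head-within K M (weighted u u-within) (excess ρ ρ-within)) (head-within K M (weighted ρ ρ-within) (excess u u-within)))
    (conv-within m (λ i → weighted u u-within (K ℕ.+ i)) (λ i → weighted ρ ρ-within (K ℕ.+ i)))
    where
    M = K ℕ.+ m
    weighted : ∀ v → (∀ n → 0≤ v n ≤ 1ℚ) → ∀ n → 0≤ (v · G) n ≤ (one · G) n
    weighted v v≤1 n = 0≤-* (v≤1 n) (G-within n)
    excess : ∀ v → (∀ n → 0≤ v n ≤ 1ℚ) → ∀ i → i ℕ.≤ K ℕ.+ M →
      0≤ v i * (G i - G (suc (K ℕ.+ M))) ≤ 1ℚ * (G i - G (suc (K ℕ.+ M)))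
    excess v v≤1 i i≤ = 0≤-* (v≤1 i) (0≤-refl (∸-nonNeg (G-anti i (suc (K ℕ.+ M)) (ℕ.m≤n⇒m≤1+n i≤))))

  remainder-one : ∀ K m → remainder K m one one ≡ G (suc (K ℕ.+ (K ℕ.+ m))) * Z K
  remainder-one K m = trans (remainder≡ K m one one)
    (trans (cong₂ (λ c h → c - w * (h + h))
        (trans (conv-cong (K ℕ.+ M) (λ i _ → *-identityˡ (G i)) (λ i _ → *-identityˡ (G i))) (sym (G-rec (K ℕ.+ M))))
        (trans (head-cong K M (λ i → *-identityˡ (G i)) (λ _ → refl)) (head-one K G M)))
      (solve 2 (λ w s → w :- w :* (s :+ s) := w :* (con 1ℚ :- (s :+ s))) refl w (sum G K)))
    where
    M = K ℕ.+ m
    w = G (suc (K ℕ.+ M))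

  0≤-cancel : ∀ {r p q} → 0ℚ < r → 0≤ r * p ≤ r * q → 0≤ p ≤ q
  0≤-cancel {r} {p} 0<r (0≤rp , rp≤rq) =
    *-cancelˡ-≤-pos r (subst (_≤ r * p) (sym (*-zeroʳ r)) 0≤rp) , *-cancelˡ-≤-pos r rp≤rq
    where instance _ = positive 0<r

  -- Division of the remainder by the latest value of `G` gives an approximate renewal equation
  -- whose error is uniform in `m`.
  renewal : ∀ K m → 0≤ ρ (suc (K ℕ.+ (K ℕ.+ m))) - (head K (u · G) ρ (K ℕ.+ m) + head K (ρ · G) u (K ℕ.+ m)) ≤ Z K
  renewal K m = 0≤-cancel (G-pos (suc n)) (subst₂ 0≤_≤_
    (trans (remainder≡ K m u ρ) (trans (cong (_- w * h) (trans (sym (ρ-rec n)) (*-comm (ρ (suc n)) w)))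
      (solve 3 (λ r w h → w :* r :- w :* h := w :* (r :- h)) refl (ρ (suc n)) w h)))
    (remainder-one K m)
    (remainder-within K m))
    where
    n = K ℕ.+ (K ℕ.+ m)
    w = G (suc n)
    h = head K (u · G) ρ (K ℕ.+ m) + head K (ρ · G) u (K ℕ.+ m)

  sum-bound : ∀ K → U K + X K ≤ ½
  sum-bound K = ≤-trans
    (subst (_≤ sum G K) (sym (sum-add {z = (λ n → u n + ρ n) · G} (λ i → sym (*-distribʳ-+ (G i) (u i) (ρ i))) K))
      (proj₂ (sum-within K (·G-within (λ n → u n + ρ n) (λ n → +-mono-≤ (0≤u n) (0≤ρ n) , u+ρ≤1 n)))))
    (∸-nonNeg⁻¹ (subst (0ℚ ≤_) (solve 1 (λ s → con ½ :* (con 1ℚ :- (s :+ s)) := con ½ :- s) refl (sum G K))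
      (*-nonNeg (nonNegative⁻¹ ½) (Z-nonNeg K))))

  U-nonNeg : ∀ K → 0ℚ ≤ U K
  U-nonNeg K = proj₁ (sum-within K (·G-within u u-within))

  Close : Seq → ℚ → Set
  Close x D = ∃[ N ] (∀ m n → N ℕ.≤ m → N ℕ.≤ n → ∣ x m - x n ∣ ≤ D)

  ∣∣-+ : ∀ {p q r p′ q′} → r ≡ p + q → ∣ p ∣ ≤ p′ → ∣ q ∣ ≤ q′ → ∣ r ∣ ≤ p′ + q′
  ∣∣-+ {p} {q} refl p≤ q≤ = ≤-trans (∣p+q∣≤∣p∣+∣q∣ p q) (+-mono-≤ p≤ q≤)

  -- The tail of ρ is, up to Z K, an affine image of itself with coefficients of total weight at most ½.
  contract : ∀ D ε → 0ℚ < ε → Close ρ D → Close ρ (½ * D + ε)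
  contract D ε 0<ε (N₁ , ρ-close) = let N₂ , q-close = u+ρ-cauchy ε 0<ε ; K , Z≤ = Z→0 (pos½ 0<ε) in
    contract-by N₂ q-close K (Z≤ K ℕ.≤-refl)
    where
    contract-by : ∀ N₂ → (∀ m n → N₂ ℕ.≤ m → N₂ ℕ.≤ n → ∣ (u m + ρ m) - (u n + ρ n) ∣ < ε) →
      ∀ K → Z K ≤ ½ * ε → Close ρ (½ * D + ε)
    contract-by N₂ q-close K Z≤ = suc (K ℕ.+ (K ℕ.+ N)) , λ i j N≤i N≤j → subst₂ (λ i j → ∣ ρ i - ρ j ∣ ≤ ½ * D + ε)
        (eq N≤i) (eq N≤j) (close (i ℕ.∸ suc (K ℕ.+ (K ℕ.+ N))) (j ℕ.∸ suc (K ℕ.+ (K ℕ.+ N))))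
      where
      N = N₁ ℕ.⊔ N₂
      eq : ∀ {i} → suc (K ℕ.+ (K ℕ.+ N)) ℕ.≤ i → suc (K ℕ.+ (K ℕ.+ (N ℕ.+ (i ℕ.∸ suc (K ℕ.+ (K ℕ.+ N)))))) ≡ i
      eq {i} N≤i = trans (cong suc (trans (cong (K ℕ.+_) (sym (ℕ.+-assoc K N d))) (sym (ℕ.+-assoc K (K ℕ.+ N) d)))) (ℕ.m+[n∸m]≡n N≤i)
        where d = i ℕ.∸ suc (K ℕ.+ (K ℕ.+ N))
      0≤D : 0ℚ ≤ D
      0≤D = ≤-trans (0≤∣p∣ _) (ρ-close N₁ N₁ ℕ.≤-refl ℕ.≤-refl)
      ρ-near : ∀ i j → N ℕ.≤ i → N ℕ.≤ j → ∣ ρ i - ρ j ∣ ≤ D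
      ρ-near i j N≤i N≤j = ρ-close i j (ℕ.m⊔n≤o⇒m≤o N₁ N₂ N≤i) (ℕ.m⊔n≤o⇒m≤o N₁ N₂ N≤j)
      -- As u is (u + ρ) - ρ and u + ρ is Cauchy, u oscillates by at most ε more than ρ does.
      u-near : ∀ i j → N ℕ.≤ i → N ℕ.≤ j → ∣ u i - u j ∣ ≤ ε + D
      u-near i j N≤i N≤j = ∣∣-+
        (solve 4 (λ u r v s → u :- v := ((u :+ r) :- (v :+ s)) :+ (s :- r)) refl (u i) (ρ i) (u j) (ρ j))
        (<⇒≤ (q-close i j (ℕ.m⊔n≤o⇒n≤o N₁ N₂ N≤i) (ℕ.m⊔n≤o⇒n≤o N₁ N₂ N≤j)))
        (ρ-near j i N≤j N≤i)
      close : ∀ k l → ∣ ρ (suc (K ℕ.+ (K ℕ.+ (N ℕ.+ k)))) - ρ (suc (K ℕ.+ (K ℕ.+ (N ℕ.+ l)))) ∣ ≤ ½ * D + ε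
      close k l = ≤-trans
        (∣∣-+ (solve 6 (λ r a b s c d → r :- s := ((r :- (a :+ b)) :- (s :- (c :+ d))) :+ ((a :- c) :+ (b :- d))) refl
            (ρ (suc (K ℕ.+ M k))) (head K (u · G) ρ (M k)) (head K (ρ · G) u (M k))
            (ρ (suc (K ℕ.+ M l))) (head K (u · G) ρ (M l)) (head K (ρ · G) u (M l)))
          (0≤-diff (renewal K (N ℕ.+ k)) (renewal K (N ℕ.+ l)))
          (∣∣-+ refl
            (head-diff K (M k) (M l) (λ i → proj₁ (·G-within u u-within i)) (λ i j ≤i ≤j → ρ-near i j (N≤ k ≤i) (N≤ l ≤j)))
            (head-diff K (M k) (M l) (λ i → proj₁ (·G-within ρ ρ-within i)) (λ i j ≤i ≤j → u-near i j (N≤ k ≤i) (N≤ l ≤j)))))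
        -- Z + U D + X (ε + D) ≤ ½ D + ε follows from U + X ≤ ½ and Z ≤ ½ ε.
        (∸-nonNeg⁻¹ (subst (0ℚ ≤_)
          (solve 5 (λ u x d e z → (con ½ :- (u :+ x)) :* d :+ ((con ½ :- (u :+ x)) :+ u) :* e :+ (con ½ :* e :- z)
             := (con ½ :* d :+ e) :- (z :+ (u :* d :+ x :* (e :+ d)))) refl (U K) (X K) D ε (Z K))
          (+-mono-≤ (+-mono-≤ (*-nonNeg (∸-nonNeg (sum-bound K)) 0≤D)
              (*-nonNeg (+-mono-≤ (∸-nonNeg (sum-bound K)) (U-nonNeg K)) (<⇒≤ 0<ε)))
            (∸-nonNeg (Z≤)))))
        where
        M : ℕ → ℕ
        M k = K ℕ.+ (N ℕ.+ k)
        N≤ : ∀ k {i} → M k ℕ.≤ i → N ℕ.≤ i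
        N≤ k ≤i = ℕ.≤-trans (ℕ.≤-trans (ℕ.m≤m+n N k) (ℕ.m≤n+m (N ℕ.+ k) K)) ≤i

  ½^ : ℕ → ℚ
  ½^ zero    = 1ℚ
  ½^ (suc k) = ½ * ½^ k

  ½^-nonNeg : ∀ k → 0ℚ ≤ ½^ k
  ½^-nonNeg zero    = nonNegative⁻¹ 1ℚ
  ½^-nonNeg (suc k) = *-nonNeg (nonNegative⁻¹ ½) (½^-nonNeg k)

  -- The left side starts at 1 and does not increase. This compares the powers of ½ with 1 / (k +
  -- 1), which is known to tend to 0.
  ½^-bound : ∀ k → ι (suc k) * ½^ k ≤ 1ℚ
  ½^-bound zero    = ≤-refl
  ½^-bound (suc k) = ≤-trans (∸-nonNeg⁻¹ (subst (0ℚ ≤_)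
    (trans (solve 2 (λ j h → (con ½ :* j) :* h := (j :+ con 1ℚ) :* h :- ((j :+ con 1ℚ) :+ con 1ℚ) :* (con ½ :* h))
        refl (ι k) (½^ k))
      (cong₂ (λ i j → i * ½^ k - j * (½ * ½^ k)) (sym (ι-suc k)) (sym (trans (ι-suc (suc k)) (cong (_+ 1ℚ) (ι-suc k))))))
    (*-nonNeg (*-nonNeg (nonNegative⁻¹ ½) (0≤ι k)) (½^-nonNeg k)))) (½^-bound k)

  ½^→0 : ∀ {ε} → 0ℚ < ε → ∃[ k ] ½^ k ≤ ε
  ½^→0 0<ε = let k , small = 1/k→0 0<ε in k , ≤-trans (*-cancelˡ-≤-pos (ι (suc k)) {{positive (0<ι-suc k)}}
    (subst (ι (suc k) * ½^ k ≤_) (sym (trans (*-comm (ι (suc k)) _) (/-*-cancel 1 (suc k)))) (½^-bound k))) (small k ℕ.≤-refl)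

  -- ε + ε is the fixed point of D ↦ ½ D + ε; the distance to it is halved by every contraction,
  -- starting from the trivial bound 1.
  ρ-close : ∀ {ε} → 0ℚ < ε → ∀ k → Close ρ (½^ k + (ε + ε))
  ρ-close {ε} 0<ε zero    = 0 , λ m n _ _ → ≤-trans (0≤-diff (ρ-within m) (ρ-within n)) (p≤p+q 1ℚ (<⇒≤ (+-mono-< 0<ε 0<ε)))
  ρ-close {ε} 0<ε (suc k) = subst (Close ρ)
    (solve 2 (λ h e → con ½ :* (h :+ (e :+ e)) :+ e := con ½ :* h :+ (e :+ e)) refl (½^ k) ε)
    (contract (½^ k + (ε + ε)) ε 0<ε (ρ-close 0<ε k))

  ρ-cauchy : Cauchy ρ
  ρ-cauchy ε 0<ε = let k , ½^k≤ = ½^→0 (pos½ (pos½ 0<ε)) ; N , close = ρ-close (pos½ (pos½ 0<ε)) k in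
    N , λ m n N≤m N≤n → ≤-<-trans (≤-trans (close m n N≤m N≤n) (+-monoˡ-≤ (δ + δ) ½^k≤))
    (subst₂ _<_ (+-identityˡ (δ + (δ + δ)))
      (solve 1 (λ e → con ½ :* (con ½ :* e) :+ (con ½ :* (con ½ :* e) :+ (con ½ :* (con ½ :* e) :+ con ½ :* (con ½ :* e))) := e)
          refl ε)
      (+-monoˡ-< (δ + (δ + δ)) (pos½ (pos½ 0<ε))))
    where δ = ½ * (½ * ε)

  head-const : ∀ K x v m → head K x (λ _ → v) m ≡ sum x K * v
  head-const zero    x v m = sym (*-zeroˡ v)
  head-const (suc K) x v m = trans (cong (x 0 * v +_) (head-const K (x ∘ suc) v m)) (sym (*-distribʳ-+ v (x 0) _))

  -- Take K = n in the renewal inequality for ρ (2 n + 1). The heads then evaluate ρ and u only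
  -- beyond n, where both have settled, so these values may be replaced by ρ n and u n.
  ρ-limit : ∀ δ → 0ℚ < δ → Eventually λ n → ∣ ρ n - (U n * ρ n + X n * u n) ∣ ≤ δ + (δ + δ)
  ρ-limit δ 0<δ = let N₁ , ρ-near = ρ-cauchy δ 0<δ ; N₂ , q-near = u+ρ-cauchy δ 0<δ ; N₃ , Z≤ = Z→0 0<δ in
    N₁ ℕ.⊔ (N₂ ℕ.⊔ N₃) , λ n N≤n →
    let N₁≤n = ℕ.m⊔n≤o⇒m≤o N₁ (N₂ ℕ.⊔ N₃) N≤n
        N₂⊔N₃≤n = ℕ.m⊔n≤o⇒n≤o N₁ (N₂ ℕ.⊔ N₃) N≤n
        N₂≤n = ℕ.m⊔n≤o⇒m≤o N₂ N₃ N₂⊔N₃≤n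
        N₃≤n = ℕ.m⊔n≤o⇒n≤o N₂ N₃ N₂⊔N₃≤n
        n≤n+0 = ℕ.≤-reflexive (sym (ℕ.+-identityʳ n))
        n′ = suc (n ℕ.+ (n ℕ.+ 0))
        n≤n′ = ℕ.m≤n⇒m≤1+n (ℕ.m≤m+n n (n ℕ.+ 0))
        M = n ℕ.+ 0
        N₁≤ : ∀ {i} → M ℕ.≤ i → N₁ ℕ.≤ i
        N₁≤ M≤i = ℕ.≤-trans N₁≤n (ℕ.≤-trans n≤n+0 M≤i)
        N₂≤ : ∀ {i} → M ℕ.≤ i → N₂ ℕ.≤ i
        N₂≤ M≤i = ℕ.≤-trans N₂≤n (ℕ.≤-trans n≤n+0 M≤i)
        h₁ = head n (u · G) ρ M
        h₂ = head n (ρ · G) u M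
    in ≤-trans
         (∣∣-+ {p = ρ n - ρ n′} {q = (ρ n′ - (h₁ + h₂)) + ((h₁ - U n * ρ n) + (h₂ - X n * u n))}
           (solve 6 (λ r s h k a b → r :- (a :+ b) := (r :- s) :+ ((s :- (h :+ k)) :+ ((h :- a) :+ (k :- b)))) refl
             (ρ n) (ρ n′) h₁ h₂ (U n * ρ n) (X n * u n))
           (<⇒≤ (ρ-near n n′ N₁≤n (ℕ.≤-trans N₁≤n n≤n′)))
           (∣∣-+ refl (≤-trans (∣∣-within (proj₁ (renewal n 0))) (≤-trans (proj₂ (renewal n 0)) (Z≤ n N₃≤n)))
             (∣∣-+ refl
               (subst (λ c → ∣ h₁ - c ∣ ≤ U n * δ) (head-const n (u · G) (ρ n) M)
                 (head-diff n M M (λ i → proj₁ (·G-within u u-within i)) (λ i j M≤i _ → <⇒≤ (ρ-near i n (N₁≤ M≤i) N₁≤n))))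
               (subst (λ c → ∣ h₂ - c ∣ ≤ X n * (δ + δ)) (head-const n (ρ · G) (u n) M)
                 (head-diff n M M (λ i → proj₁ (·G-within ρ ρ-within i)) (λ i j M≤i _ → ∣∣-+
                   (solve 4 (λ u r v s → u :- v := ((u :+ r) :- (v :+ s)) :+ (s :- r)) refl (u i) (ρ i) (u n) (ρ n))
                   (<⇒≤ (q-near i n (N₂≤ M≤i) N₂≤n)) (<⇒≤ (ρ-near n i N₁≤n (N₁≤ M≤i)))))))))
         -- The heads cost (U + 2 X) δ, at most δ since U + X ≤ ½ and U ≥ 0.
         (∸-nonNeg⁻¹ (subst (0ℚ ≤_)
           (solve 3 (λ u x d → ((con ½ :- (u :+ x)) :+ (con ½ :- (u :+ x)) :+ u) :* d
              := (d :+ (d :+ d)) :- (d :+ (d :+ (u :* d :+ x :* (d :+ d))))) refl (U n) (X n) δ)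
           (*-nonNeg (+-mono-≤ (+-mono-≤ (∸-nonNeg (sum-bound n)) (∸-nonNeg (sum-bound n))) (U-nonNeg n)) (<⇒≤ 0<δ))))

  -- Summing the recurrence gives X (n + 1) = 1/16 + Σ conv. Up to the last term of X, the error is
  -- the part of the product U X missing from the sum of convolutions, and this is dominated by the
  -- same quantity for `G`.
  X-limit : ∀ n → ∣ X n - (ℤ.+ 1 / 16 + U n * X n) ∣ ≤ Z n + Z n
  X-limit n = ∣∣-+ {p = - x n} {q = - (U n * X n - C)}
    (trans (cong (_- (ℤ.+ 1 / 16 + U n * X n)) X≡)
      (solve 3 (λ c x p → ((con (ℤ.+ 1 / 16) :+ c) :- x) :- (con (ℤ.+ 1 / 16) :+ p) := :- x :+ (:- (p :- c)))
          refl C (x n) (U n * X n)))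
    (subst (_≤ Z n) (sym (∣-p∣≡∣p∣ (x n))) (≤-trans (∣∣-within (proj₁ (·G-within ρ ρ-within n))) (≤-trans (proj₂ (·G-within ρ ρ-within n)) (G≤Z n))))
    (subst (_≤ Z n) (sym (∣-p∣≡∣p∣ (U n * X n - C))) (≤-trans (∣∣-within (proj₁ within)) (≤-trans (proj₂ within) square)))
    where
    x : Seq
    x = ρ · G
    C = sum (conv (u · G) x) n
    S = sum G n
    sum-cong : ∀ {y z : Seq} k → (∀ i → y i ≡ z i) → sum y k ≡ sum z k
    sum-cong zero    eq = refl
    sum-cong (suc k) eq = cong₂ _+_ (eq 0) (sum-cong k (eq ∘ suc))
    X≡ : X n ≡ (ℤ.+ 1 / 16 + C) - x n
    X≡ = trans (solve 2 (λ s x → s := (s :+ x) :- x) refl (X n) (x n)) (cong (_- x n)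
      (trans (sym (sum-sucʳ x n)) (cong₂ _+_ ρ-zero (sum-cong n ρ-rec))))
    within : 0≤ U n * X n - C ≤ S * S - sum (conv G G) n
    within = subst (λ j → 0≤ U n * sum x j - C ≤ S * sum G j - sum (conv G G) n) (ℕ.+-identityʳ n)
      (sum-conv-within n 0 (·G-within u u-within) (·G-within ρ ρ-within))
    -- By the recurrence of `G` the left side is (½ - S)² - G n.
    square : S * S - sum (conv G G) n ≤ Z n
    square = ∸-nonNeg⁻¹ (subst (0ℚ ≤_)
      (trans (solve 2 (λ s g → (con ½ :* (con 1ℚ :- (s :+ s))) :* (con (ℤ.+ 3 / 2) :+ s) :+ g
          := (con 1ℚ :- (s :+ s)) :- (s :* s :- ((s :+ g) :- con (ℤ.+ 1 / 4)))) refl S (G n))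
        (cong (λ c → Z n - (S * S - c)) (sym C≡)))
      (+-mono-≤ (*-nonNeg (*-nonNeg (nonNegative⁻¹ ½) (Z-nonNeg n))
        (+-mono-≤ (nonNegative⁻¹ (ℤ.+ 3 / 2)) (proj₁ (sum-within n G-within)))) (<⇒≤ (G-pos n))))
      where
      C≡ : sum (conv G G) n ≡ (S + G n) - ℤ.+ 1 / 4
      C≡ = trans (sum-cong n (sym ∘ G-rec)) (trans
        (solve 2 (λ s g → s := (g :+ s) :- g) refl (sum (G ∘ suc) n) (G 0))
        (cong₂ _-_ (sum-sucʳ G n) G0))

-- From enumerated bracketings and valuations to convolution recurrences.

module Counting where

  open import Data.Bool using (Bool; true; false; if_then_else_)
  import Data.Fin as Fin
  import Data.Fin.Properties as Fin
  open import Data.List using (List; []; _∷_; _++_; map; concatMap; length; filter; allFin; cartesianProductWith; cartesianProduct)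
  import Data.List.Properties as List
  open import Data.Rational
  open import Data.Rational.Properties
  import Data.Vec as Vec
  open import Relation.Nullary using (does; Dec)
  open import Relation.Nullary.Decidable using (from-yes)
  open import Relation.Unary using (Decidable)
  open import Defs using (V₄; 𝟎; 𝐚; 𝐛; 𝟏; _⇒G_; Bracketing; _⇒_; Valuation; eval; splits; leaves; bracketings<; nodes;
    bracketings; valuations; count; hasValue?; g; g-nonZero)

  module _ {A : Set} where

    sumOver : (A → ℚ) → List A → ℚ
    sumOver φ []       = 0ℚ
    sumOver φ (x ∷ xs) = φ x + sumOver φ xs

    sumOver-cong : ∀ {φ ψ : A → ℚ} → (∀ x → φ x ≡ ψ x) → ∀ xs → sumOver φ xs ≡ sumOver ψ xs
    sumOver-cong eq []       = refl
    sumOver-cong eq (x ∷ xs) = cong₂ _+_ (eq x) (sumOver-cong eq xs)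

    sumOver-++ : ∀ φ xs ys → sumOver φ (xs ++ ys) ≡ sumOver φ xs + sumOver φ ys
    sumOver-++ φ []       ys = sym (+-identityˡ _)
    sumOver-++ φ (x ∷ xs) ys = trans (cong (φ x +_) (sumOver-++ φ xs ys)) (sym (+-assoc (φ x) _ _))

    sumOver-+ : ∀ φ ψ xs → sumOver (λ x → φ x + ψ x) xs ≡ sumOver φ xs + sumOver ψ xs
    sumOver-+ φ ψ []       = refl
    sumOver-+ φ ψ (x ∷ xs) = trans (cong (φ x + ψ x +_) (sumOver-+ φ ψ xs))
      (solve 4 (λ a b c d → (a :+ b) :+ (c :+ d) := (a :+ c) :+ (b :+ d)) refl (φ x) (ψ x) (sumOver φ xs) (sumOver ψ xs))

    sumOver-*ˡ : ∀ c φ xs → sumOver (λ x → c * φ x) xs ≡ c * sumOver φ xs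
    sumOver-*ˡ c φ []       = sym (*-zeroʳ c)
    sumOver-*ˡ c φ (x ∷ xs) = trans (cong (c * φ x +_) (sumOver-*ˡ c φ xs)) (sym (*-distribˡ-+ c (φ x) _))

    sumOver-*ʳ : ∀ c φ xs → sumOver (λ x → φ x * c) xs ≡ sumOver φ xs * c
    sumOver-*ʳ c φ []       = sym (*-zeroˡ c)
    sumOver-*ʳ c φ (x ∷ xs) = trans (cong (φ x * c +_) (sumOver-*ʳ c φ xs)) (sym (*-distribʳ-+ c (φ x) _))

  module _ {A B : Set} where

    sumOver-map : ∀ (φ : B → ℚ) (f : A → B) xs → sumOver φ (map f xs) ≡ sumOver (φ ∘ f) xs
    sumOver-map φ f []       = refl
    sumOver-map φ f (x ∷ xs) = cong (φ (f x) +_) (sumOver-map φ f xs)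

    sumOver-concatMap : ∀ (φ : B → ℚ) (f : A → List B) xs → sumOver φ (concatMap f xs) ≡ sumOver (sumOver φ ∘ f) xs
    sumOver-concatMap φ f []       = refl
    sumOver-concatMap φ f (x ∷ xs) = trans (sumOver-++ φ (f x) (concatMap f xs)) (cong (sumOver φ (f x) +_) (sumOver-concatMap φ f xs))

  sumOver-product : ∀ {A B C : Set} (φ : C → ℚ) (f : A → B → C) xs ys →
    sumOver φ (cartesianProductWith f xs ys) ≡ sumOver (λ x → sumOver (λ y → φ (f x y)) ys) xs
  sumOver-product φ f []       ys = refl
  sumOver-product φ f (x ∷ xs) ys = trans (sumOver-++ φ (map (f x) ys) (cartesianProductWith f xs ys))
    (cong₂ _+_ (sumOver-map φ (f x) ys) (sumOver-product φ f xs ys))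

  indicator : Bool → ℚ
  indicator b = if b then 1ℚ else 0ℚ

  ι-length-filter : ∀ {A : Set} {P : A → Set} (P? : Decidable P) xs →
    ι (length (filter P? xs)) ≡ sumOver (indicator ∘ does ∘ P?) xs
  ι-length-filter P? []       = refl
  ι-length-filter P? (x ∷ xs) with does (P? x)
  ... | true  = trans (ι-suc (length (filter P? xs))) (trans (+-comm (ι (length (filter P? xs))) 1ℚ) (cong (1ℚ +_) (ι-length-filter P? xs)))
  ... | false = trans (ι-length-filter P? xs) (sym (+-identityˡ _))

  -- Weighted counts treat a single value, the values above it and all values alike, and are
  -- additive in the weight.
  Weight : Set
  Weight = V₄ → ℚ

  infixl 6 _⊕_
  _⊕_ : Weight → Weight → Weight
  (φ ⊕ ψ) x = φ x + ψ x

  is : V₄ → Weight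
  is c x = indicator (does (x Fin.≟ c))

  weight : Weight → ∀ {n} → Bracketing n → ℚ
  weight φ {n} t = sumOver (λ v → φ (eval t v)) (valuations n)

  total< : Weight → ℕ → ℕ → ℚ
  total< φ h n = sumOver (weight φ) (bracketings< h n)

  total : Weight → ℕ → ℚ
  total φ n = total< φ n n

  total-is : ∀ c n → ι (count c n) ≡ total (is c) n
  total-is c n = trans (ι-length-filter (hasValue? c) (cartesianProduct (bracketings n) (valuations n)))
    (sumOver-product _ _,_ (bracketings n) (valuations n))

  total-⊕ : ∀ φ ψ n → total (φ ⊕ ψ) n ≡ total φ n + total ψ n
  total-⊕ φ ψ n = trans (sumOver-cong (λ t → sumOver-+ (λ v → φ (eval t v)) (λ v → ψ (eval t v)) (valuations n)) (bracketings n))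
    (sumOver-+ (weight φ) (weight ψ) (bracketings n))

  valuations-split : ∀ m n (ψ : Valuation m → Valuation n → ℚ) →
    sumOver (λ v → ψ (Vec.take m v) (Vec.drop m v)) (valuations (m ℕ.+ n)) ≡
    sumOver (λ u → sumOver (ψ u) (valuations n)) (valuations m)
  valuations-split zero    n ψ = sym (+-identityʳ _)
  valuations-split (suc m) n ψ = trans (sumOver-product _ Vec._∷_ (allFin 4) (valuations (m ℕ.+ n)))
    (trans (sumOver-cong (λ x → valuations-split m n (λ u → ψ (x Vec.∷ u))) (allFin 4))
      (sym (sumOver-product _ Vec._∷_ (allFin 4) (valuations m))))

  -- With such a factorization, the sum over the valuations of an implication separates into its two
  -- sides. The indicator of 1 has none; its frequency is what the other three leave.
  Factors : Weight → Weight → Weight → Set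
  Factors φ φ₁ φ₂ = ∀ x y → φ (x ⇒G y) ≡ φ₁ x * φ₂ y

  weight-⇒ : ∀ φ φ₁ φ₂ → Factors φ φ₁ φ₂ → ∀ {m n} (s : Bracketing m) (t : Bracketing n) →
    weight φ (s ⇒ t) ≡ weight φ₁ s * weight φ₂ t
  weight-⇒ φ φ₁ φ₂ factors {m} {n} s t =
    trans (valuations-split m n (λ u v → φ (eval s u ⇒G eval t v)))
    (trans (sumOver-cong (λ u → trans (sumOver-cong (λ v → factors (eval s u) (eval t v)) (valuations n))
        (sumOver-*ˡ (φ₁ (eval s u)) (λ v → φ₂ (eval t v)) (valuations n))) (valuations m))
      (sumOver-*ʳ (weight φ₂ t) (λ u → φ₁ (eval s u)) (valuations m)))

  sumOver-splits : ∀ x y n → sumOver (λ (i , j , _) → x i * y j) (splits n) ≡ conv x y n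
  sumOver-splits x y zero    = +-identityʳ _
  sumOver-splits x y (suc n) = cong (x 0 * y (suc n) +_)
    (trans (sumOver-map _ _ (splits n)) (sumOver-splits (x ∘ suc) y n))

  total<-suc : ∀ φ φ₁ φ₂ → Factors φ φ₁ φ₂ → ∀ h n →
    total< φ (suc h) n ≡ sumOver (weight φ) (leaves n) + conv (total< φ₁ h) (total< φ₂ h) n
  total<-suc φ φ₁ φ₂ factors h n =
    trans (sumOver-++ (weight φ) (leaves n) (concatMap (nodes h) (splits n)))
    (cong (sumOver (weight φ) (leaves n) +_)
      (trans (sumOver-concatMap (weight φ) (nodes h) (splits n))
      (trans (sumOver-cong total-nodes (splits n))
        (sumOver-splits (total< φ₁ h) (total< φ₂ h) n))))
    where
    total-nodes : ∀ (p : ∃[ i ] ∃[ j ] i ℕ.+ j ≡ n) →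
      sumOver (weight φ) (nodes h p) ≡ total< φ₁ h (proj₁ p) * total< φ₂ h (proj₁ (proj₂ p))
    total-nodes (i , j , refl) =
      trans (sumOver-product (weight φ) _⇒_ (bracketings< h i) (bracketings< h j))
      (trans (sumOver-cong (λ s → trans (sumOver-cong (weight-⇒ φ φ₁ φ₂ factors s) (bracketings< h j))
          (sumOver-*ˡ (weight φ₁ s) (weight φ₂) (bracketings< h j))) (bracketings< h i))
        (sumOver-*ʳ (total< φ₂ h j) (weight φ₁) (bracketings< h i)))

  bracketings<-zero : ∀ h → bracketings< h 0 ≡ []
  bracketings<-zero zero    = refl
  bracketings<-zero (suc h) rewrite bracketings<-zero h = refl

  cartesianProductWith-[] : ∀ {A B C : Set} (f : A → B → C) xs → cartesianProductWith f xs [] ≡ []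
  cartesianProductWith-[] f []       = refl
  cartesianProductWith-[] f (x ∷ xs) = cartesianProductWith-[] f xs

  nodes-zeroˡ : ∀ h j → nodes h (0 , j , refl) ≡ []
  nodes-zeroˡ h j = cong (λ ss → cartesianProductWith _⇒_ ss (bracketings< h j)) (bracketings<-zero h)

  nodes-zeroʳ : ∀ h i → nodes h (i , 0 , refl) ≡ []
  nodes-zeroʳ h i = trans (cong (cartesianProductWith _⇒_ (bracketings< h i)) (bracketings<-zero h))
    (cartesianProductWith-[] _⇒_ (bracketings< h i))

  -- Splits with an empty side give no trees for either height bound; in all others both sides have
  -- at most `h` leaves, so the induction applies.
  bracketings<-stable : ∀ h n → n ℕ.≤ h → bracketings< (suc h) n ≡ bracketings< h n
  bracketings<-stable zero    zero ℕ.z≤n = refl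
  bracketings<-stable (suc h) n n≤1+h = cong (leaves n ++_) (List.concatMap-cong nodes-stable (splits n))
    where
    nodes-stable : ∀ (p : ∃[ i ] ∃[ j ] i ℕ.+ j ≡ n) → nodes (suc h) p ≡ nodes h p
    nodes-stable (zero  , j     , refl) = trans (nodes-zeroˡ (suc h) j) (sym (nodes-zeroˡ h j))
    nodes-stable (suc i , zero  , refl) = trans (nodes-zeroʳ (suc h) (suc i)) (sym (nodes-zeroʳ h (suc i)))
    nodes-stable (suc i , suc j , refl) = cong₂ (cartesianProductWith _⇒_)
      (bracketings<-stable h (suc i) (ℕ.≤-trans (ℕ.s≤s (ℕ.m≤m+n i j)) i+j≤h))
      (bracketings<-stable h (suc j) (ℕ.≤-trans (ℕ.s≤s (ℕ.m≤n+m j i)) i+j≤h))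
      where
      i+j≤h : suc (i ℕ.+ j) ℕ.≤ h
      i+j≤h = subst (ℕ._≤ h) (ℕ.+-suc i j) (ℕ.s≤s⁻¹ n≤1+h)

  total<-stable : ∀ φ d n → total< φ (d ℕ.+ n) n ≡ total φ n
  total<-stable φ zero    n = refl
  total<-stable φ (suc d) n = trans (cong (sumOver (weight φ)) (bracketings<-stable (d ℕ.+ n) n (ℕ.m≤n+m n d))) (total<-stable φ d n)

  total<-≥ : ∀ φ h n → n ℕ.≤ h → total< φ h n ≡ total φ n
  total<-≥ φ h n n≤h = trans (cong (λ h → total< φ h n) (sym (ℕ.m∸n+n≡m n≤h))) (total<-stable φ (h ℕ.∸ n) n)

  total<-zero : ∀ φ h → total< φ h 0 ≡ 0ℚ
  total<-zero φ h = cong (sumOver (weight φ)) (bracketings<-zero h)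

  -- No bracketing has 0 leaves, so both end terms of the convolution over all splits vanish,
  -- leaving a convolution of the sequences shifted by one.
  total-recurrence : ∀ φ φ₁ φ₂ → Factors φ φ₁ φ₂ → ∀ n →
    total φ (suc (suc n)) ≡ conv (total φ₁ ∘ suc) (total φ₂ ∘ suc) n
  total-recurrence φ φ₁ φ₂ factors n = begin
    total φ (suc (suc n))
      ≡⟨ total<-suc φ φ₁ φ₂ factors (suc n) (suc (suc n)) ⟩
    0ℚ + (x 0 * y (suc (suc n)) + conv (x ∘ suc) y (suc n))
      ≡⟨ cong (λ c → 0ℚ + (x 0 * y (suc (suc n)) + c)) (conv-sucʳ (x ∘ suc) y n) ⟩
    0ℚ + (x 0 * y (suc (suc n)) + (conv (x ∘ suc) (y ∘ suc) n + x (suc (suc n)) * y 0))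
      ≡⟨ cong₂ (λ p q → 0ℚ + (p * y (suc (suc n)) + (conv (x ∘ suc) (y ∘ suc) n + x (suc (suc n)) * q))) (total<-zero φ₁ (suc n)) (total<-zero φ₂ (suc n)) ⟩
    0ℚ + (0ℚ * y (suc (suc n)) + (conv (x ∘ suc) (y ∘ suc) n + x (suc (suc n)) * 0ℚ))
      ≡⟨ solve 3 (λ a c b → con 0ℚ :+ (con 0ℚ :* a :+ (c :+ b :* con 0ℚ)) := c)
          refl (y (suc (suc n))) (conv (x ∘ suc) (y ∘ suc) n) (x (suc (suc n))) ⟩
    conv (x ∘ suc) (y ∘ suc) n
      ≡⟨ conv-cong n (λ i i≤n → total<-≥ φ₁ (suc n) (suc i) (ℕ.s≤s i≤n)) (λ i i≤n → total<-≥ φ₂ (suc n) (suc i) (ℕ.s≤s i≤n)) ⟩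
    conv (total φ₁ ∘ suc) (total φ₂ ∘ suc) n ∎
    where
    open ≡-Reasoning
    x y : Seq
    x = total< φ₁ (suc n)
    y = total< φ₂ (suc n)

  -- Each variable contributes a factor 4 from its values and asymptotically a factor 4 from the
  -- Catalan numbers; this normalization makes the totals summable.
  16^- : Seq
  16^- zero    = 1ℚ
  16^- (suc n) = ℤ.+ 1 / 16 * 16^- n

  16^-‿* : ∀ m n → 16^- m * 16^- n ≡ 16^- (m ℕ.+ n)
  16^-‿* zero    n = *-identityˡ (16^- n)
  16^-‿* (suc m) n = trans (*-assoc (ℤ.+ 1 / 16) (16^- m) (16^- n)) (cong (ℤ.+ 1 / 16 *_) (16^-‿* m n))

  scaled : Weight → Seq
  scaled φ n = 16^- (suc n) * total φ (suc n)

  scaled-recurrence : ∀ φ φ₁ φ₂ → Factors φ φ₁ φ₂ → ∀ n → scaled φ (suc n) ≡ conv (scaled φ₁) (scaled φ₂) n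
  scaled-recurrence φ φ₁ φ₂ factors n = trans (cong (16^- (suc (suc n)) *_) (total-recurrence φ φ₁ φ₂ factors n))
    (sym (conv-scale 16^- {total φ₁ ∘ suc} {total φ₂ ∘ suc} 1 1 n (λ _ → refl) (λ _ → refl) 16^-‿*))

  scaled-⊕ : ∀ φ ψ n → scaled (φ ⊕ ψ) n ≡ scaled φ n + scaled ψ n
  scaled-⊕ φ ψ n = trans (cong (16^- (suc n) *_) (total-⊕ φ ψ (suc n))) (*-distribˡ-+ (16^- (suc n)) _ _)

  >𝟎 >𝐚 >𝐛 any : Weight
  >𝟎 = is 𝐚 ⊕ (is 𝐛 ⊕ is 𝟏)
  >𝐚 = is 𝐛 ⊕ is 𝟏
  >𝐛 = is 𝟏
  any = is 𝟎 ⊕ is 𝐚 ⊕ is 𝐛 ⊕ is 𝟏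

  -- Only sixteen pairs of values are involved, so the factorizations below are settled by
  -- evaluation.
  factors? : ∀ φ φ₁ φ₂ → Dec (Factors φ φ₁ φ₂)
  factors? φ φ₁ φ₂ = Fin.all? λ x → Fin.all? λ y → φ (x ⇒G y) ≟ φ₁ x * φ₂ y

  factors-any : Factors any any any
  factors-any = from-yes (factors? any any any)

  factors-𝟎 : Factors (is 𝟎) >𝟎 (is 𝟎)
  factors-𝟎 = from-yes (factors? (is 𝟎) >𝟎 (is 𝟎))

  factors-𝐚 : Factors (is 𝐚) >𝐚 (is 𝐚)
  factors-𝐚 = from-yes (factors? (is 𝐚) >𝐚 (is 𝐚))

  factors-𝐛 : Factors (is 𝐛) >𝐛 (is 𝐛)
  factors-𝐛 = from-yes (factors? (is 𝐛) >𝐛 (is 𝐛))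

  G : Seq
  G = scaled any

  G0 : G 0 ≡ ℤ.+ 1 / 4
  G0 = refl

  G-rec : ∀ n → G (suc n) ≡ conv G G n
  G-rec = scaled-recurrence any any any factors-any

  frequency : V₄ → Seq
  frequency c n = (ℤ.+ count c (suc n) / g (suc n)) {{g-nonZero n}}

  total-any : ∀ n → total any n ≡ ι (g n)
  total-any n = sym (trans (ι-+ (count 𝟎 n ℕ.+ count 𝐚 n ℕ.+ count 𝐛 n) (count 𝟏 n)) (trans
    (cong₂ _+_ (trans (ι-+ (count 𝟎 n ℕ.+ count 𝐚 n) (count 𝐛 n)) (trans
      (cong₂ _+_ (trans (ι-+ (count 𝟎 n) (count 𝐚 n)) (trans
        (cong₂ _+_ (total-is 𝟎 n) (total-is 𝐚 n))
        (sym (total-⊕ (is 𝟎) (is 𝐚) n)))) (total-is 𝐛 n))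
      (sym (total-⊕ (is 𝟎 ⊕ is 𝐚) (is 𝐛) n)))) (total-is 𝟏 n))
    (sym (total-⊕ (is 𝟎 ⊕ is 𝐚 ⊕ is 𝐛) (is 𝟏) n))))

  frequency-* : ∀ c n → (frequency c · G) n ≡ scaled (is c) n
  frequency-* c n = begin
    frequency c n * (16^- (suc n) * total any (suc n)) ≡⟨ cong (λ k → frequency c n * (16^- (suc n) * k)) (total-any (suc n)) ⟩
    frequency c n * (16^- (suc n) * ι (g (suc n)))     ≡⟨ solve 3 (λ r p k → r :* (p :* k) := p :* (r :* k))
        refl (frequency c n) (16^- (suc n)) (ι (g (suc n))) ⟩
    16^- (suc n) * (frequency c n * ι (g (suc n)))     ≡⟨ cong (16^- (suc n) *_) (/-*-cancel (count c (suc n)) (g (suc n)) {{g-nonZero n}}) ⟩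
    16^- (suc n) * ι (count c (suc n))                 ≡⟨ cong (16^- (suc n) *_) (total-is c (suc n)) ⟩
    scaled (is c) n                                    ∎
    where open ≡-Reasoning

  frequency-nonNeg : ∀ c n → 0ℚ ≤ frequency c n
  frequency-nonNeg c n = nonNegative⁻¹ _ {{normalize-nonNeg (count c (suc n)) (g (suc n)) {{g-nonZero n}}}}

  frequency-recurrence : ∀ c φ u → Factors (is c) φ (is c) → (∀ n → (u · G) n ≡ scaled φ n) →
    ∀ n → (frequency c · G) (suc n) ≡ conv (u · G) (frequency c · G) n
  frequency-recurrence c φ u factors u≡ n = trans (frequency-* c (suc n)) (trans (scaled-recurrence (is c) φ (is c) factors n)
    (sym (conv-cong n (λ i _ → u≡ i) (λ i _ → frequency-* c i))))

  ·-⊕ : ∀ {u v φ ψ} → (∀ n → (u · G) n ≡ scaled φ n) → (∀ n → (v · G) n ≡ scaled ψ n) →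
    ∀ n → (u n + v n) * G n ≡ scaled (φ ⊕ ψ) n
  ·-⊕ {u} {v} {φ} {ψ} u≡ v≡ n = trans (*-distribʳ-+ (G n) (u n) (v n)) (trans (cong₂ _+_ (u≡ n) (v≡ n)) (sym (scaled-⊕ φ ψ n)))

  frequency->𝐚 : ∀ n → (frequency 𝐛 n + frequency 𝟏 n) * G n ≡ scaled >𝐚 n
  frequency->𝐚 = ·-⊕ {frequency 𝐛} {frequency 𝟏} {is 𝐛} {is 𝟏} (frequency-* 𝐛) (frequency-* 𝟏)

  frequency->𝟎 : ∀ n → (frequency 𝐚 n + (frequency 𝐛 n + frequency 𝟏 n)) * G n ≡ scaled >𝟎 n
  frequency->𝟎 = ·-⊕ {frequency 𝐚} {λ n → frequency 𝐛 n + frequency 𝟏 n} {is 𝐚} {>𝐚} (frequency-* 𝐚) frequency->𝐚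

  open Catalan G G0 G-rec using (G-pos)

  frequency-total : ∀ n → frequency 𝐚 n + (frequency 𝐛 n + frequency 𝟏 n) + frequency 𝟎 n ≡ 1ℚ
  frequency-total n = ≤-antisym (*-cancelʳ-≤-pos (G n) (≤-reflexive eq)) (*-cancelʳ-≤-pos (G n) (≤-reflexive (sym eq)))
    where
    instance _ = positive (G-pos n)
    eq : (frequency 𝐚 n + (frequency 𝐛 n + frequency 𝟏 n) + frequency 𝟎 n) * G n ≡ 1ℚ * G n
    eq = begin
      (u + frequency 𝟎 n) * G n         ≡⟨ *-distribʳ-+ (G n) u (frequency 𝟎 n) ⟩
      u * G n + frequency 𝟎 n * G n     ≡⟨ cong₂ _+_ (frequency->𝟎 n) (frequency-* 𝟎 n) ⟩
      scaled >𝟎 n + scaled (is 𝟎) n     ≡⟨ cong (_+ scaled (is 𝟎) n) (trans (scaled-⊕ (is 𝐚) >𝐚 n) (cong (scaled (is 𝐚) n +_) (scaled-⊕ (is 𝐛) (is 𝟏) n))) ⟩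
      scaled (is 𝐚) n + (scaled (is 𝐛) n + scaled (is 𝟏) n) + scaled (is 𝟎) n
                                        ≡⟨ solve 4 (λ p q r s → q :+ (r :+ s) :+ p := p :+ q :+ r :+ s)
                                            refl (scaled (is 𝟎) n) (scaled (is 𝐚) n) (scaled (is 𝐛) n) (scaled (is 𝟏) n) ⟩
      scaled (is 𝟎) n + scaled (is 𝐚) n + scaled (is 𝐛) n + scaled (is 𝟏) n
                                        ≡⟨ cong (λ s → s + scaled (is 𝐛) n + scaled (is 𝟏) n) (sym (scaled-⊕ (is 𝟎) (is 𝐚) n)) ⟩
      scaled (is 𝟎 ⊕ is 𝐚) n + scaled (is 𝐛) n + scaled (is 𝟏) n
                                        ≡⟨ cong (_+ scaled (is 𝟏) n) (sym (scaled-⊕ (is 𝟎 ⊕ is 𝐚) (is 𝐛) n)) ⟩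
      scaled (is 𝟎 ⊕ is 𝐚 ⊕ is 𝐛) n + scaled (is 𝟏) n ≡⟨ sym (scaled-⊕ (is 𝟎 ⊕ is 𝐚 ⊕ is 𝐛) (is 𝟏) n) ⟩
      G n                               ≡⟨ sym (*-identityˡ (G n)) ⟩
      1ℚ * G n                          ∎
      where
      open ≡-Reasoning
      u = frequency 𝐚 n + (frequency 𝐛 n + frequency 𝟏 n)

-- Interval arithmetic for the decimal expansion.

module Intervals where

  open import Data.Rational
  open import Data.Rational.Properties
  open import Defs using (sq; √-approx; √-approx-lower; √-approx-upper; √-approx-nonNeg; 0<1/k; p≤∣p∣; ∣-∣-swap)

  -- The endpoints are natural numbers, so that for suitably scaled quantities all numerical
  -- comparisons are between natural numbers and can be evaluated.
  infix 4 _∈[_,_]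
  record _∈[_,_] (p : ℚ) (l u : ℕ) : Set where
    constructor ⟨_,_⟩
    field
      above : ι l ≤ p
      below : p ≤ ι u
  open _∈[_,_]

  ∈-ι : ∀ n → ι n ∈[ n , n ]
  ∈-ι n = ⟨ ≤-refl , ≤-refl ⟩

  ∈-+ : ∀ {p q l l′ u u′} → p ∈[ l , u ] → q ∈[ l′ , u′ ] → p + q ∈[ l ℕ.+ l′ , u ℕ.+ u′ ]
  ∈-+ {p} {q} {l} {l′} {u} {u′} ⟨ l≤p , p≤u ⟩ ⟨ l′≤q , q≤u′ ⟩ =
    ⟨ subst (_≤ p + q) (sym (ι-+ l l′)) (+-mono-≤ l≤p l′≤q) , subst (p + q ≤_) (sym (ι-+ u u′)) (+-mono-≤ p≤u q≤u′) ⟩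

  ∈-* : ∀ {p q l l′ u u′} → p ∈[ l , u ] → q ∈[ l′ , u′ ] → p * q ∈[ l ℕ.* l′ , u ℕ.* u′ ]
  ∈-* {p} {q} {l} {l′} {u} {u′} ⟨ l≤p , p≤u ⟩ ⟨ l′≤q , q≤u′ ⟩ =
    ⟨ subst (_≤ p * q) (sym (ι-* l l′)) (proj₂ (0≤-* (0≤ι l , l≤p) (0≤ι l′ , l′≤q))) ,
    subst (p * q ≤_) (sym (ι-* u u′)) (proj₂ (0≤-* (≤-trans (0≤ι l) l≤p , p≤u) (≤-trans (0≤ι l′) l′≤q , q≤u′))) ⟩

  sq-mono-< : ∀ {p q} → 0ℚ ≤ p → p < q → sq p < sq q
  sq-mono-< {p} {q} 0≤p p<q = ≤-<-trans (*-monoʳ-≤-nonNeg p {{nonNegative 0≤p}} (<⇒≤ p<q))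
    (*-monoʳ-<-pos q {{positive (≤-<-trans 0≤p p<q)}} p<q)

  module _ (N : ℕ) .{{_ : ℕ.NonZero N}} where

    private M = ι N

    ι-N-inverse : M * (ℤ.+ 1 / N) ≡ 1ℚ
    ι-N-inverse = trans (*-comm M (ℤ.+ 1 / N)) (/-*-cancel 1 N)

    -- The approximant s satisfies s² ≤ q < (s + κ)² with κ ≤ 1 / N, so N s falls short of N √q by
    -- at most one unit; hence the successor in the lower condition.
    ∈-√ : ∀ {q l u} l′ u′ n → ℤ.+ 1 / suc n ≤ ℤ.+ 1 / N → 0ℚ ≤ q → sq M * q ∈[ l , u ] →
      suc l′ ℕ.* suc l′ ℕ.≤ l → u ℕ.≤ u′ ℕ.* u′ → M * √-approx n q ∈[ l′ , u′ ]
    ∈-√ {q} {l} {u} l′ u′ n κ≤ 0≤q ⟨ l≤ , ≤u ⟩ l′²≤l u≤u′² = ⟨ lower , upper ⟩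
      where
      s κ : ℚ
      s = √-approx n q
      κ = ℤ.+ 1 / suc n
      0≤Ms : 0ℚ ≤ M * s
      0≤Ms = *-nonNeg (0≤ι N) (√-approx-nonNeg n q)
      Mκ≤1 : M * κ ≤ 1ℚ
      Mκ≤1 = subst (M * κ ≤_) ι-N-inverse (*-monoˡ-≤-nonNeg M {{nonNegative (0≤ι N)}} κ≤)
      sq-* : ∀ x y → sq x * sq y ≡ sq (x * y)
      sq-* = solve 2 (λ x y → (x :* x) :* (y :* y) := (x :* y) :* (x :* y)) refl
      upper : M * s ≤ ι u′
      upper = ≮⇒≥ λ u′<Ms → <-irrefl refl (<-≤-trans (sq-mono-< (0≤ι u′) u′<Ms)
        (≤-trans (subst₂ _≤_ (sq-* M s) (cong (sq M *_) (0≤p⇒∣p∣≡p 0≤q))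
            (*-monoˡ-≤-nonNeg (sq M) {{nonNegative (*-nonNeg (0≤ι N) (0≤ι N))}} (√-approx-lower n q)))
          (≤-trans ≤u (≤-trans (ι-mono u≤u′²) (≤-reflexive (ι-* u′ u′))))))
      lower : ι l′ ≤ M * s
      lower = ≮⇒≥ λ Ms<l′ → <-irrefl refl (≤-<-trans
        (≤-trans (≤-reflexive (sym (ι-* (suc l′) (suc l′)))) (≤-trans (ι-mono l′²≤l) (≤-trans l≤
          (subst₂ _≤_ (cong (sq M *_) (0≤p⇒∣p∣≡p 0≤q)) (sq-* M (s + κ))
            (*-monoˡ-≤-nonNeg (sq M) {{nonNegative (*-nonNeg (0≤ι N) (0≤ι N))}} (<⇒≤ (√-approx-upper n q)))))))
        (subst₂ (λ x y → sq x < sq y) (sym (*-distribˡ-+ M s κ)) (sym (ι-suc l′))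
          (sq-mono-< (+-mono-≤ 0≤Ms (*-nonNeg (0≤ι N) (<⇒≤ (0<1/k n)))) (+-mono-<-≤ Ms<l′ Mκ≤1))))

    -- p approximates v / w; the bounds on v and w are scaled by N³ and N².
    module Quotient {p w v lv uv lw uw} (close : ∣ p * w - v ∣ ≤ (ℤ.+ 1 / N) * ((ℤ.+ 1 / N) * (ℤ.+ 1 / N)))
      (v∈ : M * (M * (M * v)) ∈[ lv , uv ]) (w∈ : M * (M * w) ∈[ lw , uw ]) where

      private
        cube : ∀ x → ℚ
        cube x = M * (M * (M * x))
        cube-mono : ∀ {x y} → x ≤ y → cube x ≤ cube y
        cube-mono x≤y = mono (mono (mono x≤y))
          where
          mono : ∀ {x y} → x ≤ y → M * x ≤ M * y
          mono = *-monoˡ-≤-nonNeg M {{nonNegative (0≤ι N)}}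
        ν η : ℚ
        ν = ℤ.+ 1 / N
        η = ν * (ν * ν)
        -- After scaling by N³ the tolerance is exactly one unit.
        cube-η : cube η ≡ 1ℚ
        cube-η = trans (solve 2 (λ m e → m :* (m :* (m :* (e :* (e :* e)))) := (m :* e) :* ((m :* e) :* (m :* e))) refl M ν)
          (cong (λ x → x * (x * x)) ι-N-inverse)
        cube-+ : ∀ x y → cube (x + y) ≡ cube x + cube y
        cube-+ = solve 3 (λ m x y → m :* (m :* (m :* (x :+ y))) := m :* (m :* (m :* x)) :+ m :* (m :* (m :* y))) refl M
        bound : ∀ {x y} → x - y ≤ η → cube x ≤ cube y + 1ℚ
        bound {x} {y} x-y≤η = subst₂ _≤_
          (cong cube (solve 2 (λ x y → y :+ (x :- y) := x) refl x y))
          (trans (cube-+ y η) (cong (cube y +_) cube-η))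
          (cube-mono (+-monoʳ-≤ y x-y≤η))
        pw≤ : cube (p * w) ≤ cube v + 1ℚ
        pw≤ = bound (≤-trans (p≤∣p∣ _) close)
        v≤ : cube v ≤ cube (p * w) + 1ℚ
        v≤ = bound (≤-trans (p≤∣p∣ _) (subst (_≤ η) (∣-∣-swap (p * w) v) close))
        pw≡ : ∀ d → d * cube (p * w) ≡ (d * p) * (M * (M * (M * w)))
        pw≡ d = solve 4 (λ d p w m → d :* (m :* (m :* (m :* (p :* w)))) := (d :* p) :* (m :* (m :* (m :* w)))) refl d p w M
        MW∈ : M * (M * (M * w)) ∈[ N ℕ.* lw , N ℕ.* uw ]
        MW∈ = ∈-* (∈-ι N) w∈

      -- The cross-multiplied comparison of C / D with the largest possible numerator over the
      -- smallest denominator. The added 1 is the scaled tolerance.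
      quotient-≤ : ∀ C D → 0 ℕ.< N ℕ.* lw → D ℕ.* (uv ℕ.+ 1) ℕ.≤ C ℕ.* (N ℕ.* lw) → ι D * p ≤ ι C
      quotient-≤ C D 0<Nlw le = ≮⇒≥ λ C<Dp → <-irrefl refl (<-≤-trans
        (*-monoˡ-<-pos (cube w) {{positive (<-≤-trans 0<ιNlw (above MW∈))}} C<Dp)
        (≤-trans (≤-reflexive (sym (pw≡ (ι D))))
          (≤-trans (*-monoˡ-≤-nonNeg (ι D) {{nonNegative (0≤ι D)}} (≤-trans pw≤ (below (∈-+ v∈ (∈-ι 1)))))
            (≤-trans (≤-reflexive (sym (ι-* D (uv ℕ.+ 1)))) (≤-trans (ι-mono le)
              (≤-trans (≤-reflexive (ι-* C (N ℕ.* lw))) (*-monoˡ-≤-nonNeg (ι C) {{nonNegative (0≤ι C)}} (above MW∈))))))))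
        where
        0<ιNlw : 0ℚ < ι (N ℕ.* lw)
        0<ιNlw = <-≤-trans (positive⁻¹ 1ℚ) (ι-mono 0<Nlw)

      quotient-≥ : ∀ C D → 0 ℕ.< N ℕ.* lw → C ℕ.* (N ℕ.* uw) ℕ.+ D ℕ.≤ D ℕ.* lv → ι C ≤ ι D * p
      quotient-≥ C D 0<Nlw le = ≮⇒≥ λ Dp<C → <-irrefl refl (≤-<-trans
        (≤-trans (≤-reflexive (sym (ι-+ (C ℕ.* (N ℕ.* uw)) D))) (≤-trans (ι-mono le) (≤-trans (≤-reflexive (ι-* D lv))
          (≤-trans (*-monoˡ-≤-nonNeg (ι D) {{nonNegative (0≤ι D)}} (≤-trans (above v∈) v≤))
            (≤-reflexive (trans (*-distribˡ-+ (ι D) (cube (p * w)) 1ℚ) (cong₂ _+_ (pw≡ (ι D)) (*-identityʳ (ι D)))))))))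
        (+-monoˡ-< (ι D) (<-≤-trans
          (*-monoˡ-<-pos (cube w) {{positive (<-≤-trans 0<ιNlw (above MW∈))}} Dp<C)
          (≤-trans (*-monoˡ-≤-nonNeg (ι C) {{nonNegative (0≤ι C)}} (below MW∈)) (≤-reflexive (sym (ι-* C (N ℕ.* uw))))))))
        where
        0<ιNlw : 0ℚ < ι (N ℕ.* lw)
        0<ιNlw = <-≤-trans (positive⁻¹ 1ℚ) (ι-mono 0<Nlw)

    -- The parameters enclose N √2, N β and N γ. From them come enclosures of N α, of N³ times the
    -- numerator of p⊤ and of N² times its denominator.
    module Decimals (l₂ u₂ lβ uβ lγ uγ : ℕ) where

      lα uα lv uv lw uw : ℕ
      lα = N ℕ.+ l₂ ℕ.+ lβ
      uα = N ℕ.+ u₂ ℕ.+ uβ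
      lv = (N ℕ.* 2 ℕ.+ l₂) ℕ.* lα ℕ.* (lα ℕ.+ lγ)
      uv = (N ℕ.* 2 ℕ.+ u₂) ℕ.* uα ℕ.* (uα ℕ.+ uγ)
      lw = 16 ℕ.* lβ ℕ.* lγ
      uw = 16 ℕ.* uβ ℕ.* uγ

      record Bounds : Set where
        field
          √2≥ : suc l₂ ℕ.* suc l₂ ℕ.≤ N ℕ.* N ℕ.* 2
          √2≤ : N ℕ.* N ℕ.* 2 ℕ.≤ u₂ ℕ.* u₂
          β≥ : suc lβ ℕ.* suc lβ ℕ.≤ N ℕ.* N ℕ.* 7 ℕ.+ N ℕ.* 2 ℕ.* l₂
          β≤ : N ℕ.* N ℕ.* 7 ℕ.+ N ℕ.* 2 ℕ.* u₂ ℕ.≤ uβ ℕ.* uβ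
          γ≥ : suc lγ ℕ.* suc lγ ℕ.≤ N ℕ.* N ℕ.* 16 ℕ.+ lα ℕ.* lα
          γ≤ : N ℕ.* N ℕ.* 16 ℕ.+ uα ℕ.* uα ℕ.≤ uγ ℕ.* uγ

      module Approximants (bounds : Bounds) {n s b a c}
        (κ≤ : ℤ.+ 1 / suc n ≤ ℤ.+ 1 / N) (s≡ : s ≡ √-approx n (ι 2)) (b≡ : b ≡ √-approx n (ι 7 + ι 2 * s))
        (a≡ : a ≡ 1ℚ + s + b) (c≡ : c ≡ √-approx n (ι 16 + a * a)) where

        open Bounds bounds

        NN∈ : sq M ∈[ N ℕ.* N , N ℕ.* N ]
        NN∈ = ∈-* (∈-ι N) (∈-ι N)

        s∈ : M * s ∈[ l₂ , u₂ ]
        s∈ = subst (λ s → M * s ∈[ l₂ , u₂ ]) (sym s≡) (∈-√ l₂ u₂ n κ≤ (0≤ι 2) (∈-* NN∈ (∈-ι 2)) √2≥ √2≤)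

        s-nonNeg : 0ℚ ≤ s
        s-nonNeg = subst (0ℚ ≤_) (sym s≡) (√-approx-nonNeg n (ι 2))

        b∈ : M * b ∈[ lβ , uβ ]
        b∈ = subst (λ b → M * b ∈[ lβ , uβ ]) (sym b≡) (∈-√ lβ uβ n κ≤ (+-mono-≤ (0≤ι 7) (*-nonNeg (0≤ι 2) s-nonNeg))
          (subst (_∈[ N ℕ.* N ℕ.* 7 ℕ.+ N ℕ.* 2 ℕ.* l₂ , N ℕ.* N ℕ.* 7 ℕ.+ N ℕ.* 2 ℕ.* u₂ ])
            (solve 4 (λ m s k j → (m :* m) :* k :+ (m :* j) :* (m :* s) := (m :* m) :* (k :+ j :* s)) refl M s (ι 7) (ι 2))
            (∈-+ (∈-* NN∈ (∈-ι 7)) (∈-* (∈-* (∈-ι N) (∈-ι 2)) s∈)))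
          β≥ β≤)

        a∈ : M * a ∈[ lα , uα ]
        a∈ = subst (_∈[ lα , uα ])
          (trans (solve 3 (λ m s b → m :+ m :* s :+ m :* b := m :* (con 1ℚ :+ s :+ b)) refl M s b) (cong (M *_) (sym a≡)))
          (∈-+ (∈-+ (∈-ι N) s∈) b∈)

        a-nonNeg : 0ℚ ≤ a
        a-nonNeg = subst (0ℚ ≤_) (sym a≡) (+-mono-≤ (+-mono-≤ (nonNegative⁻¹ 1ℚ) s-nonNeg)
          (subst (0ℚ ≤_) (sym b≡) (√-approx-nonNeg n (ι 7 + ι 2 * s))))

        c∈ : M * c ∈[ lγ , uγ ]
        c∈ = subst (λ c → M * c ∈[ lγ , uγ ]) (sym c≡) (∈-√ lγ uγ n κ≤ (+-mono-≤ (0≤ι 16) (*-nonNeg a-nonNeg a-nonNeg))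
          (subst (_∈[ N ℕ.* N ℕ.* 16 ℕ.+ lα ℕ.* lα , N ℕ.* N ℕ.* 16 ℕ.+ uα ℕ.* uα ])
            (solve 3 (λ m a k → (m :* m) :* k :+ (m :* a) :* (m :* a) := (m :* m) :* (k :+ a :* a)) refl M a (ι 16))
            (∈-+ (∈-* NN∈ (∈-ι 16)) (∈-* a∈ a∈)))
          γ≥ γ≤)

        v∈ : M * (M * (M * ((ι 2 + s) * a * (a + c)))) ∈[ lv , uv ]
        v∈ = subst (_∈[ lv , uv ])
          (solve 5 (λ m s a c k → (m :* k :+ m :* s) :* (m :* a) :* (m :* a :+ m :* c) := m :* (m :* (m :* ((k :+ s) :* a :* (a :+ c)))))
              refl M s a c (ι 2))
          (∈-* (∈-* (∈-+ (∈-* (∈-ι N) (∈-ι 2)) s∈) a∈) (∈-+ a∈ c∈))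

        w∈ : M * (M * (ι 16 * b * c)) ∈[ lw , uw ]
        w∈ = subst (_∈[ lw , uw ])
          (solve 4 (λ m b c k → k :* (m :* b) :* (m :* c) := m :* (m :* (k :* b :* c))) refl M b c (ι 16))
          (∈-* (∈-* (∈-ι 16) b∈) c∈)

  fraction-≤ : ∀ C D .{{_ : ℕ.NonZero D}} {p} → ι C ≤ ι D * p → ℤ.+ C / D ≤ p
  fraction-≤ C D {p} C≤Dp = *-cancelʳ-≤-pos (ι D) {{normalize-pos D 1}}
    (subst₂ _≤_ (sym (/-*-cancel C D)) (*-comm (ι D) p) C≤Dp)

  -- One further digit provides the gap that a strict inequality of reals requires: (10 C + 9) / (10
  -- D) lies 1 / (10 D) below (C + 1) / D.
  fraction-< : ∀ C D .{{_ : ℕ.NonZero D}} .{{_ : ℕ.NonZero (10 ℕ.* D)}} {p} → ι (10 ℕ.* D) * p ≤ ι (10 ℕ.* C ℕ.+ 9) →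
    p + ℤ.+ 1 / (10 ℕ.* D) ≤ ℤ.+ suc C / D
  fraction-< C D {p} h = *-cancelˡ-≤-pos (ι (10 ℕ.* D)) {{normalize-pos (10 ℕ.* D) 1}} (subst₂ _≤_
    (trans (cong (ι (10 ℕ.* D) * p +_) (sym (trans (*-comm (ι (10 ℕ.* D)) ν) (/-*-cancel 1 (10 ℕ.* D)))))
      (sym (*-distribˡ-+ (ι (10 ℕ.* D)) p ν)))
    (trans (sym (ι-+ (10 ℕ.* C ℕ.+ 9) 1)) (trans (cong ι ten)
      (trans (ι-* 10 (suc C)) (trans (cong (ι 10 *_) (sym (/-*-cancel (suc C) D)))
        (trans (solve 3 (λ k x d → k :* (x :* d) := (k :* d) :* x) refl (ι 10) (ℤ.+ suc C / D) (ι D))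
          (cong (_* (ℤ.+ suc C / D)) (sym (ι-* 10 D))))))))
    (+-monoˡ-≤ 1ℚ h))
    where
    ν : ℚ
    ν = ℤ.+ 1 / (10 ℕ.* D)
    ten : 10 ℕ.* C ℕ.+ 9 ℕ.+ 1 ≡ 10 ℕ.* suc C
    ten = trans (ℕ.+-assoc (10 ℕ.* C) 9 1) (trans (ℕ.+-comm (10 ℕ.* C) 10) (sym (ℕ.*-suc 10 C)))

-- Equational reasoning for Cauchy reals.

module Reals where

  open import Data.Rational as ℚ using (ℚ; 0ℚ; 1ℚ; ½)
  open import Defs

  eventually-× : ∀ {P Q : ℕ → Set} → Eventually P → Eventually Q → Eventually λ n → P n × Q n
  eventually-× (M , p) (N , q) = M ℕ.⊔ N , λ n ≤n → p n (ℕ.m⊔n≤o⇒m≤o M N ≤n) , q n (ℕ.m⊔n≤o⇒n≤o M N ≤n)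

  eventually-map : ∀ {P Q : ℕ → Set} → (∀ n → P n → Q n) → Eventually P → Eventually Q
  eventually-map f (N , p) = N , λ n N≤n → f n (p n N≤n)

  ∣p+q∣<halves : ∀ {p q r ε} → p ℚ.+ q ≡ r → ℚ.∣ p ∣ ℚ.< ½ ℚ.* ε → ℚ.∣ q ∣ ℚ.< ½ ℚ.* ε → ℚ.∣ r ∣ ℚ.< ε
  ∣p+q∣<halves {p} {q} {ε = ε} refl p< q< = ℚ.≤-<-trans (ℚ.∣p+q∣≤∣p∣+∣q∣ p q) (subst (ℚ.∣ p ∣ ℚ.+ ℚ.∣ q ∣ ℚ.<_) (halves ε) (ℚ.+-mono-< p< q<))

  pointwise : ∀ {x y} → (∀ n → at x n ≡ at y n) → x ≃ y
  pointwise {x} {y} eq ε 0<ε = 0 , λ n _ → subst (λ d → ℚ.∣ d ∣ ℚ.< ε)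
    (sym (trans (cong (ℚ._- at y n) (eq n)) (ℚ.+-inverseʳ (at y n)))) 0<ε

  ≃-refl : ∀ {x} → x ≃ x
  ≃-refl {x} = pointwise {x} {x} λ _ → refl

  ≃-trans : ∀ {x y z} → x ≃ y → y ≃ z → x ≃ z
  ≃-trans {x} {y} {z} x≃y y≃z ε 0<ε = eventually-map
    (λ n (p , q) → ∣p+q∣<halves (solve 3 (λ x y z → (x :- y) :+ (y :- z) := x :- z) refl (at x n) (at y n) (at z n)) p q)
    (eventually-× (x≃y (½ ℚ.* ε) (pos½ 0<ε)) (y≃z (½ ℚ.* ε) (pos½ 0<ε)))

  +-cong : ∀ {x x′ y y′} → x ≃ x′ → y ≃ y′ → x + y ≃ x′ + y′
  +-cong {x} {x′} {y} {y′} x≃ y≃ ε 0<ε = eventually-map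
    (λ n (p , q) → ∣p+q∣<halves (solve 4 (λ x x′ y y′ → (x :- x′) :+ (y :- y′) := (x :+ y) :- (x′ :+ y′))
        refl (at x n) (at x′ n) (at y n) (at y′ n)) p q)
    (eventually-× (x≃ (½ ℚ.* ε) (pos½ 0<ε)) (y≃ (½ ℚ.* ε) (pos½ 0<ε)))

  *-congˡ : ∀ z {x y} → x ≃ y → z * x ≃ z * y
  *-congˡ z {x} {y} x≃y ε 0<ε =
    let B , 0<B , z< = bounded (cauchy z)
        δ , 0<δ , Bδ≡ε = scale 0<B 0<ε
    in eventually-map
      (λ n (p , q) → subst₂ ℚ._<_
        (trans (sym (ℚ.∣p*q∣≡∣p∣*∣q∣ (at z n) (at x n ℚ.- at y n)))
          (cong ℚ.∣_∣ (solve 3 (λ x y z → z :* (x :- y) := z :* x :- z :* y) refl (at x n) (at y n) (at z n))))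
        Bδ≡ε
        (*-mono-< (ℚ.0≤∣p∣ (at z n)) (ℚ.<⇒≤ p) (ℚ.0≤∣p∣ (at x n ℚ.- at y n)) 0<B q))
      (eventually-× z< (x≃y δ 0<δ))

  -- A record, since the endpoints of x ≃ y cannot be recovered by unification.
  infix 4 _≋_
  record _≋_ (x y : ℝ) : Set where
    constructor [_]
    field equal : x ≃ y
  open _≋_ public

  record Null (x : ℝ) : Set where
    constructor [_]
    field null : x ≃ 0ℝ
  open Null public

  -- A known equation, brought to one side and multiplied by any real. Together with `_⊞_` this
  -- yields the elements of the ideal generated by the known equations.
  infixl 7 _⊗_
  _⊗_ : ∀ c {x y} → x ≋ y → Null (c * (x - y))
  null (_⊗_ c {x} {y} [ x≃y ]) = ≃-trans {c * (x - y)} {c * (y - y)} {0ℝ}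
    (*-congˡ c {x - y} {y - y} (+-cong {x} {y} { - y} { - y} x≃y (≃-refl { - y})))
    (pointwise {c * (y - y)} {0ℝ} λ n → solve 2 (λ c y → c :* (y :- y) := con 0ℚ) refl (at c n) (at y n))

  infixl 6 _⊞_
  _⊞_ : ∀ {x y} → Null x → Null y → Null (x + y)
  null (_⊞_ {x} {y} [ x≃0 ] [ y≃0 ]) = +-cong {x} {0ℝ} {y} {0ℝ} x≃0 y≃0

  -- An equation holds if its difference is a combination of known equations.
  by : ∀ {x y e} → Null e → (∀ n → at x n ℚ.- at y n ≡ at e n) → x ≋ y
  equal (by {x} {y} {e} [ e≃0 ] eq) ε 0<ε = eventually-map
    (λ n → subst (λ d → ℚ.∣ d ∣ ℚ.< ε) (trans (ℚ.+-identityʳ (at e n)) (sym (eq n)))) (e≃0 ε 0<ε)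

  exactly : ∀ {x y} → (∀ n → at x n ≡ at y n) → x ≋ y
  equal (exactly {x} {y} eq) = pointwise {x} {y} eq

  inverse : ∀ {x} (x#0 : x # 0ℝ) → x * x ⁻¹[ x#0 ] ≋ 1ℝ
  equal (inverse {x} x#0) = ⁻¹-inverse {x} x#0

  divide : ∀ {x y z} (y#0 : y # 0ℝ) → x * y ≋ z → x ≋ z ÷ y [ y#0 ]
  divide {x} {y} {z} y#0 xy≋z = by (- x ⊗ inverse {y} y#0 ⊞ y ⁻¹[ y#0 ] ⊗ xy≋z)
    λ n → solve 4 (λ x y z i → x :- z :* i := (:- x) :* (y :* i :- con 1ℚ) :+ i :* (x :* y :- z)) refl
      (at x n) (at y n) (at z n) (at (y ⁻¹[ y#0 ]) n)

  -- The difference is shown to vanish after multiplication by the positive `z`, whose inverse then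
  -- removes the factor.
  cancel : ∀ {x y e} z → 0ℝ < z → Null e → (∀ n → (at x n ℚ.- at y n) ℚ.* at z n ≡ at e n) → x ≋ y
  cancel {x} {y} {e} z 0<z e-null eq = by (- (x - y) ⊗ inverse {z} z#0 ⊞ z ⁻¹[ z#0 ] ⊗ [e])
    λ n → trans (solve 4 (λ x y z i → x :- y := (:- (x :- y)) :* (z :* i :- con 1ℚ) :+ i :* ((x :- y) :* z :- con 0ℚ)) refl
        (at x n) (at y n) (at z n) (at (z ⁻¹[ z#0 ]) n))
      (cong (λ d → (ℚ.- (at x n ℚ.- at y n)) ℚ.* (at z n ℚ.* at (z ⁻¹[ z#0 ]) n ℚ.- 1ℚ) ℚ.+ at (z ⁻¹[ z#0 ]) n ℚ.* (d ℚ.- 0ℚ)) (eq n))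
    where
    z#0 = 0<⇒# {z} 0<z
    [e] : e ≋ 0ℝ
    equal [e] = null e-null

  <⇒≤ : ∀ {x} → 0ℝ < x → 0ℝ ≤ x
  <⇒≤ {x} 0<x ε 0<ε = let δ , 0<δ , N , δ≤ = 0<⇒at {x} 0<x in
    N , λ n N≤n → ℚ.<⇒≤ (+-pos (ℚ.≤-trans (ℚ.<⇒≤ 0<δ) (δ≤ n N≤n)) 0<ε)

  √-square : ∀ x y → y ≡ √ x → 0ℝ < x → y * y ≋ x
  equal (√-square x _ refl 0<x) = √*√ {x} (<⇒≤ {x} 0<x)

  -- The limits will be the reals that have the frequencies themselves as approximants, so
  -- convergence reduces to the Cauchy property.
  converges : ∀ x → (λ n → real (at x n)) ⟶ x
  converges x ε 0<ε =
    let δ , 0<δ , M , δ≤ε = 0<⇒at {ε} 0<ε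
        N , close = cauchy x (½ ℚ.* δ) (pos½ 0<δ)
    in N , λ n N≤n → ½ ℚ.* δ , pos½ 0<δ , M ℕ.⊔ N , λ k ≤k →
      ℚ.≤-trans (ℚ.+-monoˡ-≤ (½ ℚ.* δ) (ℚ.<⇒≤ (close n k N≤n (ℕ.m⊔n≤o⇒n≤o M N ≤k))))
        (ℚ.≤-trans (ℚ.≤-reflexive (halves δ)) (δ≤ε k (ℕ.m⊔n≤o⇒m≤o M N ≤k)))

-- The quadratic equations for D and the closed forms of the limits.

module Equations where

  open import Data.Rational as ℚ using (ℚ; 0ℚ; 1ℚ; ½)
  open import Defs hiding (√2; α; β; γ; a; b; f; g; t)
  open Reals

  ¼ ⅛ : ℚ
  ¼ = ℤ.+ 1 ℚ./ 4
  ⅛ = ℤ.+ 1 ℚ./ 8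

  1/64 : ℚ
  1/64 = ℤ.+ 1 ℚ./ 64

  1/16 : ℚ
  1/16 = ℤ.+ 1 ℚ./ 16

  κ : ∀ {n} → ℕ → Polynomial n
  κ k = con (ℤ.+ k ℚ./ 1)

  -- D′ is the positive root of D′² = D D′ + 1/16, read off from (2 D′ − D)² = s².
  root : ∀ D D′ X s → X * D′ ≋ real 1/16 → D′ ≋ D + X → s * s ≋ D * D + real ¼ → 0ℝ < (D′ + X) + s →
    D′ + D′ ≋ D + s
  root D D′ X s hX hD hs pos = cancel ((D′ + X) + s) pos
    ((D′ + D′ + D + s) ⊗ hD ⊞ real (ℤ.+ 4 ℚ./ 1) ⊗ hX ⊞ - 1ℝ ⊗ hs)
    λ n → solve 4 (λ d d′ x s → (d′ :+ d′ :- (d :+ s)) :* ((d′ :+ x) :+ s) :=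
        (d′ :+ d′ :+ d :+ s) :* (d′ :- (d :+ x)) :+ κ 4 :* (x :* d′ :- con 1/16) :+ (:- con 1ℚ) :* (s :* s :- (d :* d :+ con ¼)))
      refl (at D n) (at D′ n) (at X n) (at s n)

  -- p = U p + X v means p D = X v; multiplying by 16 D and using 16 X D = 1 gives 16 D² p = v.
  -- Adding p makes the right side the frequency of all values from the given one upwards.
  limit-equation : ∀ p v U X D → D ≋ 1ℝ - U → X * D ≋ real 1/16 → p ≋ U * p + X * v →
    p * (nat 16 * (D * D) + 1ℝ) ≋ p + v
  limit-equation p v U X D hD hX hp = by
    (nat 16 * D ⊗ hp ⊞ nat 16 * v ⊗ hX ⊞ nat 16 * D * p ⊗ hD)
    λ n → solve 5 (λ p v u x d → p :* (κ 16 :* (d :* d) :+ con 1ℚ) :- (p :+ v) :=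
        κ 16 :* d :* (p :- (u :* p :+ x :* v)) :+ κ 16 :* v :* (x :* d :- con 1/16) :+ κ 16 :* d :* p :* (d :- (con 1ℚ :- u)))
      refl (at p n) (at v n) (at U n) (at X n) (at D n)

  quarter : ∀ p s → p ≋ real ½ - real ¼ * s → p ≋ real ½ - s ÷ nat 4 [ 4#0 ]
  quarter p s p≋ = by (1ℝ ⊗ p≋ ⊞ real ¼ * s ⊗ inverse {nat 4} 4#0)
    λ n → solve 3 (λ p s i → p :- (con ½ :- s :* i)
          := con 1ℚ :* (p :- (con ½ :- con ¼ :* s)) :+ con ¼ :* s :* (κ 4 :* i :- con 1ℚ)) refl
      (at p n) (at s n) (at (nat 4 ⁻¹[ 4#0 ]) n)

  module Constants {√2 β α γ : ℝ} (√2² : √2 * √2 ≋ nat 2) (β² : β * β ≋ nat 7 + nat 2 * √2) (α≋ : α ≋ 1ℝ + √2 + β)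
    (γ² : γ * γ ≋ nat 16 + α * α) (0<√2 : 0ℝ < √2) (0<β : 0ℝ < β) (0<α : 0ℝ < α) (0<γ : 0ℝ < γ)
    {D₁ D₂ D₃ X₁ X₂ X₃ : ℝ}
    (X₁D₁ : X₁ * D₁ ≋ real 1/16) (X₂D₂ : X₂ * D₂ ≋ real 1/16) (X₃D₃ : X₃ * D₃ ≋ real 1/16)
    (D₁≋ : D₁ ≋ real ½ + X₁) (D₂≋ : D₂ ≋ D₁ + X₂) (D₃≋ : D₃ ≋ D₂ + X₃)
    (0<₁ : 0ℝ < (D₁ + X₁) + real ½ * √2) (0<₂ : 0ℝ < (D₂ + X₂) + real ¼ * β) (0<₃ : 0ℝ < (D₃ + X₃) + real ⅛ * γ) where

    4D₁≋ : nat 4 * D₁ ≋ 1ℝ + √2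
    4D₁≋ = by (nat 2 ⊗ root (real ½) D₁ X₁ (real ½ * √2) X₁D₁ D₁≋ s² 0<₁)
      λ n → solve 2 (λ d s → κ 4 :* d :- (con 1ℚ :+ s) := κ 2 :* ((d :+ d) :- (con ½ :+ con ½ :* s))) refl (at D₁ n) (at √2 n)
      where
      s² : (real ½ * √2) * (real ½ * √2) ≋ real ½ * real ½ + real ¼
      s² = by (real ¼ ⊗ √2²) λ n → solve 1 (λ s → (con ½ :* s) :* (con ½ :* s) :- (con ½ :* con ½ :+ con ¼) := con ¼ :* (s :* s :- κ 2))
          refl (at √2 n)

    -- β enters because D₁² + ¼ = ((1 + √2)² + 4) / 16 = (β / 4)².
    8D₂≋ : nat 8 * D₂ ≋ α
    8D₂≋ = by (nat 4 ⊗ root D₁ D₂ X₂ (real ¼ * β) X₂D₂ D₂≋ s² 0<₂ ⊞ 1ℝ ⊗ 4D₁≋ ⊞ - 1ℝ ⊗ α≋)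
      λ n → solve 5 (λ d d′ s b a → κ 8 :* d′ :- a :=
          κ 4 :* ((d′ :+ d′) :- (d :+ con ¼ :* b)) :+ con 1ℚ :* (κ 4 :* d :- (con 1ℚ :+ s)) :+ (:- con 1ℚ) :* (a :- (con 1ℚ :+ s :+ b)))
        refl (at D₁ n) (at D₂ n) (at √2 n) (at β n) (at α n)
      where
      s² : (real ¼ * β) * (real ¼ * β) ≋ D₁ * D₁ + real ¼
      s² = by (real 1/16 ⊗ β² ⊞ (- real 1/16 * (nat 4 * D₁ + (1ℝ + √2))) ⊗ 4D₁≋ ⊞ - real 1/16 ⊗ √2²)
        λ n → solve 3 (λ d s b → (con ¼ :* b) :* (con ¼ :* b) :- (d :* d :+ con ¼) :=
            con 1/16 :* (b :* b :- (κ 7 :+ κ 2 :* s)) :+ (:- con 1/16 :* (κ 4 :* d :+ (con 1ℚ :+ s))) :* (κ 4 :* d :- (con 1ℚ :+ s)) :+ (:- con 1/16) :* (s :* s :- κ 2))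
          refl (at D₁ n) (at √2 n) (at β n)

    -- γ enters because D₂² + ¼ = (α² + 16) / 64 = (γ / 8)².
    16D₃≋ : nat 16 * D₃ ≋ α + γ
    16D₃≋ = by (nat 8 ⊗ root D₂ D₃ X₃ (real ⅛ * γ) X₃D₃ D₃≋ s² 0<₃ ⊞ 1ℝ ⊗ 8D₂≋)
      λ n → solve 4 (λ d d′ a c → κ 16 :* d′ :- (a :+ c) := κ 8 :* ((d′ :+ d′) :- (d :+ con ⅛ :* c)) :+ con 1ℚ :* (κ 8 :* d :- a))
        refl (at D₂ n) (at D₃ n) (at α n) (at γ n)
      where
      s² : (real ⅛ * γ) * (real ⅛ * γ) ≋ D₂ * D₂ + real ¼
      s² = by (real 1/64 ⊗ γ² ⊞ (- real 1/64 * (nat 8 * D₂ + α)) ⊗ 8D₂≋)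
        λ n → solve 3 (λ d a c → (con ⅛ :* c) :* (con ⅛ :* c) :- (d :* d :+ con ¼) :=
            con 1/64 :* (c :* c :- (κ 16 :+ a :* a)) :+ (:- con 1/64 :* (κ 8 :* d :+ a)) :* (κ 8 :* d :- a))
          refl (at D₂ n) (at α n) (at γ n)

    -- Expand (α - β)² = (1 + √2)² = β² - 4.
    α²+4≋ : α * α + nat 4 ≋ nat 2 * α * β
    α²+4≋ = by ((α + (1ℝ + √2) - β) ⊗ α≋ ⊞ - 1ℝ ⊗ β² ⊞ 1ℝ ⊗ √2²)
      λ n → solve 3 (λ s b a → (a :* a :+ κ 4) :- κ 2 :* a :* b :=
          (a :+ (con 1ℚ :+ s) :- b) :* (a :- (con 1ℚ :+ s :+ b)) :+ (:- con 1ℚ) :* (b :* b :- (κ 7 :+ κ 2 :* s)) :+ con 1ℚ :* (s :* s :- κ 2))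
        refl (at √2 n) (at β n) (at α n)

    module Limits {p₁ p₂ p₃ p₄ : ℝ} (total : p₁ + p₂ + p₃ + p₄ ≋ 1ℝ)
      (e₁ : p₁ * (nat 16 * (D₁ * D₁) + 1ℝ) ≋ 1ℝ)
      (e₂ : p₂ * (nat 16 * (D₂ * D₂) + 1ℝ) ≋ p₂ + p₃ + p₄)
      (e₃ : p₃ * (nat 16 * (D₃ * D₃) + 1ℝ) ≋ p₃ + p₄) where

      -- 16 D₁² + 1 = (1 + √2)² + 1 = 4 + 2 √2, whose inverse is ½ - ¼ √2.
      p₁≋ : p₁ ≋ real ½ - real ¼ * √2
      p₁≋ = cancel (nat 4 + nat 2 * √2) (0<+ {nat 4} {nat 2 * √2} (0<nat 3) (0<* {nat 2} {√2} (0<nat 1) 0<√2))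
        (1ℝ ⊗ e₁ ⊞ (- p₁ * (nat 4 * D₁ + (1ℝ + √2))) ⊗ 4D₁≋ ⊞ (real ½ - p₁) ⊗ √2²)
        λ n → solve 3 (λ p s d → (p :- (con ½ :- con ¼ :* s)) :* (κ 4 :+ κ 2 :* s) :=
            con 1ℚ :* (p :* (κ 16 :* (d :* d) :+ con 1ℚ) :- con 1ℚ)
            :+ (:- p :* (κ 4 :* d :+ (con 1ℚ :+ s))) :* (κ 4 :* d :- (con 1ℚ :+ s)) :+ (con ½ :- p) :* (s :* s :- κ 2)) refl
          (at p₁ n) (at √2 n) (at D₁ n)

      -- 4 times the equation for p₂, with 8 D₂ = α and p₂ + p₃ + p₄ = 1 - p₁.
      p₂*≋ : p₂ * (nat 2 * α * β) ≋ nat 2 + √2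
      p₂*≋ = by (nat 4 ⊗ e₂ ⊞ (- p₂ * (nat 8 * D₂ + α)) ⊗ 8D₂≋ ⊞ - p₂ ⊗ α²+4≋ ⊞ nat 4 ⊗ total ⊞ - nat 4 ⊗ p₁≋)
        λ n → solve 8 (λ p₁ p q r s d a b → p :* (κ 2 :* a :* b) :- (κ 2 :+ s) :=
            κ 4 :* (p :* (κ 16 :* (d :* d) :+ con 1ℚ) :- (p :+ q :+ r))
            :+ (:- p :* (κ 8 :* d :+ a)) :* (κ 8 :* d :- a) :+ (:- p) :* ((a :* a :+ κ 4) :- κ 2 :* a :* b)
            :+ κ 4 :* ((p₁ :+ p :+ q :+ r) :- con 1ℚ) :+ (:- κ 4) :* (p₁ :- (con ½ :- con ¼ :* s))) refl
          (at p₁ n) (at p₂ n) (at p₃ n) (at p₄ n) (at √2 n) (at D₂ n) (at α n) (at β n)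

      -- Subtracting 8 α β p₂ = 4 (2 + √2) from 8 α β (1 - p₁) = 2 α β (2 + √2) leaves (2 + √2) (2 α
      -- β - 4) = (2 + √2) α², and one factor α cancels.
      q* : nat 8 * β * (p₃ + p₄) ≋ (nat 2 + √2) * α
      q* = cancel α 0<α
        (nat 8 * α * β ⊗ total ⊞ - (nat 8 * α * β) ⊗ p₁≋ ⊞ - nat 4 ⊗ p₂*≋ ⊞ - (nat 2 + √2) ⊗ α²+4≋)
        λ n → solve 7 (λ p₁ p₂ p₃ p₄ s a b → (κ 8 :* b :* (p₃ :+ p₄) :- (κ 2 :+ s) :* a) :* a :=
            κ 8 :* a :* b :* ((p₁ :+ p₂ :+ p₃ :+ p₄) :- con 1ℚ) :+ (:- (κ 8 :* a :* b)) :* (p₁ :- (con ½ :- con ¼ :* s))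
            :+ (:- κ 4) :* (p₂ :* (κ 2 :* a :* b) :- (κ 2 :+ s)) :+ (:- (κ 2 :+ s)) :* ((a :* a :+ κ 4) :- κ 2 :* a :* b)) refl
          (at p₁ n) (at p₂ n) (at p₃ n) (at p₄ n) (at √2 n) (at α n) (at β n)

      -- 16 (16 D₃² + 1) = (α + γ)² + 16 = 2 γ (α + γ), so the equation for p₃ times 8 β reduces to
      -- `q*`.
      p₃*≋ : p₃ * (β * γ * (α + γ)) ≋ (nat 2 + √2) * α
      p₃*≋ = by (real ½ * β * nat 16 ⊗ e₃ ⊞ (- (real ½ * β * p₃) * (nat 16 * D₃ + (α + γ))) ⊗ 16D₃≋ ⊞ real ½ * β * p₃ ⊗ γ² ⊞ 1ℝ ⊗ q*)
        λ n → solve 7 (λ p₃ p₄ s d a b c → p₃ :* (b :* c :* (a :+ c)) :- (κ 2 :+ s) :* a :=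
            con ½ :* b :* κ 16 :* (p₃ :* (κ 16 :* (d :* d) :+ con 1ℚ) :- (p₃ :+ p₄))
            :+ (:- (con ½ :* b :* p₃) :* (κ 16 :* d :+ (a :+ c))) :* (κ 16 :* d :- (a :+ c))
            :+ con ½ :* b :* p₃ :* (c :* c :- (κ 16 :+ a :* a)) :+ con 1ℚ :* (κ 8 :* b :* (p₃ :+ p₄) :- (κ 2 :+ s) :* a)) refl
          (at p₃ n) (at p₄ n) (at √2 n) (at D₃ n) (at α n) (at β n) (at γ n)

      -- Eliminating p₃ from `q*` gives the factor 2 γ (α + γ) - 16 on the right, which is (α + γ)²;
      -- one α + γ cancels.
      p₄*≋ : p₄ * (nat 16 * β * γ) ≋ (nat 2 + √2) * α * (α + γ)
      p₄*≋ = cancel (α + γ) (0<+ {α} {γ} 0<α 0<γ)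
        (nat 2 * γ * (α + γ) ⊗ q* ⊞ - nat 16 ⊗ p₃*≋ ⊞ (nat 2 + √2) * α ⊗ γ²)
        λ n → solve 6 (λ p₃ p₄ s a b c → (p₄ :* (κ 16 :* b :* c) :- (κ 2 :+ s) :* a :* (a :+ c)) :* (a :+ c) :=
            κ 2 :* c :* (a :+ c) :* (κ 8 :* b :* (p₃ :+ p₄) :- (κ 2 :+ s) :* a)
            :+ (:- κ 16) :* (p₃ :* (b :* c :* (a :+ c)) :- (κ 2 :+ s) :* a) :+ (κ 2 :+ s) :* a :* (c :* c :- (κ 16 :+ a :* a))) refl
          (at p₃ n) (at p₄ n) (at √2 n) (at α n) (at β n) (at γ n)

-- Existence of the four limits and the equations between them.

module Limits (G : Seq) (G0 : G 0 ≡ ℤ.+ 1 ℚ./ 4) (G-rec : ∀ n → G (suc n) ≡ conv G G n)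
  (r₁ r₂ r₃ r₄ : Seq) (0≤r₁ : ∀ n → ℚ.0ℚ ℚ.≤ r₁ n) (0≤r₂ : ∀ n → ℚ.0ℚ ℚ.≤ r₂ n) (0≤r₃ : ∀ n → ℚ.0ℚ ℚ.≤ r₃ n) (0≤r₄ : ∀ n → ℚ.0ℚ ℚ.≤ r₄ n)
  (r-total : ∀ n → r₂ n ℚ.+ (r₃ n ℚ.+ r₄ n) ℚ.+ r₁ n ≡ ℚ.1ℚ)
  (zero₁ : r₁ 0 ℚ.* G 0 ≡ ℤ.+ 1 ℚ./ 16) (zero₂ : r₂ 0 ℚ.* G 0 ≡ ℤ.+ 1 ℚ./ 16) (zero₃ : r₃ 0 ℚ.* G 0 ≡ ℤ.+ 1 ℚ./ 16)
  (rec₁ : ∀ n → r₁ (suc n) ℚ.* G (suc n) ≡ conv ((λ n → r₂ n ℚ.+ (r₃ n ℚ.+ r₄ n)) · G) (r₁ · G) n)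
  (rec₂ : ∀ n → r₂ (suc n) ℚ.* G (suc n) ≡ conv ((λ n → r₃ n ℚ.+ r₄ n) · G) (r₂ · G) n)
  (rec₃ : ∀ n → r₃ (suc n) ℚ.* G (suc n) ≡ conv (r₄ · G) (r₃ · G) n) where

  open import Data.Rational as ℚ using (ℚ; 0ℚ; 1ℚ; ½)
  open import Defs
  open Reals
  open Equations
  open Catalan G G0 G-rec using (Z; Z→0; half<; sum-G; sum-cauchy; G-pos)

  cauchy-resp : ∀ {x y} → (∀ n → x n ≡ y n) → Cauchy x → Cauchy y
  cauchy-resp eq cx ε 0<ε = let N , close = cx ε 0<ε in N , λ m n N≤m N≤n →
    subst₂ (λ p q → ℚ.∣ p ℚ.- q ∣ ℚ.< ε) (eq m) (eq n) (close m n N≤m N≤n)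

  u₁ u₂ : Seq
  u₂ n = r₃ n ℚ.+ r₄ n
  u₁ n = r₂ n ℚ.+ u₂ n

  0≤u₂ : ∀ n → 0ℚ ℚ.≤ u₂ n
  0≤u₂ n = ℚ.+-mono-≤ (0≤r₃ n) (0≤r₄ n)

  0≤u₁ : ∀ n → 0ℚ ℚ.≤ u₁ n
  0≤u₁ n = ℚ.+-mono-≤ (0≤r₂ n) (0≤u₂ n)

  u₁≤1 : ∀ n → u₁ n ℚ.≤ 1ℚ
  u₁≤1 n = subst (u₁ n ℚ.≤_) (r-total n) (p≤p+q (u₁ n) (0≤r₁ n))

  u₂≤1 : ∀ n → u₂ n ℚ.≤ 1ℚ
  u₂≤1 n = ℚ.≤-trans (subst (u₂ n ℚ.≤_) (ℚ.+-comm (u₂ n) (r₂ n)) (p≤p+q (u₂ n) (0≤r₂ n))) (u₁≤1 n)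

  -- The frequencies add up to 1, which starts a chain: once r₁ converges, so does the rest `u₁`,
  -- and `u₁` is the sum whose convergence the next value needs.
  module First = Renewal G G0 G-rec u₁ r₁ 0≤u₁ 0≤r₁ (λ n → ℚ.≤-reflexive (r-total n)) zero₁ rec₁
    (cauchy-resp (λ n → sym (r-total n)) (cauchy 1ℝ))

  p₁ : ℝ
  p₁ = mkℝ r₁ First.ρ-cauchy

  v₁-cauchy : Cauchy u₁
  v₁-cauchy = cauchy-resp (λ n → trans (cong (ℚ._- r₁ n) (sym (r-total n))) (solve 2 (λ u r → (u :+ r) :- r := u)
      refl (u₁ n) (r₁ n)))
    (cauchy (1ℝ - p₁))

  module Second = Renewal G G0 G-rec u₂ r₂ 0≤u₂ 0≤r₂
    (λ n → subst (ℚ._≤ 1ℚ) (ℚ.+-comm (r₂ n) (u₂ n)) (u₁≤1 n)) zero₂ rec₂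
    (cauchy-resp (λ n → ℚ.+-comm (r₂ n) (u₂ n)) v₁-cauchy)

  p₂ : ℝ
  p₂ = mkℝ r₂ Second.ρ-cauchy

  v₂-cauchy : Cauchy u₂
  v₂-cauchy = cauchy-resp (λ n → solve 2 (λ r u → (r :+ u) :- r := u) refl (r₂ n) (u₂ n)) (cauchy (mkℝ u₁ v₁-cauchy - p₂))

  module Third = Renewal G G0 G-rec r₄ r₃ 0≤r₄ 0≤r₃
    (λ n → subst (ℚ._≤ 1ℚ) (ℚ.+-comm (r₃ n) (r₄ n)) (u₂≤1 n)) zero₃ rec₃
    (cauchy-resp (λ n → ℚ.+-comm (r₃ n) (r₄ n)) v₂-cauchy)

  p₃ p₄ : ℝ
  p₃ = mkℝ r₃ Third.ρ-cauchy
  p₄ = mkℝ r₄ (cauchy-resp (λ n → solve 2 (λ r u → (r :+ u) :- r := u) refl (r₃ n) (r₄ n)) (cauchy (mkℝ u₂ v₂-cauchy - p₃)))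

  total : p₁ + p₂ + p₃ + p₄ ≋ 1ℝ
  total = exactly λ n → trans
    (solve 4 (λ a b c d → a :+ b :+ c :+ d := b :+ (c :+ d) :+ a) refl (r₁ n) (r₂ n) (r₃ n) (r₄ n)) (r-total n)

  -- What each of the three renewal equations provides, so that passing to the limit is done once
  -- for all of them.
  record Solves (p v : ℝ) : Set where
    field
      p-within : ∀ n → 0≤ (at p · G) n ≤ G n
      v-within : ∀ n → 0≤ (at v · G) n ≤ G n
      sum-bound : ∀ n → sum (at v · G) n ℚ.+ sum (at p · G) n ℚ.≤ ½
      p-limit : ∀ δ → 0ℚ ℚ.< δ → Eventually λ n →
        ℚ.∣ at p n ℚ.- (sum (at v · G) n ℚ.* at p n ℚ.+ sum (at p · G) n ℚ.* at v n) ∣ ℚ.≤ δ ℚ.+ (δ ℚ.+ δ)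
      X-limit : ∀ n → ℚ.∣ sum (at p · G) n ℚ.- (1/16 ℚ.+ sum (at v · G) n ℚ.* sum (at p · G) n) ∣ ℚ.≤ Z n ℚ.+ Z n

  module _ {p v : ℝ} (r : Solves p v) where

    open Solves r

    X U D : ℝ
    X = mkℝ (sum (at p · G)) (sum-cauchy p-within)
    U = mkℝ (sum (at v · G)) (sum-cauchy v-within)
    D = 1ℝ - U

    0≤X : ∀ n → 0ℚ ℚ.≤ at X n
    0≤X n = proj₁ (sum-within n p-within)

    ½≤D : ∀ n → ½ ℚ.≤ at D n
    ½≤D n = ℚ.+-monoʳ-≤ 1ℚ (ℚ.neg-antimono-≤ (ℚ.≤-trans (p≤p+q (at U n) (0≤X n)) (sum-bound n)))

    X≋ : X ≋ real 1/16 + U * X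
    equal X≋ ε 0<ε = let N , Z≤ = Z→0 (pos½ (pos½ 0<ε)) in N , λ n N≤n →
      ℚ.≤-<-trans (ℚ.≤-trans (X-limit n) (ℚ.≤-trans (ℚ.+-mono-≤ (Z≤ n N≤n) (Z≤ n N≤n)) (ℚ.≤-reflexive (halves (½ ℚ.* ε))))) (half< 0<ε)

    XD≋ : X * D ≋ real 1/16
    XD≋ = by (1ℝ ⊗ X≋) λ n → solve 2 (λ x u → x :* (con 1ℚ :- u) :- con 1/16 := con 1ℚ :* (x :- (con 1/16 :+ u :* x)))
        refl (at X n) (at U n)

    p≋ : p ≋ U * p + X * v
    equal p≋ ε 0<ε = eventually-map (λ n ≤3δ → ℚ.≤-<-trans ≤3δ (ℚ.<-≤-trans
        (subst (ℚ._< δ ℚ.+ (δ ℚ.+ δ) ℚ.+ δ) (ℚ.+-identityʳ _) (ℚ.+-monoʳ-< (δ ℚ.+ (δ ℚ.+ δ)) (pos½ (pos½ 0<ε))))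
        (ℚ.≤-reflexive (solve 1 (λ e → let d = con ½ :* (con ½ :* e) in d :+ (d :+ d) :+ d := e) refl ε))))
      (p-limit δ (pos½ (pos½ 0<ε)))
      where δ = ½ ℚ.* (½ ℚ.* ε)

    p-equation : p * (nat 16 * (D * D) + 1ℝ) ≋ p + v
    p-equation = limit-equation p v U X D (exactly λ _ → refl) XD≋ p≋

    -- Positivity of the factor that `root` divides by; it rules out the negative root.
    positive : ∀ y → (∀ n → 0ℚ ℚ.≤ at y n) → 0ℝ < (D + X) + y
    positive y 0≤y = at⇒0< {(D + X) + y} (ℚ.positive⁻¹ ½) (0 , λ n _ →
      ℚ.≤-trans (½≤D n) (ℚ.≤-trans (p≤p+q (at D n) (0≤X n)) (p≤p+q (at D n ℚ.+ at X n) (0≤y n))))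

  v₁ v₂ : ℝ
  v₁ = mkℝ u₁ v₁-cauchy
  v₂ = mkℝ u₂ v₂-cauchy

  s₁ : Solves p₁ v₁
  s₁ = record
    { p-within = First.·G-within r₁ First.ρ-within ; v-within = First.·G-within u₁ First.u-within
    ; sum-bound = First.sum-bound ; p-limit = First.ρ-limit ; X-limit = First.X-limit }

  s₂ : Solves p₂ v₂
  s₂ = record
    { p-within = Second.·G-within r₂ Second.ρ-within ; v-within = Second.·G-within u₂ Second.u-within
    ; sum-bound = Second.sum-bound ; p-limit = Second.ρ-limit ; X-limit = Second.X-limit }

  s₃ : Solves p₃ p₄
  s₃ = record
    { p-within = Third.·G-within r₃ Third.ρ-within ; v-within = Third.·G-within r₄ Third.u-within
    ; sum-bound = Third.sum-bound ; p-limit = Third.ρ-limit ; X-limit = Third.X-limit }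

  -- For the lowest value, U + X is the whole of Σ G = ½.
  D₁≋ : D s₁ ≋ real ½ + X s₁
  D₁≋ = by (- 1ℝ ⊗ S≋) λ n → trans
      (solve 2 (λ u x → (con 1ℚ :- u) :- (con ½ :+ x) := (:- con 1ℚ) :* ((u :+ x) :- con ½))
          refl (sum (u₁ · G) n) (sum (r₁ · G) n))
      (cong (λ s → (ℚ.- 1ℚ) ℚ.* (s ℚ.- ½)) (sum-add (λ i → trans (sym (ℚ.*-distribʳ-+ (G i) (u₁ i) (r₁ i)))
          (trans (cong (ℚ._* G i) (r-total i)) (ℚ.*-identityˡ (G i)))) n))
    where
    S : ℝ
    S = mkℝ (sum G) (sum-cauchy λ n → 0≤-refl (ℚ.<⇒≤ (G-pos n)))
    S≋ : S ≋ real ½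
    equal S≋ ε 0<ε = let N , Z≤ = Z→0 (pos½ 0<ε) in N , λ n N≤n →
      ℚ.≤-<-trans (ℚ.≤-trans (sum-G n) (Z≤ n N≤n)) (half< 0<ε)

  -- The values above one value are the next value and those above it, so the previous U splits into
  -- the new X and the new U.
  next : ∀ (y z : Seq) n →
    1ℚ ℚ.- sum (z · G) n ≡ (1ℚ ℚ.- sum ((λ i → y i ℚ.+ z i) · G) n) ℚ.+ sum (y · G) n
  next y z n = trans
    (solve 2 (λ y z → con 1ℚ :- z := (con 1ℚ :- (y :+ z)) :+ y) refl (sum (y · G) n) (sum (z · G) n))
    (cong (λ s → (1ℚ ℚ.- s) ℚ.+ sum (y · G) n)
      (sum-add (λ i → sym (ℚ.*-distribʳ-+ (G i) (y i) (z i))) n))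

  D₂≋ : D s₂ ≋ D s₁ + X s₂
  D₂≋ = exactly (next r₂ u₂)

  D₃≋ : D s₃ ≋ D s₂ + X s₃
  D₃≋ = exactly (next r₃ r₄)

  module Constant {√2 β α γ : ℝ} (√2² : √2 * √2 ≋ nat 2) (β² : β * β ≋ nat 7 + nat 2 * √2) (α≋ : α ≋ 1ℝ + √2 + β)
    (γ² : γ * γ ≋ nat 16 + α * α) (0<√2 : 0ℝ < √2) (0<β : 0ℝ < β) (0<α : 0ℝ < α) (0<γ : 0ℝ < γ)
    (0≤√2 : ∀ n → 0ℚ ℚ.≤ at √2 n) (0≤β : ∀ n → 0ℚ ℚ.≤ at β n) (0≤γ : ∀ n → 0ℚ ℚ.≤ at γ n)
    (2αβ#0 : nat 2 * α * β # 0ℝ) (βγ[α+γ]#0 : β * γ * (α + γ) # 0ℝ) (16βγ#0 : nat 16 * β * γ # 0ℝ)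
    {lo hi : ℚ} (decimals : ∀ p → p * (nat 16 * β * γ) ≋ (nat 2 + √2) * α * (α + γ) → real lo ≤ p × p < real hi) where

    module K = Constants {√2} {β} {α} {γ} √2² β² α≋ γ² 0<√2 0<β 0<α 0<γ
      {D s₁} {D s₂} {D s₃} {X s₁} {X s₂} {X s₃} (XD≋ s₁) (XD≋ s₂) (XD≋ s₃) D₁≋ D₂≋ D₃≋
      (positive s₁ (real ½ * √2) λ n → *-nonNeg (ℚ.nonNegative⁻¹ ½) (0≤√2 n))
      (positive s₂ (real ¼ * β) λ n → *-nonNeg (ℚ.nonNegative⁻¹ ¼) (0≤β n))
      (positive s₃ (real ⅛ * γ) λ n → *-nonNeg (ℚ.nonNegative⁻¹ ⅛) (0≤γ n))

    open K.Limits {p₁} {p₂} {p₃} {p₄} total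
      (by (1ℝ ⊗ p-equation s₁ ⊞ 1ℝ ⊗ total) λ n → solve 5 (λ p q r s d →
          p :* (κ 16 :* (d :* d) :+ con 1ℚ) :- con 1ℚ :=
          con 1ℚ :* (p :* (κ 16 :* (d :* d) :+ con 1ℚ) :- (p :+ (q :+ (r :+ s)))) :+ con 1ℚ :* ((p :+ q :+ r :+ s) :- con 1ℚ))
        refl (r₁ n) (r₂ n) (r₃ n) (r₄ n) (at (D s₁) n))
      (by (1ℝ ⊗ p-equation s₂) λ n → solve 4 (λ p q r d →
          p :* (κ 16 :* (d :* d) :+ con 1ℚ) :- (p :+ q :+ r) := con 1ℚ :* (p :* (κ 16 :* (d :* d) :+ con 1ℚ) :- (p :+ (q :+ r))))
        refl (r₂ n) (r₃ n) (r₄ n) (at (D s₂) n))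
      (p-equation s₃) public

    result : ∃[ p⊥ ] ∃[ pᵃ ] ∃[ pᵇ ] ∃[ p⊤ ]
      ((λ n → real (r₁ n)) ⟶ p⊥) × ((λ n → real (r₂ n)) ⟶ pᵃ) × ((λ n → real (r₃ n)) ⟶ pᵇ) × ((λ n → real (r₄ n)) ⟶ p⊤)
      × p⊥ + pᵃ + pᵇ + p⊤ ≃ 1ℝ
      × p⊥ ≃ real ½ - √2 ÷ nat 4 [ 4#0 ]
      × pᵃ ≃ (nat 2 + √2) ÷ (nat 2 * α * β) [ 2αβ#0 ]
      × pᵇ ≃ ((nat 2 + √2) * α) ÷ (β * γ * (α + γ)) [ βγ[α+γ]#0 ]
      × p⊤ ≃ ((nat 2 + √2) * α * (α + γ)) ÷ (nat 16 * β * γ) [ 16βγ#0 ]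
      × real lo ≤ p⊤
      × p⊤ < real hi
    result = p₁ , p₂ , p₃ , p₄ ,
      converges p₁ , converges p₂ , converges p₃ , converges p₄ ,
      equal total ,
      equal (quarter p₁ √2 p₁≋) ,
      equal (divide {p₂} {nat 2 * α * β} {nat 2 + √2} 2αβ#0 p₂*≋) ,
      equal (divide {p₃} {β * γ * (α + γ)} {(nat 2 + √2) * α} βγ[α+γ]#0 p₃*≋) ,
      equal (divide {p₄} {nat 16 * β * γ} {(nat 2 + √2) * α * (α + γ)} 16βγ#0 p₄*≋) ,
      decimals p₄ p₄*≋

-- The numerical enclosure and the final assembly.

open import Data.Integer using (+_)
open import Data.Rational using (0ℚ; ½; _/_)
open import Data.Unit using (tt)
open import Defs
open Intervals
open Reals
open Counting

√-at : ∀ x n → at (√ x) n ≡ √-approx n (at x n)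
√-at x n = refl

-- The precision 1 / N leaves two guard digits beyond the eighteen of `C`.
N C D : ℕ
N = 100000000000000000000
C = 684122210733017786
D = 1000000000000000000

-- The bounds are N √2, N β and N γ to within a few units.
module I = Decimals N
  141421356237309504879 141421356237309504881 313503223663588347758 313503223663588347760 684062343195551120963 684062343195551120968

bounds : I.Bounds
bounds = record
  { √2≥ = ℕ.≤ᵇ⇒≤ _ _ tt ; √2≤ = ℕ.≤ᵇ⇒≤ _ _ tt
  ; β≥  = ℕ.≤ᵇ⇒≤ _ _ tt ; β≤  = ℕ.≤ᵇ⇒≤ _ _ tt
  ; γ≥  = ℕ.≤ᵇ⇒≤ _ _ tt ; γ≤  = ℕ.≤ᵇ⇒≤ _ _ tt }

module _ (p : ℝ) (p≋ : p * (nat 16 * β * γ) ≋ (nat 2 + √2) * α * (α + γ)) where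

  approximants : Eventually λ n → (ι C ℚ.≤ ι D ℚ.* at p n) × (ι (10 ℕ.* D) ℚ.* at p n ℚ.≤ ι (10 ℕ.* C ℕ.+ 9))
  -- Far enough out, the roots are approximated within 1 / N and the equation for p holds within 1 /
  -- N³, which is the tolerance of `Quotient`.
  approximants = eventually-map scaled-bounds (eventually-× (1/k→0 0<ν) (equal p≋ _ (*-pos 0<ν (*-pos 0<ν 0<ν))))
    where
    0<ν : 0ℚ ℚ.< + 1 / N
    0<ν = ℚ.positive⁻¹ _ {{ℚ.normalize-pos 1 N}}
    scaled-bounds : ∀ n → _ → _
    scaled-bounds n (κ≤ , close) = Q.quotient-≥ C D (ℕ.≤ᵇ⇒≤ _ _ tt) (ℕ.≤ᵇ⇒≤ _ _ tt) ,
      Q.quotient-≤ (10 ℕ.* C ℕ.+ 9) (10 ℕ.* D) (ℕ.≤ᵇ⇒≤ _ _ tt) (ℕ.≤ᵇ⇒≤ _ _ tt)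
      where
      module A = I.Approximants bounds {n} {at √2 n} {at β n} {at α n} {at γ n} κ≤
        (√-at (nat 2) n) (√-at (nat 7 + nat 2 * √2) n) refl (√-at (nat 16 + α * α) n)
      module Q = Quotient N {at p n} {ι 16 ℚ.* at β n ℚ.* at γ n} {(ι 2 ℚ.+ at √2 n) ℚ.* at α n ℚ.* (at α n ℚ.+ at γ n)}
        (ℚ.<⇒≤ close) A.v∈ A.w∈

  decimals : real (+ C / D) ≤ p × p < real (+ suc C / D)
  decimals = (λ ε 0<ε → eventually-map (λ n (C≤ , _) → ℚ.≤-trans (fraction-≤ C D {at p n} C≤) (p≤p+q (at p n) (ℚ.<⇒≤ 0<ε))) approximants) ,
    (+ 1 / (10 ℕ.* D) , ℚ.positive⁻¹ _ {{ℚ.normalize-pos 1 (10 ℕ.* D)}} ,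
     eventually-map (λ n (_ , ≤C) → fraction-< C D {at p n} ≤C) approximants)

open Limits G G0 G-rec (frequency 𝟎) (frequency 𝐚) (frequency 𝐛) (frequency 𝟏)
  (frequency-nonNeg 𝟎) (frequency-nonNeg 𝐚) (frequency-nonNeg 𝐛) (frequency-nonNeg 𝟏)
  frequency-total
  (frequency-* 𝟎 0) (frequency-* 𝐚 0) (frequency-* 𝐛 0)
  (frequency-recurrence 𝟎 >𝟎 (λ n → frequency 𝐚 n ℚ.+ (frequency 𝐛 n ℚ.+ frequency 𝟏 n)) factors-𝟎 frequency->𝟎)
  (frequency-recurrence 𝐚 >𝐚 (λ n → frequency 𝐛 n ℚ.+ frequency 𝟏 n) factors-𝐚 frequency->𝐚)
  (frequency-recurrence 𝐛 >𝐛 (frequency 𝟏) factors-𝐛 (frequency-* 𝟏))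

√2² : √2 * √2 ≋ nat 2
√2² = √-square (nat 2) √2 refl (0<nat 1)

β² : β * β ≋ nat 7 + nat 2 * √2
β² = √-square (nat 7 + nat 2 * √2) β refl (0<+ {nat 7} {nat 2 * √2} (0<nat 6) (0<* {nat 2} {√2} (0<nat 1) 0<√2))

α≋ : α ≋ 1ℝ + √2 + β
α≋ = exactly λ _ → refl

γ² : γ * γ ≋ nat 16 + α * α
γ² = √-square (nat 16 + α * α) γ refl (0<+ {nat 16} {α * α} (0<nat 15) (0<* {α} {α} 0<α 0<α))

theorem2 : ∃[ p⊥ ] ∃[ pᵃ ] ∃[ pᵇ ] ∃[ p⊤ ]
    (ratio f ⟶ p⊥) × (ratio a ⟶ pᵃ) × (ratio b ⟶ pᵇ) × (ratio t ⟶ p⊤)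
    × p⊥ + pᵃ + pᵇ + p⊤ ≃ 1ℝ
    × p⊥ ≃ real ½ - √2 ÷ nat 4 [ 4#0 ]
    × pᵃ ≃ (nat 2 + √2) ÷ (nat 2 * α * β) [ 2αβ#0 ]
    × pᵇ ≃ ((nat 2 + √2) * α) ÷ (β * γ * (α + γ)) [ βγ[α+γ]#0 ]
    × p⊤ ≃ ((nat 2 + √2) * α * (α + γ)) ÷ (nat 16 * β * γ) [ 16βγ#0 ]
    -- the decimal expansion 0.684122210733017786…, truncated after 18 places
    × real (+ 684122210733017786 / 1000000000000000000) ≤ p⊤
    × p⊤ < real (+ 684122210733017787 / 1000000000000000000)
theorem2 = Constant.result {√2} {β} {α} {γ} √2² β² α≋ γ² 0<√2 0<β 0<α 0<γ
  (λ n → √-approx-nonNeg n (at (nat 2) n)) (λ n → √-approx-nonNeg n (at (nat 7 + nat 2 * √2) n)) (λ n → √-approx-nonNeg n (at (nat 16 + α * α) n))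
  2αβ#0 βγ[α+γ]#0 16βγ#0 decimals
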